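{- Let $G$ be an undirected unweighted graph with $n$ vertices and maximum degree $\Delta_G$, let $c$ be a positive real constant, and let $k$ be a positive integer such that $\Delta_G \le c\, n^{\frac1k-\varepsilon}$ for some real $0<\varepsilon\le 1/k$. Then there exists an approximate distance oracle for $G$ that uses $\tilde O\!\left(c^k n^{2-\frac{k\varepsilon}{3}}\right)$ space and has a $(2,1-k)$-stretch.
   Context: For an undirected unweighted graph $G=(V,E)$, $d(u,v)$ denotes the length of a shortest path between $u$ and $v$ ($\infty$ if there is none). An approximate distance oracle (ADO) for $G$ is a data structure (word-RAM model, space counted in words) that, given any $u,v\in V$, returns in constant time an estimate $\hat d(u,v)$. For reals $\alpha>1$ and $\beta$ (where $\beta$ may be negative), the ADO has $(\alpha,\beta)$-stretch if for all $u,v\in V$: $d(u,v)\le \hat d(u,v)\le \max\{d(u,v),\ \alpha\, d(u,v)+\beta\}$. The notation $\tilde O(\cdot)$ suppresses constant factors and factors poly-logarithmic in $n$; here $c$ and $k$ are regarded as fixed constants, and the suppressed factors do not depend on $G$. -}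

module Defs where

import Algebra.Definitions.RawSemiring
open import Data.Bool.Base using (if_then_else_)
open import Data.Fin.Base using (Fin; toℕ)
open import Data.Integer.Base as ℤ using (ℤ; +_; -[1+_])
open import Data.List.Base using (List; head; drop; length; filter; map; allFin)
open import Data.List.Extrema.Nat using (max)
open import Data.Maybe.Base as Maybe using (Maybe; just; nothing; _>>=_)
open import Data.Nat.Base as ℕ using (ℕ; zero; suc; NonZero)
open import Data.Nat.DivMod using (_mod_)
open import Data.Nat.Logarithm using (⌊log₂_⌋)
open import Data.Nat.Properties using (m^n≢0; _≟_; _≤?_)
open import Data.Product.Base using (∃; _×_; _,_)
open import Data.Rational.Base as ℚ using (ℚ; 0ℚ; 1ℚ; ↥_; ↧ₙ_)
open import Data.Sum.Base using (_⊎_; inj₁; inj₂; [_,_]′)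
open import Level using (0ℓ)
open import Relation.Binary.Core using (Rel)
open import Relation.Binary.Construct.Add.Supremum.NonStrict ℤ._≤_ using (_≤⁺_)
open import Relation.Binary.Definitions using (Decidable; Irreflexive; Symmetric)
open import Relation.Binary.PropositionalEquality.Core using (_≡_)
open import Relation.Nullary.Construct.Add.Supremum using (_⁺; ⊤⁺; [_])
open import Relation.Nullary.Decidable.Core using (does)
open import Relation.Nullary.Negation.Core using (¬_)
open import Relation.Unary using (Pred; _∈_)

------------------------------------------------------------------------
-- Graphs

record Graph (n : ℕ) : Set₁ where
  field
    _~_    : Rel (Fin n) 0ℓ
    ~-sym  : Symmetric _~_
    ~-irr  : Irreflexive _≡_ _~_
    _~?_   : Decidable _~_

  degree : Fin n → ℕ
  degree u = length (filter (u ~?_) (allFin n))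

  maxDegree : ℕ
  maxDegree = max 0 (map degree (allFin n))

  data Walk : Fin n → Fin n → ℕ → Set where
    here : ∀ {u} → Walk u u 0
    step : ∀ {u v w ℓ} → u ~ v → Walk v w ℓ → Walk u w (suc ℓ)

  -- "d(u,v) = δ", where ⊤⁺ is ∞.  A walk of minimum length is a path.
  data IsDistance (u v : Fin n) : ℕ ⁺ → Set where
    finite   : ∀ {ℓ} → Walk u v ℓ → (∀ {m} → Walk u v m → ℓ ℕ.≤ m) →
               IsDistance u v [ ℓ ]
    infinite : (∀ {m} → ¬ Walk u v m) → IsDistance u v ⊤⁺

open Graph public using (maxDegree; IsDistance)

------------------------------------------------------------------------
-- Word RAM with w-bit words
--
-- The instruction set is a subset of the usual one: queries cannot write to
-- memory (they work in the registers), and there are no bitwise operations.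
-- An oracle for this machine is an oracle for any richer word RAM.

Word : ℕ → Set
Word w = Fin (2 ℕ.^ w)

toWord : ∀ w → ℕ → Word w
toWord w m = _mod_ m (2 ℕ.^ w) {{m^n≢0 2 w}}

Reg : Set
Reg = ℕ

data Op : Set where
  add sub mul div mod : Op

-- Arithmetic is modulo 2 ^ w; division and remainder by zero give zero.
arithmetic : ℕ → Op → ℕ → ℕ → ℕ
arithmetic w add x y         = x ℕ.+ y
arithmetic w sub x y         = x ℕ.+ (2 ℕ.^ w ℕ.∸ y)
arithmetic w mul x y         = x ℕ.* y
arithmetic w div x zero      = 0
arithmetic w div x y@(suc _) = x ℕ./ y
arithmetic w mod x zero      = 0
arithmetic w mod x y@(suc _) = x ℕ.% y

data Instr : Set where
  const  : (dst : Reg) → ℕ → Instr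
  arith  : Op → (dst src₁ src₂ : Reg) → Instr
  load   : (dst addr : Reg) → Instr
  jump≤  : (src₁ src₂ : Reg) (target : ℕ) → Instr
  return : (src : Reg) → Instr

Program : Set
Program = List Instr

_!?_ : {A : Set} → List A → ℕ → Maybe A
xs !? i = head (drop i xs)

module Machine (w : ℕ) (program : Program) (memory : List (Word w)) where

  Registers : Set
  Registers = Reg → Word w

  State : Set
  State = ℕ × Registers

  _[_≔_] : Registers → Reg → Word w → Registers
  (ρ [ r ≔ x ]) s = if does (s ≟ r) then x else ρ s

  -- inj₂ is the returned word; an out-of-range load fails.
  execute : State → Instr → Maybe (State ⊎ Word w)
  execute (pc , ρ) (const r m)     = just (inj₁ (suc pc , ρ [ r ≔ toWord w m ]))
  execute (pc , ρ) (arith o r s t) =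
    just (inj₁ (suc pc , ρ [ r ≔ toWord w (arithmetic w o (toℕ (ρ s)) (toℕ (ρ t))) ]))
  execute (pc , ρ) (load r a)      =
    Maybe.map (λ x → inj₁ (suc pc , ρ [ r ≔ x ])) (memory !? toℕ (ρ a))
  execute (pc , ρ) (jump≤ s t l)   =
    just (inj₁ ((if does (toℕ (ρ s) ≤? toℕ (ρ t)) then l else suc pc) , ρ))
  execute (pc , ρ) (return r)      = just (inj₂ (ρ r))

  -- The word returned within the given number of instructions, if any.
  run : ℕ → State → Maybe (Word w)
  run zero    _          = nothing
  run (suc t) σ@(pc , _) = (program !? pc) >>= execute σ >>= [ run t , just ]′

  inputs : ℕ → ℕ → Registers
  inputs x y 0 = toWord w x
  inputs x y 1 = toWord w y
  inputs x y _ = toWord w 0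

  query : (time x y : ℕ) → Maybe (Word w)
  query time x y = run time (0 , inputs x y)

------------------------------------------------------------------------
-- Approximate distance oracles

bitLength : ℕ → ℕ
bitLength n = suc ⌊log₂ n ⌋

-- Output convention: 0 stands for ∞, and d + 1 for the estimate d.
decode : ℕ → ℕ ⁺
decode zero    = ⊤⁺
decode (suc d) = [ d ]

-- The query algorithm, its running time and the factor b in the word size are
-- parameters, so that they can be fixed independently of the graph; what is
-- specific to a graph is the memory image.
record ADO (program : Program) (time b : ℕ) {n : ℕ} (G : Graph n) : Set where
  wordSize : ℕ
  wordSize = b ℕ.* bitLength n

  field
    memory   : List (Word wordSize)
    estimate : Fin n → Fin n → ℕ ⁺
    answers  : ∀ u v →
      Maybe.map (λ x → decode (toℕ x))
        (Machine.query wordSize program memory time (toℕ u) (toℕ v))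
        ≡ just (estimate u v)

  space : ℕ
  space = length memory

open ADO public using (space)

toℤ⁺ : ℕ ⁺ → ℤ ⁺
toℤ⁺ = Maybe.map +_

-- max {d , α d + β}, for α > 0
stretched : (α β : ℤ) → ℕ ⁺ → ℤ ⁺
stretched α β ⊤⁺    = ⊤⁺
stretched α β [ d ] = [ + d ℤ.⊔ (α ℤ.* + d ℤ.+ β) ]

HasStretch : (α β : ℤ) → ∀ {program time b n} {G : Graph n} →
             ADO program time b G → Set
HasStretch α β {G = G} A = ∀ u v → ∃ λ d →
  IsDistance G u v d ×
  toℤ⁺ d ≤⁺ toℤ⁺ (estimate u v) ×
  toℤ⁺ (estimate u v) ≤⁺ stretched α β d
  where open ADO A

------------------------------------------------------------------------
-- Real numbers

-- Dedekind reals
record ℝ : Set₁ where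
  field
    lower upper     : Pred ℚ 0ℓ
    lower-inhabited : ∃ λ q → q ∈ lower
    upper-inhabited : ∃ λ q → q ∈ upper
    lower-closed    : ∀ {p q} → p ℚ.< q → q ∈ lower → p ∈ lower
    upper-closed    : ∀ {p q} → p ℚ.< q → p ∈ upper → q ∈ upper
    lower-rounded   : ∀ {p} → p ∈ lower → ∃ λ q → p ℚ.< q × q ∈ lower
    upper-rounded   : ∀ {q} → q ∈ upper → ∃ λ p → p ℚ.< q × p ∈ upper
    disjoint        : ∀ {q} → q ∈ lower → ¬ q ∈ upper
    located         : ∀ {p q} → p ℚ.< q → p ∈ lower ⊎ q ∈ upper

infix 4 _<ℝ_ _ℝ≤_ _≤ᶜ_

_<ℝ_ : ℚ → ℝ → Set
q <ℝ x = q ∈ ℝ.lower x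

_ℝ≤_ : ℝ → ℚ → Set
x ℝ≤ q = ¬ (q <ℝ x)

-- Real-valued bounds.  A real is determined by the rationals exceeding it, and
-- the bounds below are only ever compared with a natural number on their left,
-- so each is represented by that set:  q ∈ X  means  X < q.
Cut : Set₁
Cut = Pred ℚ 0ℓ

fromℕ : ℕ → ℚ
fromℕ m = + m ℚ./ 1

_≤ᶜ_ : ℕ → Cut → Set
m ≤ᶜ X = ∀ q → q ∈ X → fromℕ m ℚ.≤ q

ι : ℕ → Cut
ι m q = fromℕ m ℚ.< q

⌈_⌉ : ℝ → Cut
⌈ x ⌉ = ℝ.upper x

-- p ⊖ a ⊙ x  is  p − a x,  for a ≥ 0:  it lies below r exactly when
-- p − a s < r for some rational s < x.
_⊖_⊙_ : ℚ → ℚ → ℝ → Cut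
(p ⊖ a ⊙ x) r = ∃ λ s → s <ℝ x × p ℚ.- a ℚ.* s ℚ.< r

infixl 7 _⊗_
infixr 8 _^ᶜ_ _^ˣ_ _^ℚ_

-- Product of nonnegative reals
_⊗_ : Cut → Cut → Cut
(X ⊗ Y) q = ∃ λ a → ∃ λ b → a ∈ X × b ∈ Y × a ℚ.* b ℚ.≤ q

-- Natural power of a nonnegative real
_^ᶜ_ : Cut → ℕ → Cut
X ^ᶜ zero  = ι 1
X ^ᶜ suc k = X ⊗ X ^ᶜ k

_^ℚ_ : ℚ → ℕ → ℚ
_^ℚ_ = Algebra.Definitions.RawSemiring._^_ ℚ.+-*-rawSemiring

-- n ^ r < q.  With r = i / d this says  q > 0  and  n ^ i < q ^ d.
PowerBelow : ℕ → ℚ → ℚ → Set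
PowerBelow n r q = 0ℚ ℚ.< q × compare (↥ r)
  where
  compare : ℤ → Set
  compare (+ i)    = fromℕ (n ℕ.^ i) ℚ.< q ^ℚ (↧ₙ r)
  compare -[1+ i ] = 1ℚ ℚ.< fromℕ (n ℕ.^ suc i) ℚ.* q ^ℚ (↧ₙ r)

-- Real power of a natural number n ≥ 1, as the infimum of n ^ r over rational
-- r exceeding the exponent.  (For n = 0 this gives 0 for every exponent ≥ 0.)
_^ˣ_ : ℕ → Cut → Cut
(n ^ˣ X) q = ∃ λ r → r ∈ X × PowerBelow n r q

-- Landmarks are chosen greedily: writing C(w) for the set of vertices that are
-- closer to w than to every landmark, the potential ∑|C(w)|² falls to O(n³/t²)
-- once t landmarks are chosen, because a landmark sampled proportionally to
-- |C(w)| decreases it by the right amount on average. Let r(u) be the distance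
-- of u to the landmarks. If d(u,v) > r(u) + r(v) + k − 2, the detour through
-- the landmark nearest to u or v has length at most 2 d(u,v) + 1 − k. A
-- landmark is its own detour. Every other pair is joined by a path u … w … w′ …
-- v with u ∈ C(w), v ∈ C(w′) and d(w,w′) ≤ k, so there are at most
-- (Δ+1)ᵏ·∑|C(w)|² of them, and their distances are stored in a static
-- dictionary. With t³ ≈ n² Δᵏ both the dictionary and the n × t table of
-- distances to landmarks take O(n t) = O(c^(k/3) n^(2 − kε/3)) words.

module Submission where

-- Only the existence of the tables is claimed, so every random choice becomes an average: among all
-- candidates one is taken that does at least as well as the expectation. This applies to the
-- landmarks and also to the dictionary, which consists of two levels of displacement tables instead
-- of a randomly drawn hash function. Squares enter the potential because the stored pairs are
-- counted by a quadratic form in the cluster sizes whose matrix has small row and column sums. The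
-- choice of t balances (Δ+1)ᵏ n³/t² stored pairs against n t table entries. On the side of the
-- reals, the degree hypothesis and the space bound both speak of all rationals above an exponent. A
-- rational r above 2 - kε/3 is sent to r′ = (3r - 5)/k above 1/k - ε, and an integer y above n ^ r′
-- then takes the place of n ^ (1/k - ε). The hypothesis ε ≤ 1/k appears as r > 5/3, which makes r′
-- positive.

-- Finite sums, averaging and indicator functions

module Sums where

  import Algebra.Properties.Semiring.Sum
  open import Data.Empty using (⊥-elim)
  open import Data.Bool.Base using (if_then_else_)
  open import Data.Fin.Base as F using (Fin; toℕ)
  import Data.Fin.Properties as Finₚ
  open import Data.Nat.Base using (ℕ; zero; suc; _+_; _*_; _≤_; _<_; z≤n)
  open import Data.Nat.Properties as ℕₚ
  open import Data.Nat.Tactic.RingSolver using (solve-∀)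
  open import Data.Product.Base using (∃; _,_)
  open import Data.Sum.Base using (inj₁; inj₂)
  open import Function.Base using (_∘_; _$_)
  open import Relation.Binary.PropositionalEquality
  open import Relation.Nullary.Decidable.Core using (Dec; yes; no; does)
  open import Relation.Nullary.Negation.Core using (¬_)

  private
    module ℕ∑ = Algebra.Properties.Semiring.Sum ℕₚ.+-*-semiring
    variable
      n m : ℕ
      P Q : Set

  opaque
    ∑ : ∀ n → (Fin n → ℕ) → ℕ
    ∑ n f = ℕ∑.sum f

    ∑-cong : {f g : Fin n → ℕ} → (∀ i → f i ≡ g i) → ∑ n f ≡ ∑ n g
    ∑-cong = ℕ∑.sum-cong-≗

    ∑-distrib-+ : (f g : Fin n → ℕ) → ∑ n (λ i → f i + g i) ≡ ∑ n f + ∑ n g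
    ∑-distrib-+ = ℕ∑.∑-distrib-+

    ∑-comm : (f : Fin m → Fin n → ℕ) → ∑ m (λ i → ∑ n (f i)) ≡ ∑ n (λ j → ∑ m (λ i → f i j))
    ∑-comm {m} {n} = ℕ∑.∑-comm {m} {n}

    *-distribˡ-∑ : ∀ c (f : Fin n → ℕ) → c * ∑ n f ≡ ∑ n (λ i → c * f i)
    *-distribˡ-∑ = ℕ∑.*-distribˡ-sum

    *-distribʳ-∑ : ∀ c (f : Fin n → ℕ) → ∑ n f * c ≡ ∑ n (λ i → f i * c)
    *-distribʳ-∑ = ℕ∑.*-distribʳ-sum

    ∑-suc : (f : Fin (suc n) → ℕ) → ∑ (suc n) f ≡ f F.zero + ∑ n (f ∘ F.suc)
    ∑-suc f = refl

    ∑-zero : (f : Fin 0 → ℕ) → ∑ 0 f ≡ 0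
    ∑-zero f = refl

    ∑-mono : {f g : Fin n → ℕ} → (∀ i → f i ≤ g i) → ∑ n f ≤ ∑ n g
    ∑-mono {zero}  f≤g = z≤n
    ∑-mono {suc n} f≤g = +-mono-≤ (f≤g F.zero) (∑-mono (f≤g ∘ F.suc))

    ∑-const : ∀ n c → ∑ n (λ _ → c) ≡ n * c
    ∑-const zero    c = refl
    ∑-const (suc n) c = cong (c +_) (∑-const n c)

    term≤∑ : (f : Fin n → ℕ) (i : Fin n) → f i ≤ ∑ n f
    term≤∑ f F.zero    = m≤m+n _ _
    term≤∑ f (F.suc i) = ≤-trans (term≤∑ (f ∘ F.suc) i) (m≤n+m _ _)

  ∑-syntax : ∀ n → (Fin n → ℕ) → ℕ
  ∑-syntax = ∑

  infixl 10 ∑-syntax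
  syntax ∑-syntax n (λ i → x) = ∑[ i < n ] x

  ∑-mono₂ : {f g : Fin m → Fin n → ℕ} → (∀ i j → f i j ≤ g i j) →
            ∑[ i < m ] ∑[ j < n ] f i j ≤ ∑[ i < m ] ∑[ j < n ] g i j
  ∑-mono₂ f≤g = ∑-mono λ i → ∑-mono (f≤g i)

  ∑-cong₂ : {f g : Fin m → Fin n → ℕ} → (∀ i j → f i j ≡ g i j) →
            ∑[ i < m ] ∑[ j < n ] f i j ≡ ∑[ i < m ] ∑[ j < n ] g i j
  ∑-cong₂ f≡g = ∑-cong λ i → ∑-cong (f≡g i)

  ∑-*-∑ : (f : Fin m → ℕ) (g : Fin n → ℕ) →
          ∑[ i < m ] ∑[ j < n ] (f i * g j) ≡ ∑ m f * ∑ n g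
  ∑-*-∑ f g = begin
    ∑[ i < _ ] ∑[ j < _ ] (f i * g j) ≡⟨ ∑-cong (λ i → sym (*-distribˡ-∑ (f i) g)) ⟩
    ∑[ i < _ ] (f i * ∑ _ g)          ≡⟨ sym (*-distribʳ-∑ (∑ _ g) f) ⟩
    ∑ _ f * ∑ _ g                     ∎
    where open ≡-Reasoning

  argmin-Fin : (f : Fin (suc n) → ℕ) → ∃ λ i → ∀ j → f i ≤ f j
  argmin-Fin {zero}  f = F.zero , λ { F.zero → ≤-refl }
  argmin-Fin {suc n} f with argmin-Fin (f ∘ F.suc)
  ... | i , fi≤ with ≤-total (f F.zero) (f (F.suc i))
  ... | inj₁ f0≤ = F.zero , λ { F.zero → ≤-refl ; (F.suc j) → ≤-trans f0≤ (fi≤ j) }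
  ... | inj₂ fi≤f0 = F.suc i , λ { F.zero → fi≤f0 ; (F.suc j) → fi≤ j }

  argmax-Fin : Fin n → (f : Fin n → ℕ) → ∃ λ i → ∀ j → f j ≤ f i
  argmax-Fin {suc zero}    _ f = F.zero , λ { F.zero → ≤-refl }
  argmax-Fin {suc (suc n)} _ f with argmax-Fin F.zero (f ∘ F.suc)
  ... | i , ≤fi with ≤-total (f F.zero) (f (F.suc i))
  ... | inj₁ f0≤ = F.suc i , λ { F.zero → f0≤ ; (F.suc j) → ≤fi j }
  ... | inj₂ fi≤f0 = F.zero , λ { F.zero → ≤-refl ; (F.suc j) → ≤-trans (≤fi j) fi≤f0 }

  -- The least value does not exceed the mean; this replaces a random choice of displacement.
  ∃-≤average : (f : Fin (suc n) → ℕ) → ∃ λ i → suc n * f i ≤ ∑ (suc n) f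
  ∃-≤average {n} f with argmin-Fin f
  ... | i , fi≤ = i , subst (_≤ ∑ (suc n) f) (∑-const (suc n) (f i)) (∑-mono fi≤)

  2mn≤m²+n² : ∀ m n → 2 * (m * n) ≤ m * m + n * n
  2mn≤m²+n² m n with ≤-total m n
  ... | inj₁ m≤n with d , refl ← m≤n⇒∃[o]m+o≡n m≤n =
    subst (2 * (m * n) ≤_) (lemma m d) (m≤m+n _ (d * d))
    where lemma : ∀ m d → 2 * (m * (m + d)) + d * d ≡ m * m + (m + d) * (m + d)
          lemma = solve-∀
  ... | inj₂ n≤m with d , refl ← m≤n⇒∃[o]m+o≡n n≤m =
    subst (2 * (m * n) ≤_) (lemma n d) (m≤m+n _ (d * d))
    where lemma : ∀ n d → 2 * ((n + d) * n) + d * d ≡ (n + d) * (n + d) + n * n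
          lemma = solve-∀

  -- The summed form of AM-GM, for Cauchy-Schwarz and for the count of close pairs.
  ∑∑-≤-half : (f g : Fin m → Fin n → ℕ) (h : Fin m → Fin n → ℕ) →
    (∀ i j → 2 * h i j ≤ f i j + g i j) →
    2 * ∑[ i < m ] ∑[ j < n ] h i j ≤ ∑[ i < m ] ∑[ j < n ] f i j + ∑[ i < m ] ∑[ j < n ] g i j
  ∑∑-≤-half {m} {n} f g h 2h≤ = begin
    2 * ∑[ i < m ] ∑[ j < n ] h i j                          ≡⟨ *-distribˡ-∑ 2 _ ⟩
    ∑[ i < m ] (2 * ∑[ j < n ] h i j)                        ≡⟨ ∑-cong (λ i → *-distribˡ-∑ 2 (h i)) ⟩
    ∑[ i < m ] ∑[ j < n ] (2 * h i j)                        ≤⟨ ∑-mono₂ 2h≤ ⟩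
    ∑[ i < m ] ∑[ j < n ] (f i j + g i j)                    ≡⟨ ∑-cong (λ i → ∑-distrib-+ (f i) (g i)) ⟩
    ∑[ i < m ] (∑[ j < n ] f i j + ∑[ j < n ] g i j)         ≡⟨ ∑-distrib-+ (λ i → ∑ n (f i)) (λ i → ∑ n (g i)) ⟩
    ∑[ i < m ] ∑[ j < n ] f i j + ∑[ i < m ] ∑[ j < n ] g i j ∎
    where open ≤-Reasoning

  -- Summing 2 f i f j ≤ (f i)² + (f j)² over all i and j yields twice the claim.
  cauchy-schwarz : (f : Fin n → ℕ) → ∑ n f * ∑ n f ≤ n * ∑[ i < n ] (f i * f i)
  cauchy-schwarz {n} f = *-cancelˡ-≤ 2 $ begin
    2 * (∑ n f * ∑ n f)                                       ≡⟨ cong (2 *_) (sym (∑-*-∑ f f)) ⟩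
    2 * ∑[ i < n ] ∑[ j < n ] (f i * f j)                     ≤⟨ ∑∑-≤-half (λ i _ → f i * f i) (λ _ j → f j * f j) _ (λ i j → 2mn≤m²+n² (f i) (f j)) ⟩
    ∑[ i < n ] ∑[ j < n ] (f i * f i) + ∑[ i < n ] ∑ n f²      ≡⟨ cong (_+ ∑[ i < n ] ∑ n f²) (∑-comm (λ i _ → f i * f i)) ⟩
    ∑[ i < n ] ∑ n f² + ∑[ i < n ] ∑ n f²                     ≡⟨ cong (λ z → z + z) (∑-const n (∑ n f²)) ⟩
    n * ∑ n f² + n * ∑ n f²                                   ≡⟨ lemma (n * ∑ n f²) ⟩
    2 * (n * ∑ n f²)                                          ∎
    where
    open ≤-Reasoning
    f² : Fin n → ℕ
    f² i = f i * f i
    lemma : ∀ x → x + x ≡ 2 * x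
    lemma = solve-∀

  opaque
    𝟙 : Dec P → ℕ
    𝟙 d = if does d then 1 else 0

    𝟙-true : (d : Dec P) → P → 𝟙 d ≡ 1
    𝟙-true (yes _) _ = refl
    𝟙-true (no ¬p) p = ⊥-elim (¬p p)

    𝟙-false : (d : Dec P) → ¬ P → 𝟙 d ≡ 0
    𝟙-false (yes p) ¬p = ⊥-elim (¬p p)
    𝟙-false (no _)  _  = refl

  𝟙≤1 : (d : Dec P) → 𝟙 d ≤ 1
  𝟙≤1 d@(yes p) = ≤-reflexive (𝟙-true d p)
  𝟙≤1 d@(no ¬p) = ≤-trans (≤-reflexive (𝟙-false d ¬p)) z≤n

  𝟙*≤ : (d : Dec P) {x y : ℕ} → (P → x ≤ y) → 𝟙 d * x ≤ y
  𝟙*≤ d@(yes p) {x} x≤y rewrite 𝟙-true d p | +-identityʳ x = x≤y p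
  𝟙*≤ d@(no ¬p) _ rewrite 𝟙-false d ¬p = z≤n

  𝟙*-cong : (d : Dec P) {x y : ℕ} → (P → x ≡ y) → 𝟙 d * x ≡ 𝟙 d * y
  𝟙*-cong d@(yes p) x≡y = cong (𝟙 d *_) (x≡y p)
  𝟙*-cong d@(no ¬p) _ rewrite 𝟙-false d ¬p = refl

  𝟙≤ : (d : Dec P) {x : ℕ} → (P → 1 ≤ x) → 𝟙 d ≤ x
  𝟙≤ d {x} 1≤x = subst (_≤ x) (*-identityʳ (𝟙 d)) (𝟙*≤ d 1≤x)

  𝟙-mono : (d : Dec P) (e : Dec Q) → (P → Q) → 𝟙 d ≤ 𝟙 e
  𝟙-mono d e f = 𝟙≤ d λ p → ≤-reflexive (sym (𝟙-true e (f p)))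

  ∑𝟙≤1 : {P : Fin n → Set} (P? : ∀ i → Dec (P i)) →
         (∀ {i j} → P i → P j → i ≡ j) → ∑[ i < n ] 𝟙 (P? i) ≤ 1
  ∑𝟙≤1 {zero}  P? unique = ≤-trans (≤-reflexive (∑-zero _)) z≤n
  ∑𝟙≤1 {suc n} P? unique with P? F.zero 
  ... | yes p₀ = begin
    ∑[ i < suc n ] 𝟙 (P? i)                      ≡⟨ ∑-suc (λ i → 𝟙 (P? i)) ⟩
    𝟙 (P? F.zero) + ∑[ i < n ] 𝟙 (P? (F.suc i))  ≤⟨ +-mono-≤ (𝟙≤1 (P? F.zero)) (∑-mono others) ⟩
    1 + ∑[ i < n ] 0                             ≡⟨ cong suc (trans (∑-const n 0) (*-zeroʳ n)) ⟩
    1                                            ∎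
    where
    open ≤-Reasoning
    others : ∀ i → 𝟙 (P? (F.suc i)) ≤ 0
    others i = 𝟙≤ (P? (F.suc i)) λ p → ⊥-elim (0≢1+n (cong toℕ (unique p₀ p)))
  ... | no ¬p₀ = begin
    ∑[ i < suc n ] 𝟙 (P? i)                      ≡⟨ ∑-suc (λ i → 𝟙 (P? i)) ⟩
    𝟙 (P? F.zero) + ∑[ i < n ] 𝟙 (P? (F.suc i))  ≡⟨ cong (_+ ∑[ i < n ] 𝟙 (P? (F.suc i))) (𝟙-false (P? F.zero) ¬p₀) ⟩
    ∑[ i < n ] 𝟙 (P? (F.suc i))                  ≤⟨ ∑𝟙≤1 (P? ∘ F.suc) (λ p q → Finₚ.suc-injective (unique p q)) ⟩
    1                                            ∎
    where open ≤-Reasoning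

-- Greedy choice of displacements

module Displacements where

  open Sums
  open import Data.Empty using (⊥-elim)
  open import Data.Fin.Base using (Fin; toℕ)
  import Data.Fin.Properties as Finₚ
  open import Data.Nat.Base as ℕ using (ℕ; zero; suc; _+_; _*_; _≤_; _<_)
  open import Data.Nat.Properties
  open import Data.Product.Base using (∃; _×_; _,_; proj₁; proj₂)
  open import Data.Sum.Base using (inj₁; inj₂)
  open import Relation.Binary.PropositionalEquality
  open import Relation.Nullary.Decidable.Core using (yes; no)
  open import Relation.Nullary.Negation.Core using (¬_)

  _[_↦_] : (ℕ → ℕ) → ℕ → ℕ → (ℕ → ℕ)
  (T [ g ↦ t ]) h with h ≟ g
  ... | yes _ = t
  ... | no _  = T h

  ↦-same : ∀ T g t → (T [ g ↦ t ]) g ≡ t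
  ↦-same T g t with g ≟ g
  ... | yes _ = refl
  ... | no g≢g = ⊥-elim (g≢g refl)

  ↦-other : ∀ T {g h} t → ¬ h ≡ g → (T [ g ↦ t ]) h ≡ T h
  ↦-other T {g} {h} t h≢g with h ≟ g
  ... | yes h≡g = ⊥-elim (h≢g h≡g)
  ... | no _ = refl

  before : ∀ {N} → (Fin N → ℕ) → ℕ → Fin N → Fin N → ℕ
  before group g x y = 𝟙 (group x ≟ g) * 𝟙 (group y <? g)

  clash : ∀ {N} → (Fin N → ℕ) → (Fin N → ℕ) → (ℕ → ℕ) → ℕ → ℕ → Fin N → Fin N → ℕ
  clash group off T g t x y = before group g x y * 𝟙 (off x + t ≟ off y + T (group y))

  ∑∑ : ∀ {N} → (Fin N → Fin N → ℕ) → ℕ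
  ∑∑ {N} f = ∑[ x < N ] ∑[ y < N ] f x y

  -- Averaged over all M displacements of a group, a clash with a given earlier
  -- element occurs at most once.
  displacement : ∀ {N} (group off : Fin N → ℕ) (M′ m : ℕ) → let M = suc M′ in
    ∃ λ (T : ℕ → ℕ) → ∀ g → g < m →
      T g < M × M * ∑∑ (clash group off T g (T g)) ≤ ∑∑ (before group g)
  displacement group off M′ zero = (λ _ → 0) , λ _ ()
  displacement {N} group off M′ (suc m) = T [ m ↦ toℕ t ] , bound
    where
    M = suc M′
    T = proj₁ (displacement group off M′ m)
    -- The groups below m are already placed, and group m takes the candidate with the fewest
    -- clashes against them.
    best = ∃-≤average {M′} (λ t → ∑∑ (clash group off T m (toℕ t)))
    t = proj₁ best

    -- A clash count at g consults the table only at groups below g, so changing the table at m ≥ g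
    -- does not affect it.
    stable : ∀ {g} → g ≤ m → ∀ s x y →
      clash group off (T [ m ↦ toℕ t ]) g s x y ≡ clash group off T g s x y
    stable {g} g≤m s x y = begin
      𝟙 (group x ≟ g) * 𝟙 (group y <? g) * 𝟙 (off x + s ≟ off y + (T [ m ↦ toℕ t ]) (group y))
        ≡⟨ *-assoc (𝟙 (group x ≟ g)) _ _ ⟩
      𝟙 (group x ≟ g) * (𝟙 (group y <? g) * 𝟙 (off x + s ≟ off y + (T [ m ↦ toℕ t ]) (group y)))
        ≡⟨ cong (𝟙 (group x ≟ g) *_) (𝟙*-cong (group y <? g) λ y<g →
             cong (λ z → 𝟙 (off x + s ≟ off y + z)) (↦-other T (toℕ t) (<⇒≢ (<-≤-trans y<g g≤m)))) ⟩
      𝟙 (group x ≟ g) * (𝟙 (group y <? g) * 𝟙 (off x + s ≟ off y + T (group y)))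
        ≡⟨ sym (*-assoc (𝟙 (group x ≟ g)) _ _) ⟩
      𝟙 (group x ≟ g) * 𝟙 (group y <? g) * 𝟙 (off x + s ≟ off y + T (group y)) ∎
      where open ≡-Reasoning

    average : M * ∑∑ (clash group off T m (toℕ t)) ≤ ∑∑ (before group m)
    average = begin
      M * ∑∑ (clash group off T m (toℕ t))
        ≤⟨ proj₂ best ⟩
      ∑[ s < M ] ∑[ x < N ] ∑[ y < N ] clash group off T m (toℕ s) x y
        ≡⟨ ∑-comm {M} {N} (λ s x → ∑[ y < N ] clash group off T m (toℕ s) x y) ⟩
      ∑[ x < N ] ∑[ s < M ] ∑[ y < N ] clash group off T m (toℕ s) x y
        ≡⟨ ∑-cong (λ x → ∑-comm {M} {N} (λ s y → clash group off T m (toℕ s) x y)) ⟩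
      ∑[ x < N ] ∑[ y < N ] ∑[ s < M ] clash group off T m (toℕ s) x y
        ≤⟨ ∑-mono₂ (λ x y → once x y) ⟩
      ∑∑ (before group m) ∎
      where
      open ≤-Reasoning
      once : ∀ x y → ∑[ s < M ] clash group off T m (toℕ s) x y ≤ before group m x y
      once x y = begin
        ∑[ s < M ] clash group off T m (toℕ s) x y
          ≡⟨ sym (*-distribˡ-∑ (before group m x y) (λ (s : Fin M) → 𝟙 (off x + toℕ s ≟ off y + T (group y)))) ⟩
        before group m x y * ∑[ s < M ] 𝟙 (off x + toℕ s ≟ off y + T (group y))
          ≤⟨ *-monoʳ-≤ (before group m x y) (∑𝟙≤1 {M} (λ s → off x + toℕ s ≟ off y + T (group y))
               λ p q → Finₚ.toℕ-injective (+-cancelˡ-≡ (off x) _ _ (trans p (sym q)))) ⟩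
        before group m x y * 1
          ≡⟨ *-identityʳ _ ⟩
        before group m x y ∎

    bound : ∀ g → g < suc m → (T [ m ↦ toℕ t ]) g < M ×
      M * ∑∑ (clash group off (T [ m ↦ toℕ t ]) g ((T [ m ↦ toℕ t ]) g)) ≤ ∑∑ (before group g)
    bound g g<1+m with m≤n⇒m<n∨m≡n (ℕ.s≤s⁻¹ g<1+m)
    ... | inj₁ g<m rewrite ↦-other T (toℕ t) (<⇒≢ g<m) =
      proj₁ IH , subst (λ z → M * z ≤ _) (sym (∑-cong₂ (stable (<⇒≤ g<m) (T g)))) (proj₂ IH)
      where IH = proj₂ (displacement group off M′ m) g g<m
    ... | inj₂ refl rewrite ↦-same T m (toℕ t) =
      Finₚ.toℕ<n t , subst (λ z → M * z ≤ _) (sym (∑-cong₂ (stable ≤-refl (toℕ t)))) average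

-- Perfect hashing of a sparse matrix by double displacement

module DoubleDisplacement where

  open Sums
  open Displacements
  open import Data.Empty using (⊥-elim)
  open import Data.Fin.Base using (Fin; toℕ; fromℕ<)
  import Data.Fin.Properties as Finₚ
  open import Data.Nat.Base using (ℕ; suc; _+_; _*_; _∸_; _≤_; _<_; z≤n; s≤s)
  open import Data.Nat.Properties
  open import Data.Product.Base using (∃₂; _×_; _,_; proj₁; proj₂)
  open import Function.Base using (_$_)
  open import Relation.Binary.PropositionalEquality
  open import Relation.Binary.Definitions using (tri<; tri≈; tri>)
  open import Relation.Nullary.Decidable.Core using (yes; no)
  open import Relation.Nullary.Negation.Core using (¬_)

  -- These are two-digit numbers in base X, and the leading digit decides.
  lex-< : ∀ {a b X f h} → f < X → a < b → a * X + f < b * X + h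
  lex-< {a} {b} {X} {f} {h} f<X a<b = begin-strict
    a * X + f <⟨ +-monoʳ-< (a * X) f<X ⟩
    a * X + X ≡⟨ +-comm (a * X) X ⟩
    suc a * X ≤⟨ *-monoˡ-≤ X a<b ⟩
    b * X     ≤⟨ m≤m+n _ h ⟩
    b * X + h ∎
    where open ≤-Reasoning

  lex-injective : ∀ {a b X f h} → f < X → h < X → a * X + f ≡ b * X + h → f ≡ h
  lex-injective {a} {b} {X} {f} {h} f<X h<X eq with <-cmp a b
  ... | tri< a<b _ _ = ⊥-elim (<⇒≢ (lex-< {a} {b} f<X a<b) eq)
  ... | tri≈ _ refl _ = +-cancelˡ-≡ (a * X) f h eq
  ... | tri> _ _ b<a = ⊥-elim (<⇒≢ (lex-< {b} {a} h<X b<a) (sym eq))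

  -- The double displacement of Tarjan and Yao.  The first level leaves few
  -- collisions, and the second one then displaces the buckets in order of
  -- decreasing load, so that no collision remains.
  double-displacement : ∀ {N n} (row col : Fin N → ℕ) →
    (∀ x → row x < n) → (∀ x → col x < n) →
    (∀ {x y} → row x ≡ row y → col x ≡ col y → x ≡ y) →
    ∃₂ λ (T R : ℕ → ℕ) →
      (∀ v → v < n → T v < suc N) ×
      (∀ f → f < n + suc N → R f < suc (3 * N)) ×
      (∀ {x y} → R (row x + T (col x)) + col x ≡ R (row y + T (col y)) + col y → x ≡ y)
  double-displacement {N} {n} row col row< col< injective =
    T , R , (λ v v<n → proj₁ (T-good v v<n)) ,
    (λ f f<X → proj₁ (R̃-good (key f) (key< f f<X))) , pos-injective
    where
    open ≤-Reasoning
    -- The first level shifts column v by T v, and `f` below is the shifted row.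
    level₁ = displacement col row N n
    T      = proj₁ level₁
    T-good = proj₂ level₁

    f : Fin N → ℕ
    f x = row x + T (col x)

    X : ℕ
    X = n + suc N

    f<X : ∀ x → f x < X
    f<X x = +-mono-<-≤ (row< x) (<⇒≤ (proj₁ (T-good (col x) (col< x))))

    size : ℕ → ℕ
    size g = ∑[ x < N ] 𝟙 (col x ≟ g)

    -- Each element of the column meets at most N earlier elements, and the average is over N + 1
    -- shifts.
    clash≤size : ∀ g → g < n → ∑∑ (clash col row T g (T g)) ≤ size g
    clash≤size g g<n = *-cancelˡ-≤ (suc N) $ begin
      suc N * ∑∑ (clash col row T g (T g))
        ≤⟨ proj₂ (T-good g g<n) ⟩
      ∑[ x < N ] ∑[ y < N ] (𝟙 (col x ≟ g) * 𝟙 (col y <? g))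
        ≤⟨ ∑-mono₂ (λ x y → *-monoʳ-≤ (𝟙 (col x ≟ g)) (𝟙≤1 (col y <? g))) ⟩
      ∑[ x < N ] ∑[ y < N ] (𝟙 (col x ≟ g) * 1)
        ≡⟨ ∑-cong (λ x → trans (∑-const N _) (cong (N *_) (*-identityʳ _))) ⟩
      ∑[ x < N ] (N * 𝟙 (col x ≟ g))
        ≡⟨ sym (*-distribˡ-∑ N (λ x → 𝟙 (col x ≟ g))) ⟩
      N * size g
        ≤⟨ *-monoˡ-≤ (size g) (n≤1+n N) ⟩
      suc N * size g ∎

    ∑size≤N : ∑[ g < n ] size (toℕ g) ≤ N
    ∑size≤N = begin
      ∑[ g < n ] ∑[ x < N ] 𝟙 (col x ≟ toℕ g)
        ≡⟨ ∑-comm (λ (g : Fin n) x → 𝟙 (col x ≟ toℕ g)) ⟩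
      ∑[ x < N ] ∑[ g < n ] 𝟙 (col x ≟ toℕ g)
        ≤⟨ ∑-mono (λ x → ∑𝟙≤1 (λ (g : Fin n) → col x ≟ toℕ g)
             λ p q → Finₚ.toℕ-injective (trans (sym p) q)) ⟩
      ∑[ x < N ] 1
        ≡⟨ trans (∑-const N 1) (*-identityʳ N) ⟩
      N ∎

    cross : Fin N → Fin N → ℕ
    cross x y = 𝟙 (col y <? col x) * 𝟙 (f x ≟ f y)

    ∑cross≤N : ∑∑ cross ≤ N
    ∑cross≤N = begin
      ∑∑ cross
        ≤⟨ ∑-mono₂ (λ x y → cross≤ x y) ⟩
      ∑[ x < N ] ∑[ y < N ] ∑[ g < n ] clash col row T (toℕ g) (T (toℕ g)) x y
        ≡⟨ ∑-cong (λ x → ∑-comm (λ y (g : Fin n) → clash col row T (toℕ g) (T (toℕ g)) x y)) ⟩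
      ∑[ x < N ] ∑[ g < n ] ∑[ y < N ] clash col row T (toℕ g) (T (toℕ g)) x y
        ≡⟨ ∑-comm (λ x (g : Fin n) → ∑[ y < N ] clash col row T (toℕ g) (T (toℕ g)) x y) ⟩
      ∑[ g < n ] ∑∑ (clash col row T (toℕ g) (T (toℕ g)))
        ≤⟨ ∑-mono (λ (g : Fin n) → clash≤size (toℕ g) (Finₚ.toℕ<n g)) ⟩
      ∑[ g < n ] size (toℕ g)
        ≤⟨ ∑size≤N ⟩
      N ∎
      where
      cross≤ : ∀ x y → cross x y ≤ ∑[ g < n ] clash col row T (toℕ g) (T (toℕ g)) x y
      cross≤ x y = begin
        𝟙 (col y <? col x) * 𝟙 (f x ≟ f y)
          ≡⟨ cong (_* 𝟙 (f x ≟ f y)) (sym (*-identityˡ (𝟙 (col y <? col x)))) ⟩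
        1 * 𝟙 (col y <? col x) * 𝟙 (f x ≟ f y)
          ≡⟨ cong (λ z → z * 𝟙 (col y <? col x) * 𝟙 (f x ≟ f y)) (sym (𝟙-true (col x ≟ col x) refl)) ⟩
        clash col row T (col x) (T (col x)) x y
          ≡⟨ cong (λ g → clash col row T g (T g) x y) (sym (Finₚ.toℕ-fromℕ< (col< x))) ⟩
        clash col row T (toℕ g) (T (toℕ g)) x y
          ≤⟨ term≤∑ (λ (g : Fin n) → clash col row T (toℕ g) (T (toℕ g)) x y) g ⟩
        ∑[ g < n ] clash col row T (toℕ g) (T (toℕ g)) x y ∎
        where g = fromℕ< (col< x)

    collisions : ℕ
    collisions = ∑[ x < N ] ∑[ y < N ] 𝟙 (f x ≟ f y)

    -- The diagonal contributes N and each of the two orders of the columns at most N. Distinct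
    -- elements of one column never collide, because a common shift keeps their rows apart.
    collisions≤ : collisions ≤ 3 * N
    collisions≤ = begin
      collisions
        ≤⟨ ∑-mono₂ split ⟩
      ∑[ x < N ] ∑[ y < N ] (𝟙 (x Finₚ.≟ y) + (cross x y + cross y x))
        ≡⟨ ∑-cong (λ x → ∑-distrib-+ (λ y → 𝟙 (x Finₚ.≟ y)) (λ y → cross x y + cross y x)) ⟩
      ∑[ x < N ] (∑[ y < N ] 𝟙 (x Finₚ.≟ y) + ∑[ y < N ] (cross x y + cross y x))
        ≡⟨ ∑-distrib-+ (λ x → ∑[ y < N ] 𝟙 (x Finₚ.≟ y)) (λ x → ∑[ y < N ] (cross x y + cross y x)) ⟩
      ∑[ x < N ] ∑[ y < N ] 𝟙 (x Finₚ.≟ y) + ∑[ x < N ] ∑[ y < N ] (cross x y + cross y x)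
        ≤⟨ +-mono-≤ diagonal off-diagonal ⟩
      N + (N + N)
        ≡⟨ cong (λ z → N + (N + z)) (sym (+-identityʳ N)) ⟩
      3 * N ∎
      where
      diagonal : ∑[ x < N ] ∑[ y < N ] 𝟙 (x Finₚ.≟ y) ≤ N
      diagonal = begin
        ∑[ x < N ] ∑[ y < N ] 𝟙 (x Finₚ.≟ y) ≤⟨ ∑-mono (λ x → ∑𝟙≤1 (x Finₚ.≟_) λ p q → trans (sym p) q) ⟩
        ∑[ x < N ] 1                         ≡⟨ trans (∑-const N 1) (*-identityʳ N) ⟩
        N                                    ∎
      off-diagonal : ∑[ x < N ] ∑[ y < N ] (cross x y + cross y x) ≤ N + N
      off-diagonal = begin
        ∑[ x < N ] ∑[ y < N ] (cross x y + cross y x)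
          ≡⟨ ∑-cong (λ x → ∑-distrib-+ (cross x) (λ y → cross y x)) ⟩
        ∑[ x < N ] (∑[ y < N ] cross x y + ∑[ y < N ] cross y x)
          ≡⟨ ∑-distrib-+ (λ x → ∑[ y < N ] cross x y) (λ x → ∑[ y < N ] cross y x) ⟩
        ∑∑ cross + ∑[ x < N ] ∑[ y < N ] cross y x
          ≡⟨ cong (∑∑ cross +_) (∑-comm (λ x y → cross y x)) ⟩
        ∑∑ cross + ∑∑ cross
          ≤⟨ +-mono-≤ ∑cross≤N ∑cross≤N ⟩
        N + N ∎
      split : ∀ x y → 𝟙 (f x ≟ f y) ≤ 𝟙 (x Finₚ.≟ y) + (cross x y + cross y x)
      split x y = 𝟙≤ (f x ≟ f y) λ fx≡fy → case fx≡fy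
        where
        case : f x ≡ f y → 1 ≤ 𝟙 (x Finₚ.≟ y) + (cross x y + cross y x)
        case fx≡fy with <-cmp (col x) (col y)
        ... | tri< x<y _ _ = ≤-trans (≤-reflexive (sym (cong₂ _*_ (𝟙-true (col x <? col y) x<y) (𝟙-true (f y ≟ f x) (sym fx≡fy)))))
                               (≤-trans (m≤n+m _ (cross x y)) (m≤n+m _ (𝟙 (x Finₚ.≟ y))))
        ... | tri> _ _ y<x = ≤-trans (≤-reflexive (sym (cong₂ _*_ (𝟙-true (col y <? col x) y<x) (𝟙-true (f x ≟ f y) fx≡fy))))
                               (≤-trans (m≤m+n _ (cross y x)) (m≤n+m _ (𝟙 (x Finₚ.≟ y))))
        ... | tri≈ _ cx≡cy _ = ≤-trans (≤-reflexive (sym (𝟙-true (x Finₚ.≟ y) x≡y))) (m≤m+n _ _)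
          where x≡y = injective (+-cancelʳ-≡ (T (col x)) (row x) (row y)
                                  (trans fx≡fy (cong (λ c → row y + T c) (sym cx≡cy)))) cx≡cy

    load : ℕ → ℕ
    load h = ∑[ z < N ] 𝟙 (f z ≟ h)

    load≤N : ∀ h → load h ≤ N
    load≤N h = ≤-trans (∑-mono (λ z → 𝟙≤1 (f z ≟ h))) (≤-reflexive (trans (∑-const N 1) (*-identityʳ N)))

    -- A lexicographic code: heavier buckets come first, and the summand h tells buckets of equal
    -- load apart.
    key : ℕ → ℕ
    key h = (N ∸ load h) * X + h

    key< : ∀ h → h < X → key h < suc N * X
    key< h h<X = subst (key h <_) (+-identityʳ _) (lex-< {N ∸ load h} {suc N} h<X (s≤s (m∸n≤m N (load h))))

    key-antitone : ∀ x y → key (f y) < key (f x) → load (f x) ≤ load (f y)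
    key-antitone x y ky<kx = ≮⇒≥ λ ly<lx →
      <-asym ky<kx (lex-< {N ∸ load (f x)} {N ∸ load (f y)} (f<X x) (∸-monoʳ-< ly<lx (load≤N (f x))))

    id : Fin N → ℕ
    id x = key (f x)

    -- Now the groups are the buckets of equal shifted row, and the offsets are the columns. At most
    -- 3 N pairs spread over 3 N + 1 displacements average to less than one clash, hence to none.
    level₂ = displacement id col (3 * N) (suc N * X)
    R̃ = proj₁ level₂
    R̃-good = proj₂ level₂

    R : ℕ → ℕ
    R h = R̃ (key h)

    -- The bucket placed at g is no larger than the bucket of any y placed before it. So the pairs
    -- number at most the sum over y of the load of its bucket, and that sum counts collisions.
    before≤ : ∀ g → ∑∑ (before id g) ≤ 3 * N
    before≤ g = begin
      ∑∑ (before id g)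
        ≡⟨ ∑-comm (before id g) ⟩
      ∑[ y < N ] ∑[ x < N ] (𝟙 (id x ≟ g) * 𝟙 (id y <? g))
        ≡⟨ ∑-cong (λ y → trans (sym (*-distribʳ-∑ (𝟙 (id y <? g)) (λ x → 𝟙 (id x ≟ g)))) (*-comm _ (𝟙 (id y <? g)))) ⟩
      ∑[ y < N ] (𝟙 (id y <? g) * ∑[ x < N ] 𝟙 (id x ≟ g))
        ≤⟨ ∑-mono (λ y → 𝟙*≤ (id y <? g) (bucket y)) ⟩
      ∑[ y < N ] load (f y)
        ≡⟨ ∑-comm (λ y z → 𝟙 (f z ≟ f y)) ⟩
      collisions
        ≤⟨ collisions≤ ⟩
      3 * N ∎
      where
      bucket : ∀ y → id y < g → ∑[ x < N ] 𝟙 (id x ≟ g) ≤ load (f y)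
      bucket y idy<g with Finₚ.any? (λ x → id x ≟ g)
      ... | yes (x₀ , refl) = begin
        ∑[ x < N ] 𝟙 (id x ≟ id x₀) ≤⟨ ∑-mono (λ x → 𝟙-mono (id x ≟ id x₀) (f x ≟ f x₀)
                                         (lex-injective {N ∸ load (f x)} {N ∸ load (f x₀)} (f<X x) (f<X x₀))) ⟩
        load (f x₀)                 ≤⟨ key-antitone x₀ y idy<g ⟩
        load (f y)                  ∎
      ... | no none = begin
        ∑[ x < N ] 𝟙 (id x ≟ g) ≤⟨ ∑-mono (λ x → 𝟙≤ (id x ≟ g) {0} λ idx≡g → ⊥-elim (none (x , idx≡g))) ⟩
        ∑[ x < N ] 0            ≡⟨ trans (∑-const N 0) (*-zeroʳ N) ⟩
        0                       ≤⟨ z≤n ⟩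
        load (f y)              ∎

    no-clash : ∀ x y → id y < id x → ¬ col x + R̃ (id x) ≡ col y + R̃ (id y)
    no-clash x y idy<idx eq = <⇒≱ (n<1+n (3 * N)) $ begin
      suc (3 * N)
        ≡⟨ sym (*-identityʳ _) ⟩
      suc (3 * N) * 1
        ≡⟨ cong (suc (3 * N) *_) (sym (cong₂ _*_ (cong₂ _*_ (𝟙-true (id x ≟ id x) refl) (𝟙-true (id y <? id x) idy<idx))
             (𝟙-true (col x + R̃ (id x) ≟ col y + R̃ (id y)) eq))) ⟩
      suc (3 * N) * clash id col R̃ (id x) (R̃ (id x)) x y
        ≤⟨ *-monoʳ-≤ (suc (3 * N)) (≤-trans (term≤∑ (clash id col R̃ (id x) (R̃ (id x)) x) y)
             (term≤∑ (λ x′ → ∑[ y < N ] clash id col R̃ (id x) (R̃ (id x)) x′ y) x)) ⟩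
      suc (3 * N) * ∑∑ (clash id col R̃ (id x) (R̃ (id x)))
        ≤⟨ proj₂ (R̃-good (id x) (key< (f x) (f<X x))) ⟩
      ∑∑ (before id (id x))
        ≤⟨ before≤ (id x) ⟩
      3 * N ∎

    pos-injective : ∀ {x y} → R (f x) + col x ≡ R (f y) + col y → x ≡ y
    pos-injective {x} {y} eq with <-cmp (id x) (id y)
    ... | tri< idx<idy _ _ = ⊥-elim (no-clash y x idx<idy (trans (+-comm (col y) _) (trans (sym eq) (+-comm (R (f x)) _))))
    ... | tri> _ _ idy<idx = ⊥-elim (no-clash x y idy<idx (trans (+-comm (col x) _) (trans eq (+-comm (R (f y)) _))))
    -- Within a bucket the second displacement is constant, so equal positions force equal columns
    -- and then equal rows.
    ... | tri≈ _ idx≡idy _ = injective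
        (+-cancelʳ-≡ (T (col x)) (row x) (row y) (trans fx≡fy (cong (λ c → row y + T c) (sym cx≡cy)))) cx≡cy
      where
      fx≡fy : f x ≡ f y
      fx≡fy = lex-injective {N ∸ load (f x)} {N ∸ load (f y)} (f<X x) (f<X y) idx≡idy
      cx≡cy : col x ≡ col y
      cx≡cy = +-cancelˡ-≡ (R (f x)) (col x) (col y) (trans eq (cong (λ h → R h + col y) (sym fx≡fy)))

-- Greedy landmarks and the decay of the energy

module Landmarks where

  open Sums
  open import Data.Empty using (⊥-elim)
  open import Data.Fin.Base using (Fin)
  open import Data.List.Base using (List; []; _∷_; length)
  open import Data.List.Extrema.Nat using (argmin; argmin-sel; f[argmin]≤v⁺)
  open import Data.List.Membership.Propositional using (_∈_; lose)
  open import Data.List.Relation.Unary.Any using (here; there)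
  open import Data.Nat.Base using (ℕ; zero; suc; _+_; _*_; _≤_; _<_; z≤n)
  open import Data.Nat.Properties
  open import Data.Nat.Tactic.RingSolver using (solve-∀)
  open import Data.Product.Base using (∃; _×_; _,_; proj₁; proj₂)
  open import Data.Sum.Base using (inj₁; inj₂)
  open import Function.Base using (_$_)
  open import Relation.Binary.PropositionalEquality
  open import Relation.Nullary.Decidable.Core using (yes; no; does)

  m²≤n²⇒m≤n : ∀ {m n} → m * m ≤ n * n → m ≤ n
  m²≤n²⇒m≤n m²≤n² = ≮⇒≥ λ n<m → <⇒≱ (*-mono-< n<m n<m) m²≤n²

  -- The size of the Thorup-Zwick cluster of w, when r is the distance to the landmarks.
  cluster : ∀ {n} → (Fin n → Fin n → ℕ) → (Fin n → ℕ) → Fin n → ℕ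
  cluster {n} δ r w = ∑[ u < n ] 𝟙 (δ w u <? r u)

  energy : ∀ {n} → (Fin n → Fin n → ℕ) → (Fin n → ℕ) → ℕ
  energy {n} δ r = ∑[ w < n ] (cluster δ r w * cluster δ r w)

  -- Sampling w₀ proportionally to the size of its cluster, the expected decrease
  -- of the energy is at least energy² / (2 n ∑ cluster); the maximiser does as well.
  energy-step : ∀ {n} (δ : Fin n → Fin n → ℕ) (r : Fin n → ℕ) → Fin n →
    let Y = 2 * n * ∑ n (cluster δ r) in
    ∃ λ w₀ → ∀ r′ → (∀ u → r′ u ≤ r u) → (∀ u → r′ u ≤ δ w₀ u) →
      energy δ r′ * Y + energy δ r * energy δ r ≤ Y * energy δ r
  energy-step {n} δ r a₀ = w₀ , decrease
    where
    open ≤-Reasoning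

    C : Fin n → ℕ
    C = cluster δ r

    I : Fin n → Fin n → ℕ
    I w u = 𝟙 (δ w u <? r u)

    L : Fin n → Fin n → Fin n → ℕ
    L w₀ w u = 𝟙 (δ w₀ u ≤? δ w u)

    -- The vertices counted here leave the cluster of w once w₀ becomes a landmark, since their new
    -- radius is at most their distance to w.
    K : Fin n → Fin n → ℕ
    K w₀ w = ∑[ u < n ] (I w u * (I w₀ u * L w₀ w u))

    kill : Fin n → ℕ
    kill w₀ = ∑[ w < n ] (C w * K w₀ w)

    w₀ = proj₁ (argmax-Fin a₀ kill)
    kill≤ = proj₂ (argmax-Fin a₀ kill)

    Φ = ∑ n C
    Ψ = energy δ r

    β : Fin n → ℕ
    β u = ∑[ w < n ] (C w * I w u)

    q : Fin n → Fin n → Fin n → ℕ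
    q u w w₀ = C w₀ * (C w * (I w u * (I w₀ u * L w₀ w u)))

    Ψ≡∑β : Ψ ≡ ∑ n β
    Ψ≡∑β = trans (∑-cong λ w → *-distribˡ-∑ (C w) (I w)) (∑-comm λ w u → C w * I w u)

    -- The square expands into pairs of clusters containing u. One of the two centres is at least as
    -- close to u as the other, so one of the two orders contributes to `q`.
    β²≤ : ∀ u → β u * β u ≤ 2 * ∑[ w < n ] ∑[ x < n ] q u w x
    β²≤ u = begin
      β u * β u
        ≡⟨ sym (∑-*-∑ (λ w → C w * I w u) (λ w → C w * I w u)) ⟩
      ∑[ w < n ] ∑[ x < n ] (C w * I w u * (C x * I x u))
        ≤⟨ ∑-mono₂ pointwise ⟩
      ∑[ w < n ] ∑[ x < n ] (q u w x + q u x w)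
        ≡⟨ ∑-cong (λ w → ∑-distrib-+ (λ x → q u w x) (λ x → q u x w)) ⟩
      ∑[ w < n ] (∑[ x < n ] q u w x + ∑[ x < n ] q u x w)
        ≡⟨ ∑-distrib-+ (λ w → ∑[ x < n ] q u w x) (λ w → ∑[ x < n ] q u x w) ⟩
      ∑[ w < n ] ∑[ x < n ] q u w x + ∑[ w < n ] ∑[ x < n ] q u x w
        ≡⟨ cong (∑[ w < n ] ∑[ x < n ] q u w x +_) (∑-comm (λ w x → q u x w)) ⟩
      ∑[ w < n ] ∑[ x < n ] q u w x + ∑[ w < n ] ∑[ x < n ] q u w x
        ≡⟨ cong (∑[ w < n ] ∑[ x < n ] q u w x +_) (sym (+-identityʳ _)) ⟩
      2 * ∑[ w < n ] ∑[ x < n ] q u w x ∎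
      where
      rearrange : ∀ a b c d e → c * (a * (b * (d * e))) ≡ a * b * (c * d) * e
      rearrange = solve-∀
      rearrange′ : ∀ a b c d e → a * (c * (d * (b * e))) ≡ a * b * (c * d) * e
      rearrange′ = solve-∀
      pointwise : ∀ w x → C w * I w u * (C x * I x u) ≤ q u w x + q u x w
      pointwise w x with ≤-total (δ x u) (δ w u)
      ... | inj₁ x≤w = begin
        C w * I w u * (C x * I x u)             ≡⟨ sym (*-identityʳ _) ⟩
        C w * I w u * (C x * I x u) * 1         ≡⟨ cong (C w * I w u * (C x * I x u) *_) (sym (𝟙-true (δ x u ≤? δ w u) x≤w)) ⟩
        C w * I w u * (C x * I x u) * L x w u   ≡⟨ sym (rearrange (C w) (I w u) (C x) (I x u) (L x w u)) ⟩
        q u w x                                 ≤⟨ m≤m+n _ _ ⟩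
        q u w x + q u x w                       ∎
      ... | inj₂ w≤x = begin
        C w * I w u * (C x * I x u)             ≡⟨ sym (*-identityʳ _) ⟩
        C w * I w u * (C x * I x u) * 1         ≡⟨ cong (C w * I w u * (C x * I x u) *_) (sym (𝟙-true (δ w u ≤? δ x u) w≤x)) ⟩
        C w * I w u * (C x * I x u) * L w x u   ≡⟨ sym (rearrange′ (C w) (I w u) (C x) (I x u) (L w x u)) ⟩
        q u x w                                 ≤⟨ m≤n+m _ _ ⟩
        q u w x + q u x w                       ∎

    weighted : ∑[ u < n ] ∑[ w < n ] ∑[ x < n ] q u w x ≡ ∑[ x < n ] (C x * kill x)
    weighted = begin-equality
      ∑[ u < n ] ∑[ w < n ] ∑[ x < n ] q u w x
        ≡⟨ ∑-comm (λ u w → ∑[ x < n ] q u w x) ⟩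
      ∑[ w < n ] ∑[ u < n ] ∑[ x < n ] q u w x
        ≡⟨ ∑-cong (λ w → ∑-comm (λ u x → q u w x)) ⟩
      ∑[ w < n ] ∑[ x < n ] ∑[ u < n ] q u w x
        ≡⟨ ∑-comm (λ w x → ∑[ u < n ] q u w x) ⟩
      ∑[ x < n ] ∑[ w < n ] ∑[ u < n ] q u w x
        ≡⟨ ∑-cong (λ x → ∑-cong (λ w → trans (sym (*-distribˡ-∑ (C x) _)) (cong (C x *_) (sym (*-distribˡ-∑ (C w) _))))) ⟩
      ∑[ x < n ] ∑[ w < n ] (C x * (C w * K x w))
        ≡⟨ ∑-cong (λ x → sym (*-distribˡ-∑ (C x) (λ w → C w * K x w))) ⟩
      ∑[ x < n ] (C x * kill x) ∎

    -- Up to the factor Φ, the sum of C x * kill x is the expectation of `kill` under sampling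
    -- proportional to C, so it is at most Φ times the maximum.
    Ψ²≤ : Ψ * Ψ ≤ 2 * n * Φ * kill w₀
    Ψ²≤ = begin
      Ψ * Ψ                                             ≡⟨ cong (λ z → z * z) Ψ≡∑β ⟩
      ∑ n β * ∑ n β                                     ≤⟨ cauchy-schwarz β ⟩
      n * ∑[ u < n ] (β u * β u)                        ≤⟨ *-monoʳ-≤ n (∑-mono β²≤) ⟩
      n * ∑[ u < n ] (2 * ∑[ w < n ] ∑[ x < n ] q u w x) ≡⟨ cong (n *_) (sym (*-distribˡ-∑ 2 (λ u → ∑[ w < n ] ∑[ x < n ] q u w x))) ⟩
      n * (2 * ∑[ u < n ] ∑[ w < n ] ∑[ x < n ] q u w x) ≡⟨ cong (λ z → n * (2 * z)) weighted ⟩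
      n * (2 * ∑[ x < n ] (C x * kill x))               ≤⟨ *-monoʳ-≤ n (*-monoʳ-≤ 2 (∑-mono λ x → *-monoʳ-≤ (C x) (kill≤ x))) ⟩
      n * (2 * ∑[ x < n ] (C x * kill w₀))              ≡⟨ cong (λ z → n * (2 * z)) (sym (*-distribʳ-∑ (kill w₀) C)) ⟩
      n * (2 * (Φ * kill w₀))                           ≡⟨ regroup n Φ (kill w₀) ⟩
      2 * n * Φ * kill w₀                               ∎
      where
      regroup : ∀ a b c → a * (2 * (b * c)) ≡ 2 * a * b * c
      regroup = solve-∀

    decrease : ∀ r′ → (∀ u → r′ u ≤ r u) → (∀ u → r′ u ≤ δ w₀ u) →
      energy δ r′ * (2 * n * Φ) + Ψ * Ψ ≤ 2 * n * Φ * Ψ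
    decrease r′ r′≤r r′≤δ = begin
      energy δ r′ * Y + Ψ * Ψ          ≤⟨ +-monoʳ-≤ (energy δ r′ * Y) Ψ²≤ ⟩
      energy δ r′ * Y + Y * kill w₀    ≡⟨ cong (_+ Y * kill w₀) (*-comm (energy δ r′) Y) ⟩
      Y * energy δ r′ + Y * kill w₀    ≡⟨ sym (*-distribˡ-+ Y (energy δ r′) (kill w₀)) ⟩
      Y * (energy δ r′ + kill w₀)      ≡⟨ cong (Y *_) (sym (∑-distrib-+ (λ w → C′ w * C′ w) (λ w → C w * K w₀ w))) ⟩
      Y * ∑[ w < n ] (C′ w * C′ w + C w * K w₀ w) ≤⟨ *-monoʳ-≤ Y (∑-mono square) ⟩
      Y * Ψ                            ∎
      where
      Y = 2 * n * Φ
      C′ = cluster δ r′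
      shrink : ∀ w → C′ w ≤ C w
      shrink w = ∑-mono λ u → 𝟙-mono (δ w u <? r′ u) (δ w u <? r u) λ lt → <-≤-trans lt (r′≤r u)
      lose-K : ∀ w → C′ w + K w₀ w ≤ C w
      lose-K w = begin
        C′ w + K w₀ w ≡⟨ sym (∑-distrib-+ (λ u → 𝟙 (δ w u <? r′ u)) (λ u → I w u * (I w₀ u * L w₀ w u))) ⟩
        ∑[ u < n ] (𝟙 (δ w u <? r′ u) + I w u * (I w₀ u * L w₀ w u)) ≤⟨ ∑-mono pointwise ⟩
        C w ∎
        where
        pointwise : ∀ u → 𝟙 (δ w u <? r′ u) + I w u * (I w₀ u * L w₀ w u) ≤ I w u
        pointwise u with δ w u <? r′ u
        ... | d@(yes lt) = begin
          𝟙 d + I w u * (I w₀ u * L w₀ w u) ≤⟨ +-monoˡ-≤ _ (𝟙≤1 d) ⟩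
          1 + I w u * (I w₀ u * L w₀ w u)   ≡⟨ cong (λ z → 1 + I w u * (I w₀ u * z)) (𝟙-false (δ w₀ u ≤? δ w u) (<⇒≱ (<-≤-trans lt (r′≤δ u)))) ⟩
          1 + I w u * (I w₀ u * 0)          ≡⟨ cong (λ z → 1 + I w u * z) (*-zeroʳ (I w₀ u)) ⟩
          1 + I w u * 0                     ≡⟨ cong suc (*-zeroʳ (I w u)) ⟩
          1                                 ≡⟨ sym (𝟙-true (δ w u <? r u) (<-≤-trans lt (r′≤r u))) ⟩
          I w u                             ∎
        ... | d@(no ¬lt) = begin
          𝟙 d + I w u * (I w₀ u * L w₀ w u) ≡⟨ cong (_+ I w u * (I w₀ u * L w₀ w u)) (𝟙-false d ¬lt) ⟩
          I w u * (I w₀ u * L w₀ w u)       ≤⟨ *-monoʳ-≤ (I w u) (*-mono-≤ (𝟙≤1 (δ w₀ u <? r u)) (𝟙≤1 (δ w₀ u ≤? δ w u))) ⟩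
          I w u * 1                         ≡⟨ *-identityʳ _ ⟩
          I w u                             ∎
      -- C′² ≤ C C′ ≤ C (C - K), so the square of the cluster size drops by at least C K.
      square : ∀ w → C′ w * C′ w + C w * K w₀ w ≤ C w * C w
      square w = begin
        C′ w * C′ w + C w * K w₀ w ≤⟨ +-monoˡ-≤ _ (*-monoˡ-≤ (C′ w) (shrink w)) ⟩
        C w * C′ w + C w * K w₀ w  ≡⟨ sym (*-distribˡ-+ (C w) (C′ w) (K w₀ w)) ⟩
        C w * (C′ w + K w₀ w)      ≤⟨ *-monoʳ-≤ (C w) (lose-K w) ⟩
        C w * C w                  ∎

  -- The recursion  Ψ′ ≤ Ψ − Ψ² / Y  solves to  Ψ ≤ 16 n³ / j².
  energy-recursion : ∀ n Φ Ψ Ψ′ i → let j = suc i; Y = 2 * n * Φ in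
    Ψ′ ≤ Ψ → Ψ′ * Y + Ψ * Ψ ≤ Y * Ψ → Φ * Φ ≤ n * Ψ →
    j * j * Ψ ≤ 16 * (n * n * n) → suc j * suc j * Ψ′ ≤ 16 * (n * n * n)
  energy-recursion n Φ Ψ Ψ′ i Ψ′≤Ψ step Φ²≤ bound with suc (suc i) * suc (suc i) * Ψ ≤? 16 * (n * n * n)
  -- If the new bound already holds for Ψ, monotonicity suffices. Otherwise Ψ is large, and so is
  -- its decrease.
  ... | yes small = ≤-trans (*-monoʳ-≤ (suc (suc i) * suc (suc i)) Ψ′≤Ψ) small
  -- By `gain`, (j + 1) Ψ′ ≤ (j - 1) Ψ, and the induction closes because (j - 1)(j + 1) ≤ j².
  ... | no large = *-cancelˡ-≤ (j * j) $ begin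
      j * j * (suc j * suc j * Ψ′)       ≡⟨ eq₁ j (suc j) Ψ′ ⟩
      j * j * suc j * (suc j * Ψ′)       ≤⟨ *-monoʳ-≤ (j * j * suc j) gain ⟩
      j * j * suc j * (i * Ψ)            ≡⟨ eq₂ j (suc j) i Ψ ⟩
      i * suc j * (j * j * Ψ)            ≤⟨ *-monoʳ-≤ (i * suc j) bound ⟩
      i * suc j * (16 * (n * n * n))     ≤⟨ *-monoˡ-≤ (16 * (n * n * n)) (≤-trans (n≤1+n _) (≤-reflexive (eq₃ i))) ⟩
      j * j * (16 * (n * n * n))         ∎
    where
    open ≤-Reasoning
    j = suc i
    Y = 2 * n * Φ
    eq₁ : ∀ a b c → a * a * (b * b * c) ≡ a * a * b * (b * c)
    eq₁ = solve-∀
    eq₂ : ∀ a b i c → a * a * b * (i * c) ≡ i * b * (a * a * c)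
    eq₂ = solve-∀
    eq₃ : ∀ i → suc (i * suc (suc i)) ≡ suc i * suc i
    eq₃ = solve-∀
    -- The constant 16 arises here: (2 Y)² = 16 n² Φ² ≤ 16 n³ Ψ, which in the large case is below (j
    -- + 1)² Ψ².
    2Y≤ : 2 * Y ≤ suc j * Ψ
    2Y≤ = m²≤n²⇒m≤n $ begin
      2 * Y * (2 * Y)               ≡⟨ e₁ n Φ ⟩
      16 * (n * n) * (Φ * Φ)        ≤⟨ *-monoʳ-≤ (16 * (n * n)) Φ²≤ ⟩
      16 * (n * n) * (n * Ψ)        ≡⟨ e₂ n Ψ ⟩
      16 * (n * n * n) * Ψ          ≤⟨ *-monoˡ-≤ Ψ (<⇒≤ (≰⇒> large)) ⟩
      suc j * suc j * Ψ * Ψ         ≡⟨ e₃ (suc j) Ψ ⟩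
      suc j * Ψ * (suc j * Ψ)       ∎
      where
      e₁ : ∀ n Φ → 2 * (2 * n * Φ) * (2 * (2 * n * Φ)) ≡ 16 * (n * n) * (Φ * Φ)
      e₁ = solve-∀
      e₂ : ∀ n Ψ → 16 * (n * n) * (n * Ψ) ≡ 16 * (n * n * n) * Ψ
      e₂ = solve-∀
      e₃ : ∀ j Ψ → j * j * Ψ * Ψ ≡ j * Ψ * (j * Ψ)
      e₃ = solve-∀
    -- Division by Y gives Ψ′ ≤ Ψ (1 - 2/(j + 1)). If Y = 0, the step inequality forces Ψ = 0,
    -- contrary to `large`.
    cancel : ∀ Y → Ψ′ * Y + Ψ * Ψ ≤ Y * Ψ → 2 * Y ≤ suc j * Ψ → suc j * Ψ′ + 2 * Ψ ≤ suc j * Ψ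
    cancel zero step _ = ⊥-elim (large (≤-trans (≤-reflexive (trans (cong (suc (suc i) * suc (suc i) *_) Ψ≡0) (*-zeroʳ (suc (suc i) * suc (suc i))))) z≤n))
      where Ψ≡0 : Ψ ≡ 0
            Ψ≡0 = n≤0⇒n≡0 (m²≤n²⇒m≤n {Ψ} {0} (≤-trans (m≤n+m _ (Ψ′ * 0)) step))
    cancel Y@(suc _) step 2Y≤ = *-cancelˡ-≤ Y $ begin
      Y * (suc j * Ψ′ + 2 * Ψ)             ≡⟨ e₁ Y (suc j) Ψ′ Ψ ⟩
      suc j * (Ψ′ * Y) + 2 * Y * Ψ         ≤⟨ +-monoʳ-≤ (suc j * (Ψ′ * Y)) (*-monoˡ-≤ Ψ 2Y≤) ⟩
      suc j * (Ψ′ * Y) + suc j * Ψ * Ψ     ≡⟨ e₂ (suc j) (Ψ′ * Y) Ψ ⟩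
      suc j * (Ψ′ * Y + Ψ * Ψ)             ≤⟨ *-monoʳ-≤ (suc j) step ⟩
      suc j * (Y * Ψ)                      ≡⟨ e₃ (suc j) Y Ψ ⟩
      Y * (suc j * Ψ)                      ∎
      where
      e₁ : ∀ Y j Ψ′ Ψ → Y * (j * Ψ′ + 2 * Ψ) ≡ j * (Ψ′ * Y) + 2 * Y * Ψ
      e₁ = solve-∀
      e₂ : ∀ j z Ψ → j * z + j * Ψ * Ψ ≡ j * (z + Ψ * Ψ)
      e₂ = solve-∀
      e₃ : ∀ j Y Ψ → j * (Y * Ψ) ≡ Y * (j * Ψ)
      e₃ = solve-∀
    gain : suc j * Ψ′ ≤ i * Ψ
    gain = +-cancelʳ-≤ (2 * Ψ) (suc j * Ψ′) (i * Ψ)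
      (≤-trans (cancel Y step 2Y≤) (≤-reflexive (e i Ψ)))
      where
      e : ∀ i Ψ → suc (suc i) * Ψ ≡ i * Ψ + 2 * Ψ
      e = solve-∀

  opaque
    -- An initial landmark a₀ keeps the list nonempty, so that the minimum always exists.
    nearest : ∀ {n} → (Fin n → Fin n → ℕ) → Fin n → List (Fin n) → Fin n → Fin n
    nearest δ a₀ as u = argmin (λ a → δ a u) a₀ as

    nearest-∈ : ∀ {n} (δ : Fin n → Fin n → ℕ) a₀ as u → nearest δ a₀ as u ∈ a₀ ∷ as
    nearest-∈ δ a₀ as u with argmin-sel (λ a → δ a u) a₀ as
    ... | inj₁ eq  = here eq
    ... | inj₂ ∈as = there ∈as

    nearest-≤ : ∀ {n} (δ : Fin n → Fin n → ℕ) a₀ as u {a} → a ∈ a₀ ∷ as → δ (nearest δ a₀ as u) u ≤ δ a u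
    nearest-≤ δ a₀ as u (here refl) = f[argmin]≤v⁺ {f = λ b → δ b u} a₀ as (inj₁ ≤-refl)
    nearest-≤ δ a₀ as u (there a∈)  = f[argmin]≤v⁺ {f = λ b → δ b u} a₀ as (inj₂ (lose a∈ ≤-refl))

  radius : ∀ {n} → (Fin n → Fin n → ℕ) → Fin n → List (Fin n) → Fin n → ℕ
  radius δ a₀ as u = δ (nearest δ a₀ as u) u

  radius-∷-≤ : ∀ {n} (δ : Fin n → Fin n → ℕ) a₀ a as u → radius δ a₀ (a ∷ as) u ≤ radius δ a₀ as u
  radius-∷-≤ δ a₀ a as u with nearest-∈ δ a₀ as u
  ... | here eq   = nearest-≤ δ a₀ (a ∷ as) u (here eq)
  ... | there ∈as = nearest-≤ δ a₀ (a ∷ as) u (there (there ∈as))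

  radius-∷-≤-head : ∀ {n} (δ : Fin n → Fin n → ℕ) a₀ a as u → radius δ a₀ (a ∷ as) u ≤ δ a u
  radius-∷-≤-head δ a₀ a as u = nearest-≤ δ a₀ (a ∷ as) u (there (here refl))

  energy-mono : ∀ {n} (δ : Fin n → Fin n → ℕ) {r r′} → (∀ u → r′ u ≤ r u) → energy δ r′ ≤ energy δ r
  energy-mono {n} δ {r} {r′} r′≤r = ∑-mono λ w → *-mono-≤ (shrink w) (shrink w)
    where
    shrink : ∀ w → cluster δ r′ w ≤ cluster δ r w
    shrink w = ∑-mono λ u → 𝟙-mono (δ w u <? r′ u) (δ w u <? r u) λ lt → <-≤-trans lt (r′≤r u)

  energy≤n³ : ∀ {n} (δ : Fin n → Fin n → ℕ) r → energy δ r ≤ n * n * n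
  energy≤n³ {n} δ r = begin
    energy δ r            ≤⟨ ∑-mono (λ w → *-mono-≤ (cluster≤n w) (cluster≤n w)) ⟩
    ∑[ w < n ] (n * n)    ≡⟨ trans (∑-const n (n * n)) (*-comm n (n * n)) ⟩
    n * n * n             ∎
    where
    open ≤-Reasoning
    cluster≤n : ∀ w → cluster δ r w ≤ n
    cluster≤n w = ≤-trans (∑-mono (λ u → 𝟙≤1 (δ w u <? r u))) (≤-reflexive (trans (∑-const n 1) (*-identityʳ n)))

  landmarks : ∀ {n} (δ : Fin n → Fin n → ℕ) a₀ j →
    ∃ λ as → length as ≡ j × j * j * energy δ (radius δ a₀ as) ≤ 16 * (n * n * n)
  landmarks δ a₀ zero = [] , refl , z≤n
  landmarks {n} δ a₀ (suc j) = extend (landmarks δ a₀ j)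
    where
    extend : (∃ λ as → length as ≡ j × j * j * energy δ (radius δ a₀ as) ≤ 16 * (n * n * n)) →
             (∃ λ as → length as ≡ suc j × suc j * suc j * energy δ (radius δ a₀ as) ≤ 16 * (n * n * n))
    extend (as , len , bound) = w₀ ∷ as , cong suc len , next j bound
      where
      w₀ : Fin n
      w₀ = proj₁ (energy-step δ (radius δ a₀ as) a₀)
      Ψ Ψ′ : ℕ
      Ψ  = energy δ (radius δ a₀ as)
      Ψ′ = energy δ (radius δ a₀ (w₀ ∷ as))
      next : ∀ j → j * j * Ψ ≤ 16 * (n * n * n) → suc j * suc j * Ψ′ ≤ 16 * (n * n * n)
      -- The factor j² makes the bound vacuous at j = 0, so the first chosen landmark starts from
      -- the trivial bound n³.
      next zero _ = ≤-trans (≤-reflexive (+-identityʳ Ψ′))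
        (≤-trans (energy≤n³ δ (radius δ a₀ (w₀ ∷ as))) (m≤n*m (n * n * n) 16))
      next (suc i) b = energy-recursion n (∑ n (cluster δ (radius δ a₀ as))) Ψ Ψ′ i
        (energy-mono δ (radius-∷-≤ δ a₀ w₀ as))
        (proj₂ (energy-step δ (radius δ a₀ as) a₀) _ (radius-∷-≤ δ a₀ w₀ as) (radius-∷-≤-head δ a₀ w₀ as))
        (cauchy-schwarz (cluster δ (radius δ a₀ as))) b

-- Distances, powers of the adjacency matrix and the number of stored pairs

module Distances where

  open Sums
  open Landmarks
  open import Defs using (Graph; maxDegree)
  open import Data.Empty using (⊥-elim)
  open import Data.Fin.Base as F using (Fin; toℕ)
  import Data.Fin.Properties as Finₚ
  open import Data.List.Base using ([]; length; filter; map; allFin; tabulate)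
  open import Data.List.Properties using (length-filter; length-tabulate)
  open import Data.List.Extrema.Nat using (xs≤max; max≤v⁺)
  open import Data.List.Membership.Propositional.Properties using (∈-map⁺; ∈-allFin; ∈-map⁻)
  open import Data.List.Relation.Unary.All as All using ()
  open import Data.Nat.Base as ℕ using (ℕ; zero; suc; _+_; _*_; _^_; _∸_; _⊓_; _≤_; _<_; z≤n; s≤s)
  open import Data.Nat.Induction using (<-rec)
  open import Data.Nat.Properties
  open import Data.Nat.Tactic.RingSolver using (solve-∀)
  open import Data.Product.Base using (∃; ∃₂; _×_; _,_; proj₁; proj₂)
  open import Data.Sum.Base using (inj₁; inj₂)
  open import Function.Base using (_∘_; _$_; case_of_)
  open import Relation.Binary.PropositionalEquality
  open import Relation.Nullary.Decidable using (Dec; yes; no; _×-dec_; map′)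

  -- A bounded search whose default b, returned when nothing below b is found, becomes the code of ∞
  -- in `dist`.
  first : {P : ℕ → Set} → (∀ i → Dec (P i)) → ℕ → ℕ
  first P? zero = zero
  first P? (suc b) with P? 0
  ... | yes _ = 0
  ... | no _  = suc (first (P? ∘ suc) b)

  first≤ : {P : ℕ → Set} (P? : ∀ i → Dec (P i)) (b : ℕ) → first P? b ≤ b
  first≤ P? zero = z≤n
  first≤ P? (suc b) with P? 0
  ... | yes _ = z≤n
  ... | no _  = s≤s (first≤ (P? ∘ suc) b)

  first-holds : {P : ℕ → Set} (P? : ∀ i → Dec (P i)) (b : ℕ) → first P? b < b → P (first P? b)
  first-holds P? (suc b) lt with P? 0
  ... | yes p = p
  ... | no _  = first-holds (P? ∘ suc) b (ℕ.s<s⁻¹ lt)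

  first-least : {P : ℕ → Set} (P? : ∀ i → Dec (P i)) (b : ℕ) {m : ℕ} → P m → first P? b ≤ m
  first-least P? zero _ = z≤n
  first-least P? (suc b) {m} p with P? 0 | m
  ... | yes _ | _ = z≤n
  ... | no ¬p | zero  = ⊥-elim (¬p p)
  ... | no _  | suc m = s≤s (first-least (P? ∘ suc) b p)

  length-filter-tabulate : ∀ {n} {A : Set} {P : A → Set} (P? : ∀ x → Dec (P x)) (f : Fin n → A) →
    length (filter P? (tabulate f)) ≡ ∑[ i < n ] 𝟙 (P? (f i))
  length-filter-tabulate {zero}  P? f = sym (∑-zero _)
  length-filter-tabulate {suc n} P? f with P? (f F.zero) | ∑-suc (λ i → 𝟙 (P? (f i)))
  ... | yes p | eq = trans (cong suc (length-filter-tabulate P? (f ∘ F.suc)))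
        (sym (trans eq (cong (_+ ∑[ i < n ] 𝟙 (P? (f (F.suc i)))) (𝟙-true (yes p) p))))
  ... | no ¬p | eq = trans (length-filter-tabulate P? (f ∘ F.suc))
        (sym (trans eq (cong (_+ ∑[ i < n ] 𝟙 (P? (f (F.suc i)))) (𝟙-false (no ¬p) ¬p))))

  module _ {n : ℕ} (G : Graph n) where
    open Graph G using (_~_; ~-sym; _~?_; degree; Walk; here; step; finite; infinite)

    walk? : ∀ u v ℓ → Dec (Walk u v ℓ)
    walk? u v zero    = map′ (λ { refl → here }) (λ { here → refl }) (u Finₚ.≟ v)
    walk? u v (suc ℓ) = map′ (λ { (w , u~w , p) → step u~w p }) (λ { (step u~w p) → _ , u~w , p })
                             (Finₚ.any? λ w → (u ~? w) ×-dec walk? w v ℓ)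

    _++ʷ_ : ∀ {u v w a b} → Walk u v a → Walk v w b → Walk u w (a + b)
    here       ++ʷ q = q
    step u~x p ++ʷ q = step u~x (p ++ʷ q)

    reverseʷ : ∀ {u v a} → Walk u v a → Walk v u a
    reverseʷ here = here
    reverseʷ {u} {v} {suc a} (step u~x p) =
      subst (Walk v u) (+-comm a 1) (reverseʷ p ++ʷ step (~-sym u~x) here)

    splitʷ : ∀ {u v ℓ} a → a ≤ ℓ → Walk u v ℓ → ∃ λ w → Walk u w a × Walk w v (ℓ ∸ a)
    splitʷ zero    _         p            = _ , here , p
    splitʷ (suc a) (s≤s a≤ℓ) (step u~x p) with splitʷ a a≤ℓ p
    ... | w , q , r = w , step u~x q , r

    -- Two of the ℓ + 1 > n vertices of the walk coincide, and the part between them is cut out.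
    shorten : ∀ {u v ℓ} → Walk u v ℓ → n ≤ ℓ → ∃ λ m → m < ℓ × Walk u v m
    shorten {u} {v} {ℓ} p n≤ℓ with Finₚ.pigeonhole (s≤s n≤ℓ) (λ i → proj₁ (splitʷ (toℕ i) (ℕ.s≤s⁻¹ (Finₚ.toℕ<n i)) p))
    ... | i , j , i<j , eq = toℕ i + (ℓ ∸ toℕ j) , shorter ,
      subst (λ w → Walk u w (toℕ i)) eq (proj₁ (proj₂ (split i))) ++ʷ proj₂ (proj₂ (split j))
      where
      split : (i : Fin (suc ℓ)) → ∃ λ w → Walk u w (toℕ i) × Walk w v (ℓ ∸ toℕ i)
      split i = splitʷ (toℕ i) (ℕ.s≤s⁻¹ (Finₚ.toℕ<n i)) p
      shorter : toℕ i + (ℓ ∸ toℕ j) < ℓ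
      shorter = begin-strict
        toℕ i + (ℓ ∸ toℕ j) <⟨ +-monoˡ-< (ℓ ∸ toℕ j) i<j ⟩
        toℕ j + (ℓ ∸ toℕ j) ≡⟨ m+[n∸m]≡n (ℕ.s≤s⁻¹ (Finₚ.toℕ<n j)) ⟩
        ℓ                   ∎
        where open ≤-Reasoning

    walk<n : ∀ {u v} ℓ → Walk u v ℓ → ∃ λ m → m < n × Walk u v m
    walk<n {u} {v} = <-rec _ go
      where
      go : ∀ ℓ → (∀ {m} → m < ℓ → Walk u v m → ∃ λ m → m < n × Walk u v m) →
           Walk u v ℓ → ∃ λ m → m < n × Walk u v m
      go ℓ rec p with ℓ <? n
      ... | yes ℓ<n = ℓ , ℓ<n , p
      ... | no ℓ≮n with shorten p (≮⇒≥ ℓ≮n)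
      ... | m , m<ℓ , q = rec m<ℓ q

    -- The value n stands for ∞.
    opaque
      dist : Fin n → Fin n → ℕ
      dist u v = first (walk? u v) n

      dist≤n : ∀ u v → dist u v ≤ n
      dist≤n u v = first≤ (walk? u v) n

      dist-walk : ∀ {u v} → dist u v < n → Walk u v (dist u v)
      dist-walk {u} {v} = first-holds (walk? u v) n

      dist-least : ∀ {u v m} → Walk u v m → dist u v ≤ m
      dist-least {u} {v} p = first-least (walk? u v) n p

    walk⇒dist<n : ∀ {u v m} → Walk u v m → dist u v < n
    walk⇒dist<n p with walk<n _ p
    ... | m , m<n , q = ≤-<-trans (dist-least q) m<n

    dist-sym-≤ : ∀ u v → dist u v ≤ dist v u
    dist-sym-≤ u v with dist v u <? n
    ... | yes lt = dist-least (reverseʷ (dist-walk lt))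
    ... | no ≮n  = ≤-trans (dist≤n u v) (≮⇒≥ ≮n)

    dist-sym : ∀ u v → dist u v ≡ dist v u
    dist-sym u v = ≤-antisym (dist-sym-≤ u v) (dist-sym-≤ v u)

    -- No value of `dist` exceeds n, so the inequality survives the convention that n stands for ∞.
    dist-triangle : ∀ u w v → dist u v ≤ dist u w + dist w v
    dist-triangle u w v with dist u w <? n | dist w v <? n
    ... | yes p | yes q = dist-least (dist-walk p ++ʷ dist-walk q)
    ... | no ≮n | _     = ≤-trans (dist≤n u v) (≤-trans (≮⇒≥ ≮n) (m≤m+n _ _))
    ... | _     | no ≮n = ≤-trans (dist≤n u v) (≤-trans (≮⇒≥ ≮n) (m≤n+m _ _))

    connected-trans : ∀ {u w v} → dist u w < n → dist w v < n → dist u v < n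
    connected-trans p q = walk⇒dist<n (dist-walk p ++ʷ dist-walk q)

    connected-sym : ∀ {u v} → dist u v < n → dist v u < n
    connected-sym p = walk⇒dist<n (reverseʷ (dist-walk p))

    degree≤maxDegree : ∀ u → degree u ≤ maxDegree G
    degree≤maxDegree u = All.lookup (xs≤max 0 (map degree (allFin n))) (∈-map⁺ degree (∈-allFin u))

    maxDegree≤n : maxDegree G ≤ n
    maxDegree≤n = max≤v⁺ {xs = map degree (allFin n)} z≤n (All.tabulate λ d∈ → case ∈-map⁻ degree d∈ of λ
      { (u , _ , refl) → ≤-trans (length-filter (u ~?_) (allFin n)) (≤-reflexive (length-tabulate {n = n} (λ i → i))) })

    -- The matrix I + A, with A the adjacency matrix: its loops let the k-th power account for walks
    -- of every length up to k.
    closed : Fin n → Fin n → ℕ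
    closed u v = 𝟙 (u Finₚ.≟ v) + 𝟙 (u ~? v)

    closed-sym : ∀ u v → closed u v ≤ closed v u
    closed-sym u v = +-mono-≤ (𝟙-mono (u Finₚ.≟ v) (v Finₚ.≟ u) sym) (𝟙-mono (u ~? v) (v ~? u) ~-sym)

    ∑closed≤ : ∀ u → ∑[ v < n ] closed u v ≤ suc (maxDegree G)
    ∑closed≤ u = begin
      ∑[ v < n ] closed u v
        ≡⟨ ∑-distrib-+ (λ v → 𝟙 (u Finₚ.≟ v)) (λ v → 𝟙 (u ~? v)) ⟩
      ∑[ v < n ] 𝟙 (u Finₚ.≟ v) + ∑[ v < n ] 𝟙 (u ~? v)
        ≤⟨ +-mono-≤ (∑𝟙≤1 (u Finₚ.≟_) λ p q → trans (sym p) q)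
             (≤-trans (≤-reflexive (sym (length-filter-tabulate (u ~?_) (λ i → i)))) (degree≤maxDegree u)) ⟩
      suc (maxDegree G) ∎
      where open ≤-Reasoning

    -- The entries of (I + adjacency matrix) ^ k.
    paths : ℕ → Fin n → Fin n → ℕ
    paths zero    u v = 𝟙 (u Finₚ.≟ v)
    paths (suc k) u v = ∑[ x < n ] (closed u x * paths k x v)

    walk⇒path : ∀ k {u v ℓ} → ℓ ≤ k → Walk u v ℓ → 1 ≤ paths k u v
    walk⇒path zero    {u} {v} _  here = ≤-reflexive (sym (𝟙-true (u Finₚ.≟ v) refl))
    walk⇒path (suc k) {u} {v} ℓ≤k here = ≤-trans
      (*-mono-≤ (≤-trans (≤-reflexive (sym (𝟙-true (u Finₚ.≟ u) refl))) (m≤m+n _ (𝟙 (u ~? u)))) (walk⇒path k z≤n here))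
      (term≤∑ (λ x → closed u x * paths k x v) u)
    walk⇒path (suc k) {u} {v} (s≤s ℓ≤k) (step {v = x} u~x p) = ≤-trans
      (*-mono-≤ (≤-trans (≤-reflexive (sym (𝟙-true (u ~? x) u~x))) (m≤n+m _ (𝟙 (u Finₚ.≟ x)))) (walk⇒path k ℓ≤k p))
      (term≤∑ (λ x → closed u x * paths k x v) x)

    ∑paths-row : ∀ k u → ∑[ v < n ] paths k u v ≤ suc (maxDegree G) ^ k
    ∑paths-row zero    u = ∑𝟙≤1 (u Finₚ.≟_) λ p q → trans (sym p) q
    ∑paths-row (suc k) u = begin
      ∑[ v < n ] ∑[ x < n ] (closed u x * paths k x v)
        ≡⟨ ∑-comm (λ v x → closed u x * paths k x v) ⟩
      ∑[ x < n ] ∑[ v < n ] (closed u x * paths k x v)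
        ≡⟨ ∑-cong (λ x → sym (*-distribˡ-∑ (closed u x) (paths k x))) ⟩
      ∑[ x < n ] (closed u x * ∑[ v < n ] paths k x v)
        ≤⟨ ∑-mono (λ x → *-monoʳ-≤ (closed u x) (∑paths-row k x)) ⟩
      ∑[ x < n ] (closed u x * suc (maxDegree G) ^ k)
        ≡⟨ sym (*-distribʳ-∑ (suc (maxDegree G) ^ k) (closed u)) ⟩
      ∑[ x < n ] closed u x * suc (maxDegree G) ^ k
        ≤⟨ *-monoˡ-≤ (suc (maxDegree G) ^ k) (∑closed≤ u) ⟩
      suc (maxDegree G) ^ suc k ∎
      where open ≤-Reasoning

    ∑paths-column : ∀ k v → ∑[ u < n ] paths k u v ≤ suc (maxDegree G) ^ k
    ∑paths-column zero    v = ∑𝟙≤1 (Finₚ._≟ v) λ p q → trans p (sym q)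
    ∑paths-column (suc k) v = begin
      ∑[ u < n ] ∑[ x < n ] (closed u x * paths k x v)
        ≡⟨ ∑-comm (λ u x → closed u x * paths k x v) ⟩
      ∑[ x < n ] ∑[ u < n ] (closed u x * paths k x v)
        ≡⟨ ∑-cong (λ x → sym (*-distribʳ-∑ (paths k x v) (λ u → closed u x))) ⟩
      ∑[ x < n ] (∑[ u < n ] closed u x * paths k x v)
        ≤⟨ ∑-mono (λ x → *-monoˡ-≤ (paths k x v) (≤-trans (∑-mono (λ u → closed-sym u x)) (∑closed≤ x))) ⟩
      ∑[ x < n ] (suc (maxDegree G) * paths k x v)
        ≡⟨ sym (*-distribˡ-∑ (suc (maxDegree G)) (λ x → paths k x v)) ⟩
      suc (maxDegree G) * ∑[ x < n ] paths k x v
        ≤⟨ *-monoʳ-≤ (suc (maxDegree G)) (∑paths-column k v) ⟩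
      suc (maxDegree G) ^ suc k ∎
      where open ≤-Reasoning

    Close : (Fin n → ℕ) → ℕ → Fin n → Fin n → Set
    Close r k u v = ∃₂ λ w x → ∃ λ ℓ → ℓ ≤ k × dist w u < r u × Walk w x ℓ × dist x v < r v

    -- Summing the witnesses over u and v leaves the quadratic form ∑ C(w) P(w,x) C(x). AM-GM splits
    -- it into a part bounded by the row sums of P and a part bounded by its column sums.
    ∑close≤ : ∀ r k {S : Fin n → Fin n → Set} (S? : ∀ u v → Dec (S u v)) →
      (∀ {u v} → S u v → Close r k u v) →
      ∑[ u < n ] ∑[ v < n ] 𝟙 (S? u v) ≤ suc (maxDegree G) ^ k * energy dist r
    ∑close≤ r k S? close = begin
      ∑[ u < n ] ∑[ v < n ] 𝟙 (S? u v)
        ≤⟨ ∑-mono₂ (λ u v → 𝟙≤ (S? u v) (count u v ∘ close)) ⟩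
      ∑[ u < n ] ∑[ v < n ] ∑[ w < n ] ∑[ x < n ] (I w u * (P w x * I x v))
        ≡⟨ ∑-cong (λ u → sum-v u) ⟩
      ∑[ u < n ] ∑[ w < n ] (I w u * ∑[ x < n ] (P w x * C x))
        ≡⟨ ∑-comm (λ u w → I w u * ∑[ x < n ] (P w x * C x)) ⟩
      ∑[ w < n ] ∑[ u < n ] (I w u * ∑[ x < n ] (P w x * C x))
        ≡⟨ ∑-cong (λ w → sym (*-distribʳ-∑ (∑[ x < n ] (P w x * C x)) (I w))) ⟩
      ∑[ w < n ] (C w * ∑[ x < n ] (P w x * C x))
        ≡⟨ ∑-cong (λ w → *-distribˡ-∑ (C w) (λ x → P w x * C x)) ⟩
      ∑[ w < n ] ∑[ x < n ] (C w * (P w x * C x))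
        ≤⟨ *-cancelˡ-≤ 2 am-gm ⟩
      D * energy dist r ∎
      where
      open ≤-Reasoning
      D = suc (maxDegree G) ^ k
      P = paths k
      C = cluster dist r
      I : Fin n → Fin n → ℕ
      I w u = 𝟙 (dist w u <? r u)
      count : ∀ u v → Close r k u v → 1 ≤ ∑[ w < n ] ∑[ x < n ] (I w u * (P w x * I x v))
      count u v (w , x , ℓ , ℓ≤k , w∈ , p , x∈) = begin
        1 ≤⟨ *-mono-≤ (≤-reflexive (sym (𝟙-true (dist w u <? r u) w∈)))
               (*-mono-≤ (walk⇒path k ℓ≤k p) (≤-reflexive (sym (𝟙-true (dist x v <? r v) x∈)))) ⟩
        I w u * (P w x * I x v)
          ≤⟨ term≤∑ (λ x → I w u * (P w x * I x v)) x ⟩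
        ∑[ x < n ] (I w u * (P w x * I x v))
          ≤⟨ term≤∑ (λ w → ∑[ x < n ] (I w u * (P w x * I x v))) w ⟩
        ∑[ w < n ] ∑[ x < n ] (I w u * (P w x * I x v)) ∎
      sum-v : ∀ u → ∑[ v < n ] ∑[ w < n ] ∑[ x < n ] (I w u * (P w x * I x v)) ≡
                    ∑[ w < n ] (I w u * ∑[ x < n ] (P w x * C x))
      sum-v u = begin-equality
        ∑[ v < n ] ∑[ w < n ] ∑[ x < n ] (I w u * (P w x * I x v))
          ≡⟨ ∑-comm (λ v w → ∑[ x < n ] (I w u * (P w x * I x v))) ⟩
        ∑[ w < n ] ∑[ v < n ] ∑[ x < n ] (I w u * (P w x * I x v))
          ≡⟨ ∑-cong (λ w → ∑-comm (λ v x → I w u * (P w x * I x v))) ⟩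
        ∑[ w < n ] ∑[ x < n ] ∑[ v < n ] (I w u * (P w x * I x v))
          ≡⟨ ∑-cong (λ w → ∑-cong (λ x → trans (sym (*-distribˡ-∑ (I w u) (λ v → P w x * I x v)))
               (cong (I w u *_) (sym (*-distribˡ-∑ (P w x) (I x)))))) ⟩
        ∑[ w < n ] ∑[ x < n ] (I w u * (P w x * C x))
          ≡⟨ ∑-cong (λ w → sym (*-distribˡ-∑ (I w u) (λ x → P w x * C x))) ⟩
        ∑[ w < n ] (I w u * ∑[ x < n ] (P w x * C x)) ∎
      rows : ∑[ w < n ] ∑[ x < n ] (P w x * (C w * C w)) ≤ D * energy dist r
      rows = begin
        ∑[ w < n ] ∑[ x < n ] (P w x * (C w * C w)) ≡⟨ ∑-cong (λ w → sym (*-distribʳ-∑ (C w * C w) (P w))) ⟩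
        ∑[ w < n ] (∑[ x < n ] P w x * (C w * C w)) ≤⟨ ∑-mono (λ w → *-monoˡ-≤ (C w * C w) (∑paths-row k w)) ⟩
        ∑[ w < n ] (D * (C w * C w))                ≡⟨ sym (*-distribˡ-∑ D (λ w → C w * C w)) ⟩
        D * energy dist r                           ∎
      columns : ∑[ w < n ] ∑[ x < n ] (P w x * (C x * C x)) ≤ D * energy dist r
      columns = begin
        ∑[ w < n ] ∑[ x < n ] (P w x * (C x * C x)) ≡⟨ ∑-comm (λ w x → P w x * (C x * C x)) ⟩
        ∑[ x < n ] ∑[ w < n ] (P w x * (C x * C x)) ≡⟨ ∑-cong (λ x → sym (*-distribʳ-∑ (C x * C x) (λ w → P w x))) ⟩
        ∑[ x < n ] (∑[ w < n ] P w x * (C x * C x)) ≤⟨ ∑-mono (λ x → *-monoˡ-≤ (C x * C x) (∑paths-column k x)) ⟩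
        ∑[ x < n ] (D * (C x * C x))                ≡⟨ sym (*-distribˡ-∑ D (λ w → C w * C w)) ⟩
        D * energy dist r                           ∎
      pointwise : ∀ w x → 2 * (C w * (P w x * C x)) ≤ P w x * (C w * C w) + P w x * (C x * C x)
      pointwise w x = begin
        2 * (C w * (P w x * C x))                   ≡⟨ e (C w) (P w x) (C x) ⟩
        P w x * (2 * (C w * C x))                   ≤⟨ *-monoʳ-≤ (P w x) (2mn≤m²+n² (C w) (C x)) ⟩
        P w x * (C w * C w + C x * C x)             ≡⟨ *-distribˡ-+ (P w x) (C w * C w) (C x * C x) ⟩
        P w x * (C w * C w) + P w x * (C x * C x)   ∎
        where
        e : ∀ a p b → 2 * (a * (p * b)) ≡ p * (2 * (a * b))
        e = solve-∀
      am-gm : 2 * ∑[ w < n ] ∑[ x < n ] (C w * (P w x * C x)) ≤ 2 * (D * energy dist r)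
      am-gm = begin
        2 * ∑[ w < n ] ∑[ x < n ] (C w * (P w x * C x))
          ≤⟨ ∑∑-≤-half (λ w x → P w x * (C w * C w)) (λ w x → P w x * (C x * C x)) _ pointwise ⟩
        ∑[ w < n ] ∑[ x < n ] (P w x * (C w * C w)) + ∑[ w < n ] ∑[ x < n ] (P w x * (C x * C x))
          ≤⟨ +-mono-≤ rows columns ⟩
        D * energy dist r + D * energy dist r
          ≡⟨ cong (D * energy dist r +_) (sym (+-identityʳ _)) ⟩
        2 * (D * energy dist r) ∎

    -- The condition d(u,v) ≤ r(u) + r(v) + k - 2 without subtraction; a positive radius excludes
    -- landmarks, which are their own detours.
    Stored : (Fin n → ℕ) → ℕ → Fin n → Fin n → Set
    Stored r k u v = (dist u v < n × 2 + dist u v ≤ r u + r v + k) × 1 ≤ r u × 1 ≤ r v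

    stored? : ∀ r k u v → Dec (Stored r k u v)
    stored? r k u v = ((dist u v <? n) ×-dec (2 + dist u v ≤? r u + r v + k)) ×-dec ((1 ≤? r u) ×-dec (1 ≤? r v))

    -- A shortest path is cut after r u - 1 edges and again after k more, which leaves at most r v -
    -- 1 edges. The minima in the cut points take care of paths that end earlier.
    stored⇒close : ∀ r k {u v} → Stored r k u v → Close r k u v
    stored⇒close r k {u} {v} ((d<n , d≤) , 1≤ru , 1≤rv)
      with splitʷ (ℕ.pred (r u) ⊓ dist u v) (m⊓n≤n (ℕ.pred (r u)) (dist u v)) (dist-walk d<n)
    ... | w , p , q with splitʷ (k ⊓ (dist u v ∸ (ℕ.pred (r u) ⊓ dist u v))) (m⊓n≤n k _) q
    ... | x , q₁ , q₂ = w , x , _ , m⊓n≤m k _ ,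
        ≤-<-trans (dist-least (reverseʷ p)) (≤-<-trans (m⊓n≤m (ℕ.pred (r u)) (dist u v)) (pred< 1≤ru)) , q₁ ,
        ≤-<-trans (dist-least q₂) (rest (r u) (r v) (dist u v) d≤ 1≤ru 1≤rv)
      where
      pred< : ∀ {m} → 1 ≤ m → ℕ.pred m < m
      pred< (s≤s _) = ≤-refl
      rest : ∀ a b d → 2 + d ≤ a + b + k → 1 ≤ a → 1 ≤ b →
        d ∸ (ℕ.pred a ⊓ d) ∸ (k ⊓ (d ∸ (ℕ.pred a ⊓ d))) < b
      rest (suc a) (suc b) d d≤ _ _ = s≤s $ begin
        d ∸ (a ⊓ d) ∸ (k ⊓ (d ∸ (a ⊓ d))) ≡⟨ [m∸n]⊓ (d ∸ (a ⊓ d)) k ⟩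
        d ∸ (a ⊓ d) ∸ k                   ≡⟨ cong (_∸ k) ([m∸n]⊓ d a) ⟩
        d ∸ a ∸ k                         ≡⟨ ∸-+-assoc d a k ⟩
        d ∸ (a + k)                       ≤⟨ m≤n+o⇒m∸n≤o d (a + k) (ℕ.s≤s⁻¹ (ℕ.s≤s⁻¹ (≤-trans d≤ (≤-reflexive (e a b k))))) ⟩
        b                                 ∎
        where
        open ≤-Reasoning
        [m∸n]⊓ : ∀ d a → d ∸ (a ⊓ d) ≡ d ∸ a
        [m∸n]⊓ d a with ≤-total a d
        ... | inj₁ a≤d = cong (d ∸_) (m≤n⇒m⊓n≡m a≤d)
        ... | inj₂ d≤a = trans (cong (d ∸_) (m≥n⇒m⊓n≡n d≤a)) (trans (n∸n≡0 d) (sym (m≤n⇒m∸n≡0 d≤a)))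
        e : ∀ a b k → suc a + suc b + k ≡ suc (suc (a + k + b))
        e = solve-∀

-- Memory layout and verified execution of program fragments

module Machines where

  open import Defs
  open import Data.Fin.Base using (toℕ)
  import Data.Fin.Properties as Finₚ
  open import Data.List.Base using (List; []; _∷_; _++_; length; map; drop; concat)
  open import Data.List.Relation.Unary.All using (All; []; _∷_)
  open import Data.Maybe.Base as Maybe using (Maybe; just)
  open import Data.Maybe.Properties using (map-∘)
  open import Data.Nat.Base using (ℕ; zero; suc; _+_; _^_; _≤_; _<_; z≤n; s≤s)
  open import Data.Nat.DivMod using (m<n⇒m%n≡m)
  open import Data.Nat.Properties
  open import Data.Product.Base using (∃; _×_; _,_)
  open import Data.Sum.Base using (inj₁)
  open import Relation.Binary.PropositionalEquality
  open import Relation.Nullary.Decidable using (dec-true; dec-false)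
  open import Relation.Nullary.Negation.Core using (¬_)

  !?-map : ∀ {A B : Set} (f : A → B) xs i → map f xs !? i ≡ Maybe.map f (xs !? i)
  !?-map f []       zero    = refl
  !?-map f []       (suc i) = refl
  !?-map f (x ∷ xs) zero    = refl
  !?-map f (x ∷ xs) (suc i) = !?-map f xs i

  !?-++ʳ : ∀ {A : Set} (xs : List A) i {ys} → (xs ++ ys) !? (length xs + i) ≡ ys !? i
  !?-++ʳ []       i = refl
  !?-++ʳ (x ∷ xs) i = !?-++ʳ xs i

  !?-++ˡ : ∀ {A : Set} (xs : List A) i {ys x} → xs !? i ≡ just x → (xs ++ ys) !? i ≡ just x
  !?-++ˡ (x ∷ xs) zero    eq = eq
  !?-++ˡ (x ∷ xs) (suc i) eq = !?-++ˡ xs i eq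
  !?-++ˡ []       zero    ()
  !?-++ˡ []       (suc i) ()

  !?-< : ∀ {A : Set} (xs : List A) i {x} → xs !? i ≡ just x → i < length xs
  !?-< (x ∷ xs) zero    _  = s≤s z≤n
  !?-< (x ∷ xs) (suc i) eq = s≤s (!?-< xs i eq)
  !?-< []       zero    ()
  !?-< []       (suc i) ()

  !?-All : ∀ {A : Set} {P : A → Set} {xs : List A} → All P xs → ∀ i {x} → xs !? i ≡ just x → P x
  !?-All (p ∷ ps) zero    refl = p
  !?-All (p ∷ ps) (suc i) eq   = !?-All ps i eq
  !?-All []       zero    ()
  !?-All []       (suc i) ()

  bases : ℕ → List (List ℕ) → List ℕ
  bases b []       = []
  bases b (a ∷ as) = b ∷ bases (b + length a) as

  -- A header of absolute base addresses precedes the arrays. One fixed program can thus read tables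
  -- whose sizes depend on the graph.
  image : List (List ℕ) → List ℕ
  image as = bases (length as) as ++ concat as

  length-bases : ∀ b as → length (bases b as) ≡ length as
  length-bases b []       = refl
  length-bases b (a ∷ as) = cong suc (length-bases (b + length a) as)

  bases-!? : ∀ b as j i {a x} → as !? j ≡ just a → a !? i ≡ just x →
    ∃ λ o → bases b as !? j ≡ just (b + o) × concat as !? (o + i) ≡ just x
  bases-!? b (a ∷ as) zero    i refl ai≡ = 0 , cong just (sym (+-identityʳ b)) , !?-++ˡ a i ai≡
  bases-!? b (a ∷ as) (suc j) i {x = x} asj≡ ai≡ with bases-!? (b + length a) as j i asj≡ ai≡
  ... | o , base≡ , elem≡ = length a + o , trans base≡ (cong just (+-assoc b (length a) o)) ,
        subst (λ m → (a ++ concat as) !? m ≡ just x) (sym (+-assoc (length a) o i)) (trans (!?-++ʳ a (o + i)) elem≡)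
  bases-!? b []       zero    i ()
  bases-!? b []       (suc j) i ()

  image-!? : ∀ as j i {a x} → as !? j ≡ just a → a !? i ≡ just x →
    ∃ λ base → image as !? j ≡ just base × image as !? (base + i) ≡ just x
  image-!? as j i {x = x} asj≡ ai≡ with bases-!? (length as) as j i asj≡ ai≡
  ... | o , base≡ , elem≡ = length as + o , !?-++ˡ (bases (length as) as) j base≡ ,
        subst (λ m → image as !? m ≡ just x)
          (trans (cong (_+ (o + i)) (length-bases (length as) as)) (sym (+-assoc (length as) o i)))
          (trans (!?-++ʳ (bases (length as) as) (o + i)) elem≡)

  toℕ-toWord : ∀ w {m} → m < 2 ^ w → toℕ (toWord w m) ≡ m
  toℕ-toWord w m< = trans (Finₚ.toℕ-fromℕ< _) (m<n⇒m%n≡m {{m^n≢0 2 w}} m<)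

  -- Word j of the image is the base address of array j, which is read at the index
  -- in register i.
  fetch : (dst j i : ℕ) → Program
  fetch d j i = const d j ∷ load d d ∷ arith add d d i ∷ load d d ∷ []

  -- Registers 0 and 1 hold the vertices u and v, and register 2 holds zero.
  -- The arrays are T, R, keys and values of the dictionary of stored pairs, then
  -- radii, row offsets and entries of the landmark table.  The jump targets are 23
  -- for a pair that is not stored, 44 if u is at most as far from the landmarks as v,
  -- and 56 for the answer ∞.
  farFrom : (x y rx out : ℕ) → Program
  farFrom x y rx out =
    fetch 5 5 x ++ arith add 5 5 y ∷ fetch out 6 5 ++
    jump≤ out 2 56 ∷ arith add out out rx ∷ return out ∷ []

  oracle : Program
  oracle =
    fetch 3 0 1 ++ arith add 3 3 0 ∷
    fetch 4 1 3 ++ arith add 4 4 1 ∷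
    fetch 5 2 4 ++ jump≤ 3 5 16 ∷ jump≤ 2 2 23 ∷ jump≤ 5 3 18 ∷ jump≤ 2 2 23 ∷
    fetch 5 3 4 ++ return 5 ∷
    fetch 3 4 0 ++ fetch 4 4 1 ++ jump≤ 3 4 44 ∷
    farFrom 1 0 4 3 ++
    farFrom 0 1 3 4 ++
    return 2 ∷ []

  drop-suc : ∀ {A : Set} n (xs : List A) {y ys} → drop n xs ≡ y ∷ ys → drop (suc n) xs ≡ ys
  drop-suc zero    (_ ∷ _)  refl = refl
  drop-suc (suc n) (_ ∷ xs) eq   = drop-suc n xs eq
  drop-suc zero    [] ()
  drop-suc (suc n) [] ()

  module Execution (w : ℕ) (program : Program) (arrays : List (List ℕ))
    (fits : length (image arrays) ≤ 2 ^ w) (small : All (_< 2 ^ w) (image arrays)) where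

    memory : List (Word w)
    memory = map (toWord w) (image arrays)

    open Machine w program memory

    -- An address is described by the instructions that remain from it on, so a fragment can be
    -- verified wherever it stands.
    record Code (pc : ℕ) (is : Program) : Set where
      constructor located
      field drop-≡ : drop pc program ≡ is

    _holds_ : Word w → ℕ → Set
    x holds m = toℕ x ≡ m

    set-same : ∀ (ρ : Registers) r x → (ρ [ r ≔ x ]) r ≡ x
    set-same ρ r x rewrite dec-true (r ≟ r) refl = refl

    set-other : ∀ (ρ : Registers) {r s} x → s ≢ r → (ρ [ r ≔ x ]) s ≡ ρ s
    set-other ρ {r} {s} x s≢r rewrite dec-false (s ≟ r) s≢r = refl

    Agree : Reg → Registers → Registers → Set
    Agree d ρ ρ′ = ∀ s → s ≢ d → ρ′ s ≡ ρ s

    -- The remaining time is part of the relation, so instruction counts add up under composition.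
    record Reaches (t : ℕ) (σ : State) (t′ : ℕ) (σ′ : State) : Set where
      constructor reaches
      field run-≡ : run t σ ≡ run t′ σ′

    record Returns (t : ℕ) (σ : State) (m : ℕ) : Set where
      constructor returns
      field run-just : Maybe.map toℕ (run t σ) ≡ just m

    infixr 5 _⟫_ _⟫ʳ_

    _⟫_ : ∀ {t₁ t₂ t₃ σ₁ σ₂ σ₃} → Reaches t₁ σ₁ t₂ σ₂ → Reaches t₂ σ₂ t₃ σ₃ → Reaches t₁ σ₁ t₃ σ₃
    reaches p ⟫ reaches q = reaches (trans p q)

    _⟫ʳ_ : ∀ {t₁ t₂ σ₁ σ₂ m} → Reaches t₁ σ₁ t₂ σ₂ → Returns t₂ σ₂ m → Returns t₁ σ₁ m
    reaches p ⟫ʳ returns q = returns (trans (cong (Maybe.map toℕ) p) q)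

    run-step : ∀ {pc is t i ρ σ} → Code pc (i ∷ is) → execute (pc , ρ) i ≡ just (inj₁ σ) →
      Reaches (suc t) (pc , ρ) t σ
    run-step {pc} {is} {t} {i} {ρ} {σ} (located code) eq = reaches proof
      where
      proof : run (suc t) (pc , ρ) ≡ run t σ
      proof rewrite code | eq = refl

    run-const : ∀ {pc is t d m} ρ → Code pc (const d m ∷ is) → m < 2 ^ w →
      ∃ λ ρ′ → Reaches (suc t) (pc , ρ) t (suc pc , ρ′) × ρ′ d holds m × Agree d ρ ρ′
    run-const {d = d} {m} ρ code m< =
      ρ [ d ≔ toWord w m ] , run-step code refl , trans (cong toℕ (set-same ρ d _)) (toℕ-toWord w m<) , λ s → set-other ρ _

    run-add : ∀ {pc is t d a b x y} ρ → Code pc (arith add d a b ∷ is) →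
      ρ a holds x → ρ b holds y → x + y < 2 ^ w →
      ∃ λ ρ′ → Reaches (suc t) (pc , ρ) t (suc pc , ρ′) × ρ′ d holds (x + y) × Agree d ρ ρ′
    run-add {d = d} ρ code refl refl xy< =
      ρ [ d ≔ toWord w _ ] , run-step code refl , trans (cong toℕ (set-same ρ d _)) (toℕ-toWord w xy<) , λ s → set-other ρ _

    run-load : ∀ {pc is t d a i x} ρ → Code pc (load d a ∷ is) → ρ a holds i → image arrays !? i ≡ just x →
      ∃ λ ρ′ → Reaches (suc t) (pc , ρ) t (suc pc , ρ′) × ρ′ d holds x × Agree d ρ ρ′
    run-load {pc} {d = d} {a} {x = x} ρ code refl eq =
      ρ [ d ≔ toWord w x ] , run-step code loaded ,
      trans (cong toℕ (set-same ρ d _)) (toℕ-toWord w (!?-All small (toℕ (ρ a)) eq)) , λ s → set-other ρ _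
      where
      loaded : execute (pc , ρ) (load d a) ≡ just (inj₁ (suc pc , ρ [ d ≔ toWord w x ]))
      loaded rewrite !?-map (toWord w) (image arrays) (toℕ (ρ a)) | eq = refl

    run-jump-≤ : ∀ {pc is t a b l} ρ → Code pc (jump≤ a b l ∷ is) → toℕ (ρ a) ≤ toℕ (ρ b) →
      Reaches (suc t) (pc , ρ) t (l , ρ)
    run-jump-≤ {pc} {a = a} {b} {l} ρ code le = run-step code jumped
      where
      jumped : execute (pc , ρ) (jump≤ a b l) ≡ just (inj₁ (l , ρ))
      jumped rewrite dec-true (toℕ (ρ a) ≤? toℕ (ρ b)) le = refl

    run-jump-≰ : ∀ {pc is t a b l} ρ → Code pc (jump≤ a b l ∷ is) → ¬ toℕ (ρ a) ≤ toℕ (ρ b) →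
      Reaches (suc t) (pc , ρ) t (suc pc , ρ)
    run-jump-≰ {pc} {a = a} {b} {l} ρ code ≰ = run-step code jumped
      where
      jumped : execute (pc , ρ) (jump≤ a b l) ≡ just (inj₁ (suc pc , ρ))
      jumped rewrite dec-false (toℕ (ρ a) ≤? toℕ (ρ b)) ≰ = refl

    run-return : ∀ {pc is t s m} ρ → Code pc (return s ∷ is) → ρ s holds m → Returns (suc t) (pc , ρ) m
    run-return {pc} {t = t} {s} ρ (located code) refl = returns proof
      where
      proof : Maybe.map toℕ (run (suc t) (pc , ρ)) ≡ just (toℕ (ρ s))
      proof rewrite code = refl

    Entry : ℕ → ℕ → ℕ → Set
    Entry j i x = ∃ λ a → arrays !? j ≡ just a × a !? i ≡ just x

    code-suc : ∀ {pc i is} → Code pc (i ∷ is) → Code (suc pc) is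
    code-suc {pc} (located eq) = located (drop-suc pc program eq)

    -- Register d carries the base address before the index is added, hence the requirement i ≢ d.
    run-fetch : ∀ {pc is t d j i m x} ρ → Code pc (fetch d j i ++ is) → i ≢ d → ρ i holds m → Entry j m x →
      ∃ λ ρ′ → Reaches (4 + t) (pc , ρ) t (4 + pc , ρ′) × ρ′ d holds x × Agree d ρ ρ′
    run-fetch {pc} {is} {t} {d} {j} {i} {m} {x} ρ code i≢d ρi (a , aj≡ , ai≡) with image-!? arrays j m aj≡ ai≡
    ... | base , head≡ , elem≡
      with run-const {t = 3 + t} ρ code (<-≤-trans (!?-< (image arrays) j head≡) fits)
    ... | ρ₁ , run₁ , ρ₁d , keep₁
      with run-load {t = 2 + t} ρ₁ (code-suc code) ρ₁d head≡
    ... | ρ₂ , run₂ , ρ₂d , keep₂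
      with run-add {t = 1 + t} ρ₂ (code-suc (code-suc code)) ρ₂d
             (trans (cong toℕ (trans (keep₂ i i≢d) (keep₁ i i≢d))) ρi)
             (<-≤-trans (!?-< (image arrays) (base + m) elem≡) fits)
    ... | ρ₃ , run₃ , ρ₃d , keep₃
      with run-load {t = t} ρ₃ (code-suc (code-suc (code-suc code))) ρ₃d elem≡
    ... | ρ₄ , run₄ , ρ₄d , keep₄ =
      ρ₄ , run₁ ⟫ run₂ ⟫ run₃ ⟫ run₄ , ρ₄d ,
      λ s s≢d → trans (keep₄ s s≢d) (trans (keep₃ s s≢d) (trans (keep₂ s s≢d) (keep₁ s s≢d)))

    code-fetch : ∀ {pc is d j i} → Code pc (fetch d j i ++ is) → Code (4 + pc) is
    code-fetch code = code-suc (code-suc (code-suc (code-suc code)))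

    query-decodes : ∀ t x y {m} → Returns t (0 , inputs x y) m →
      Maybe.map (λ z → decode (toℕ z)) (query t x y) ≡ just (decode m)
    query-decodes t x y (returns eq) = trans (map-∘ (query t x y)) (cong (Maybe.map decode) eq)

-- Correctness of the query program

module Queries where

  open Machines
  open import Defs
  open import Data.Fin.Base using (toℕ)
  open import Data.List.Base using (List; []; _++_; length)
  open import Data.List.Relation.Unary.All using (All; [])
  open import Data.Nat.Base using (ℕ; zero; suc; _+_; _^_; _≤_; _<_; z≤n)
  open import Data.Nat.Properties
  open import Data.Product.Base using (_,_)
  open import Relation.Binary.PropositionalEquality
  open import Relation.Nullary.Decidable using (yes; no)
  open import Relation.Nullary.Negation.Core using (¬_)

  -- A table entry e + 1 encodes the distance e. Adding the radius keeps the shift by one that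
  -- `decode` expects, while 0 remains the code of ∞.
  farAnswer : ℕ → ℕ → ℕ
  farAnswer zero    r = 0
  farAnswer (suc e) r = suc e + r

  module Query (w : ℕ) (arrays : List (List ℕ))
    (fits : length (image arrays) ≤ 2 ^ w) (small : All (_< 2 ^ w) (image arrays)) where

    open Execution w oracle arrays fits small
    open Machine w oracle memory

    kept : ∀ {d ρ ρ′ s m} → Agree d ρ ρ′ → s ≢ d → ρ s holds m → ρ′ s holds m
    kept agree s≢d eq = trans (cong toℕ (agree _ s≢d)) eq

    run-far : ∀ {pc is t x y rx out a b r l e} ρ → Code pc (farFrom x y rx out ++ is) →
      x ≢ 5 → y ≢ 5 → rx ≢ 5 → 2 ≢ out → rx ≢ out → 5 ≢ out →
      ρ x holds a → ρ y holds b → ρ rx holds r → ρ 2 holds 0 →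
      Entry 5 a l → Entry 6 (l + b) e → l + b < 2 ^ w → e + r < 2 ^ w →
      Returns (12 + t) (pc , ρ) (farAnswer e r)
    run-far {pc} {t = t} {x} {y} {rx} {out} {a} {b} {r} {l} {e} ρ code x≢5 y≢5 rx≢5 2≢out rx≢out 5≢out ρx ρy ρr ρ2 at-l at-e lb< er<
      with run-fetch {t = 8 + t} ρ code x≢5 ρx at-l
    ... | ρ₁ , run₁ , ρ₁5 , keep₁
      with run-add {t = 7 + t} ρ₁ (code-fetch code) ρ₁5 (kept keep₁ y≢5 ρy) lb<
    ... | ρ₂ , run₂ , ρ₂5 , keep₂
      with run-fetch {t = 3 + t} ρ₂ (code-suc (code-fetch code)) 5≢out ρ₂5 at-e
    ... | ρ₃ , run₃ , ρ₃o , keep₃ = run₁ ⟫ʳ run₂ ⟫ʳ run₃ ⟫ʳ finish e ρ₃o er<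
      where
      code₃ = code-fetch (code-suc (code-fetch code))
      ρ₃2 : ρ₃ 2 holds 0
      ρ₃2 = kept keep₃ 2≢out (kept keep₂ (λ ()) (kept keep₁ (λ ()) ρ2))
      ρ₃r : ρ₃ rx holds r
      ρ₃r = kept keep₃ rx≢out (kept keep₂ rx≢5 (kept keep₁ rx≢5 ρr))
      finish : ∀ e → ρ₃ out holds e → e + r < 2 ^ w → Returns (3 + t) (9 + pc , ρ₃) (farAnswer e r)
      finish zero ρo _ = run-jump-≤ {t = 2 + t} ρ₃ code₃ (≤-trans (≤-reflexive ρo) z≤n) ⟫ʳ
        (run-return {56} {t = 1 + t} ρ₃ (located refl) ρ₃2)
      finish (suc e) ρo er< with run-add {t = 1 + t} ρ₃ (code-suc code₃) ρo ρ₃r er<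
      ... | ρ₄ , run₄ , ρ₄o , _ = 
        run-jump-≰ {t = 2 + t} ρ₃ code₃ (subst₂ (λ i j → ¬ i ≤ j) (sym ρo) (sym ρ₃2) λ ()) ⟫ʳ run₄ ⟫ʳ
        (run-return {t = t} ρ₄ (code-suc (code-suc code₃)) ρ₄o)

    query-far : ∀ {t u v ru rv lu lv euv evu} ρ →
      ρ 0 holds u → ρ 1 holds v → ρ 2 holds 0 →
      Entry 4 u ru → Entry 4 v rv → Entry 5 u lu → Entry 5 v lv →
      Entry 6 (lu + v) euv → Entry 6 (lv + u) evu →
      lu + v < 2 ^ w → lv + u < 2 ^ w → euv + ru < 2 ^ w → evu + rv < 2 ^ w →
      ∀ {m} → (ru ≤ rv → farAnswer euv ru ≡ m) → (¬ ru ≤ rv → farAnswer evu rv ≡ m) →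
      Returns (21 + t) (23 , ρ) m
    query-far {t} {u} {v} {ru} {rv} ρ ρ0 ρ1 ρ2 at-ru at-rv at-lu at-lv at-uv at-vu luv< lvu< eru< erv< near-u near-v
      with run-fetch {23} {t = 17 + t} ρ (located refl) (λ ()) ρ0 at-ru
    ... | ρ₁ , run₁ , ρ₁3 , keep₁
      with run-fetch {27} {t = 13 + t} ρ₁ (located refl) (λ ()) (kept keep₁ (λ ()) ρ1) at-rv
    ... | ρ₂ , run₂ , ρ₂4 , keep₂ with ru ≤? rv
    ... | yes ru≤rv = 
        run₁ ⟫ʳ run₂ ⟫ʳ run-jump-≤ {31} {t = 12 + t} ρ₂ (located refl)
          (subst₂ _≤_ (sym (kept keep₂ (λ ()) ρ₁3)) (sym ρ₂4) ru≤rv) ⟫ʳ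
        (subst (Returns (12 + t) (44 , ρ₂)) (near-u ru≤rv)
          (run-far {44} {t = t} ρ₂ (located refl) (λ ()) (λ ()) (λ ()) (λ ()) (λ ()) (λ ())
            (kept keep₂ (λ ()) (kept keep₁ (λ ()) ρ0)) (kept keep₂ (λ ()) (kept keep₁ (λ ()) ρ1))
            (kept keep₂ (λ ()) ρ₁3) (kept keep₂ (λ ()) (kept keep₁ (λ ()) ρ2)) at-lu at-uv luv< eru<))
    ... | no ru≰rv = 
        run₁ ⟫ʳ run₂ ⟫ʳ run-jump-≰ {31} {t = 12 + t} ρ₂ (located refl)
          (subst₂ (λ i j → ¬ i ≤ j) (sym (kept keep₂ (λ ()) ρ₁3)) (sym ρ₂4) ru≰rv) ⟫ʳ
        (subst (Returns (12 + t) (32 , ρ₂)) (near-v ru≰rv)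
          (run-far {32} {t = t} ρ₂ (located refl) (λ ()) (λ ()) (λ ()) (λ ()) (λ ()) (λ ())
            (kept keep₂ (λ ()) (kept keep₁ (λ ()) ρ1)) (kept keep₂ (λ ()) (kept keep₁ (λ ()) ρ0))
            ρ₂4 (kept keep₂ (λ ()) (kept keep₁ (λ ()) ρ2)) at-lv at-vu lvu< erv<))

    -- The longest branch takes 14 instructions up to reading the key, three jumps, and 21
    -- instructions in `query-far`, which stays within 39.
    query-returns : ∀ {u v t f rf key value ru rv lu lv euv evu} ρ →
      ρ 0 holds u → ρ 1 holds v → ρ 2 holds 0 →
      Entry 0 v t → t + u ≡ f → f < 2 ^ w → Entry 1 f rf → rf + v < 2 ^ w → Entry 2 (rf + v) key →
      Entry 3 (rf + v) value →
      Entry 4 u ru → Entry 4 v rv → Entry 5 u lu → Entry 5 v lv →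
      Entry 6 (lu + v) euv → Entry 6 (lv + u) evu →
      lu + v < 2 ^ w → lv + u < 2 ^ w → euv + ru < 2 ^ w → evu + rv < 2 ^ w →
      ∀ {m} → (key ≡ f → value ≡ m) →
      (key ≢ f → ru ≤ rv → farAnswer euv ru ≡ m) → (key ≢ f → ¬ ru ≤ rv → farAnswer evu rv ≡ m) →
      Returns 39 (0 , ρ) m
    query-returns {f = f} {key = key} ρ ρ0 ρ1 ρ2 at-t refl f< at-rf pos< at-key at-value
      at-ru at-rv at-lu at-lv at-uv at-vu luv< lvu< eru< erv< {m} hit near-u near-v
      with run-fetch {0} {t = 35} ρ (located refl) (λ ()) ρ1 at-t
    ... | ρ₁ , run₁ , ρ₁3 , keep₁
      with run-add {4} {t = 34} ρ₁ (located refl) ρ₁3 (kept keep₁ (λ ()) ρ0) f<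
    ... | ρ₂ , run₂ , ρ₂3 , keep₂
      with run-fetch {5} {t = 30} ρ₂ (located refl) (λ ()) ρ₂3 at-rf
    ... | ρ₃ , run₃ , ρ₃4 , keep₃
      with run-add {9} {t = 29} ρ₃ (located refl) ρ₃4 (kept keep₃ (λ ()) (kept keep₂ (λ ()) (kept keep₁ (λ ()) ρ1))) pos<
    ... | ρ₄ , run₄ , ρ₄4 , keep₄
      with run-fetch {10} {t = 25} ρ₄ (located refl) (λ ()) ρ₄4 at-key
    ... | ρ₅ , run₅ , ρ₅5 , keep₅ = run₁ ⟫ʳ run₂ ⟫ʳ run₃ ⟫ʳ run₄ ⟫ʳ run₅ ⟫ʳ compare
      where
      keep : ∀ {s m} → s ≢ 3 → s ≢ 4 → s ≢ 5 → ρ s holds m → ρ₅ s holds m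
      keep s≢3 s≢4 s≢5 ρs = kept keep₅ s≢5 (kept keep₄ s≢4 (kept keep₃ s≢4 (kept keep₂ s≢3 (kept keep₁ s≢3 ρs))))
      ρ₅3 : ρ₅ 3 holds f
      ρ₅3 = kept keep₅ (λ ()) (kept keep₄ (λ ()) (kept keep₃ (λ ()) ρ₂3))
      far : ∀ {t} → key ≢ f → Returns (21 + t) (23 , ρ₅) m
      far key≢f = query-far ρ₅ (keep (λ ()) (λ ()) (λ ()) ρ0) (keep (λ ()) (λ ()) (λ ()) ρ1) (keep (λ ()) (λ ()) (λ ()) ρ2)
        at-ru at-rv at-lu at-lv at-uv at-vu luv< lvu< eru< erv< (near-u key≢f) (near-v key≢f)
      compare : Returns 25 (14 , ρ₅) m
      -- The only branch instruction is `jump≤`: equality of key and slot takes two comparisons, and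
      -- comparing register 2 with itself jumps always.
      compare with f ≤? key | key ≤? f
      ... | no f≰key | _ =
        run-jump-≰ {14} {t = 24} ρ₅ (located refl) (subst₂ (λ i j → ¬ i ≤ j) (sym ρ₅3) (sym ρ₅5) f≰key) ⟫ʳ
        run-jump-≤ {15} {t = 23} ρ₅ (located refl) ≤-refl ⟫ʳ
        far λ { refl → f≰key ≤-refl }
      ... | yes f≤key | no key≰f =
        run-jump-≤ {14} {t = 24} ρ₅ (located refl) (subst₂ _≤_ (sym ρ₅3) (sym ρ₅5) f≤key) ⟫ʳ
        run-jump-≰ {16} {t = 23} ρ₅ (located refl) (subst₂ (λ i j → ¬ i ≤ j) (sym ρ₅5) (sym ρ₅3) key≰f) ⟫ʳ
        run-jump-≤ {17} {t = 22} ρ₅ (located refl) ≤-refl ⟫ʳ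
        far λ { refl → key≰f ≤-refl }
      ... | yes f≤key | yes key≤f with run-fetch {18} {t = 19} ρ₅ (located refl) (λ ()) (kept keep₅ (λ ()) ρ₄4) at-value
      ... | ρ₆ , run₆ , ρ₆5 , _ =
        run-jump-≤ {14} {t = 24} ρ₅ (located refl) (subst₂ _≤_ (sym ρ₅3) (sym ρ₅5) f≤key) ⟫ʳ
        run-jump-≤ {16} {t = 23} ρ₅ (located refl) (subst₂ _≤_ (sym ρ₅5) (sym ρ₅3) key≤f) ⟫ʳ
        run₆ ⟫ʳ
        subst (Returns 19 (22 , ρ₆)) (hit (≤-antisym key≤f f≤key)) (run-return {22} {t = 18} ρ₆ (located refl) ρ₆5)

-- Integer roots and inequalities between powers

module IntegerRoots where

  open import Data.Empty using (⊥-elim)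
  open import Data.Nat.Base using (ℕ; zero; suc; _+_; _*_; _^_; _≤_; _<_; z≤n; s≤s; NonZero; >-nonZero; >-nonZero⁻¹)
  open import Data.Nat.Properties
  open import Data.Nat.Tactic.RingSolver using (solve-∀)
  open import Data.Product.Base using (∃; _×_; _,_)
  open import Function.Base using (_$_)
  open import Relation.Binary.PropositionalEquality
  open import Relation.Nullary.Decidable using (Dec; yes; no)
  open import Relation.Nullary.Negation.Core using (¬_)

  ^-distribʳ-* : ∀ k m n → (m * n) ^ k ≡ m ^ k * n ^ k
  ^-distribʳ-* zero    m n = refl
  ^-distribʳ-* (suc k) m n = trans (cong (m * n *_) (^-distribʳ-* k m n)) (lemma m n (m ^ k) (n ^ k))
    where
    lemma : ∀ m n x y → m * n * (x * y) ≡ m * x * (n * y)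
    lemma = solve-∀

  ^-cancelˡ-< : ∀ k {m n} → m ^ k < n ^ k → m < n
  ^-cancelˡ-< k lt = ≰⇒> λ n≤m → <⇒≱ lt (^-monoˡ-≤ k n≤m)

  ^-cancelˡ-≤ : ∀ k .{{_ : NonZero k}} {m n} → m ^ k ≤ n ^ k → m ≤ n
  ^-cancelˡ-≤ k le = ≮⇒≥ λ n<m → <⇒≱ (^-monoˡ-< k n<m) le

  n≤n^k : ∀ n k .{{_ : NonZero k}} → n ≤ n ^ k
  n≤n^k zero      k       = z≤n
  n≤n^k n@(suc _) (suc k) = m≤m*n n (n ^ k) {{m^n≢0 n k}}

  crossing : {P : ℕ → Set} → (∀ i → Dec (P i)) → ¬ P 0 → ∀ m → P m → ∃ λ x → ¬ P x × P (suc x)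
  crossing P? ¬p zero    p = ⊥-elim (¬p p)
  crossing P? ¬p (suc m) p with P? m
  ... | yes q = crossing P? ¬p m q
  ... | no ¬q = m , ¬q , p

  -- The candidate 0 is too small and b is large enough, since b ≤ bᵏ a, so a crossing lies between
  -- them. Multiplying by a avoids the fraction b / a.
  integer-root : ∀ k .{{_ : NonZero k}} a b → 1 ≤ a → 1 ≤ b →
    ∃ λ x → x ^ k * a < b × b ≤ suc x ^ k * a
  integer-root k@(suc k′) a b 1≤a 1≤b with crossing (λ x → b ≤? x ^ k * a) (<⇒≱ 1≤b) b
    (≤-trans (n≤n^k b k) (m≤m*n (b ^ k) a {{>-nonZero 1≤a}}))
  ... | x , ≰ , ≤ = x , ≰⇒> ≰ , ≤

  -- Here P / Q is a rational above n ^ (i / d), and i / d > 5/3 because ε ≤ 1/k makes 2 - kε/3 at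
  -- least 5/3. Roots and denominators are cleared throughout.
  module Exponents (n P Q d i : ℕ) .{{_ : NonZero n}} .{{_ : NonZero d}}
    (below : n ^ i * Q ^ d < P ^ d) (5d<3i : 5 * d < 3 * i) where

    open ≤-Reasoning

    n⁵Q³<P³ : n ^ 5 * Q ^ 3 < P ^ 3
    n⁵Q³<P³ = ^-cancelˡ-< d $ begin-strict
      (n ^ 5 * Q ^ 3) ^ d         ≡⟨ ^-distribʳ-* d (n ^ 5) (Q ^ 3) ⟩
      (n ^ 5) ^ d * (Q ^ 3) ^ d   ≡⟨ cong₂ _*_ (^-*-assoc n 5 d) (^-*-assoc Q 3 d) ⟩
      n ^ (5 * d) * Q ^ (3 * d)   ≤⟨ *-monoˡ-≤ (Q ^ (3 * d)) (^-monoʳ-≤ n (<⇒≤ 5d<3i)) ⟩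
      n ^ (3 * i) * Q ^ (3 * d)   ≡⟨ cong₂ (λ x y → n ^ x * Q ^ y) (*-comm 3 i) (*-comm 3 d) ⟩
      n ^ (i * 3) * Q ^ (d * 3)   ≡⟨ sym (cong₂ _*_ (^-*-assoc n i 3) (^-*-assoc Q d 3)) ⟩
      (n ^ i) ^ 3 * (Q ^ d) ^ 3   ≡⟨ sym (^-distribʳ-* 3 (n ^ i) (Q ^ d)) ⟩
      (n ^ i * Q ^ d) ^ 3         <⟨ ^-monoˡ-< 3 below ⟩
      (P ^ d) ^ 3                 ≡⟨ ^-*-assoc P d 3 ⟩
      P ^ (d * 3)                 ≡⟨ cong (P ^_) (*-comm d 3) ⟩
      P ^ (3 * d)                 ≡⟨ sym (^-*-assoc P 3 d) ⟩
      (P ^ 3) ^ d                 ∎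

    -- Rounding x up to x + 1 at most doubles a positive x. For x = 0 the bound rests on n⁵ Q³ < P³,
    -- that is, on i / d > 5/3.
    root-≤ : ∀ k x → x ^ k * (n ^ 5 * Q ^ 3) < P ^ 3 → suc x ^ k * (n ^ 5 * Q ^ 3) ≤ 2 ^ k * P ^ 3
    root-≤ k zero _ = begin
      1 ^ k * (n ^ 5 * Q ^ 3)   ≡⟨ cong (_* (n ^ 5 * Q ^ 3)) (^-zeroˡ k) ⟩
      1 * (n ^ 5 * Q ^ 3)       ≤⟨ *-mono-≤ (m^n>0 2 k) (<⇒≤ n⁵Q³<P³) ⟩
      2 ^ k * P ^ 3             ∎
    root-≤ k x@(suc x′) lt = begin
      suc x ^ k * (n ^ 5 * Q ^ 3)      ≤⟨ *-monoˡ-≤ (n ^ 5 * Q ^ 3) (^-monoˡ-≤ k (s≤s (m≤n+m (suc x′) x′))) ⟩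
      (x + suc x′) ^ k * (n ^ 5 * Q ^ 3) ≡⟨ cong (λ y → y ^ k * (n ^ 5 * Q ^ 3)) (cong (x +_) (sym (+-identityʳ x))) ⟩
      (2 * x) ^ k * (n ^ 5 * Q ^ 3)    ≡⟨ cong (_* (n ^ 5 * Q ^ 3)) (^-distribʳ-* k 2 x) ⟩
      2 ^ k * x ^ k * (n ^ 5 * Q ^ 3)  ≡⟨ *-assoc (2 ^ k) (x ^ k) _ ⟩
      2 ^ k * (x ^ k * (n ^ 5 * Q ^ 3)) ≤⟨ *-monoʳ-≤ (2 ^ k) (<⇒≤ lt) ⟩
      2 ^ k * P ^ 3                    ∎

    -- The equation says i′ / d′ = (3 i / d - 5) / k. After raising to the power k d and multiplying
    -- by a power of n⁵ Q³, all exponents are integers and `below` meets the lower bound on yᵏ.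
    power-< : ∀ k y i′ d′ .{{_ : NonZero d′}} → k * i′ * d + 5 * d * d′ ≡ 3 * i * d′ →
      P ^ 3 ≤ y ^ k * (n ^ 5 * Q ^ 3) → n ^ i′ < y ^ d′
    power-< k y i′ d′ eq le = ^-cancelˡ-< (k * d) (*-cancelʳ-< (M ^ (d * d′)) _ _ goal)
      where
      M = n ^ 5 * Q ^ 3
      M^ : M ^ (d * d′) ≡ n ^ (5 * d * d′) * Q ^ (3 * (d * d′))
      M^ = begin-equality
        (n ^ 5 * Q ^ 3) ^ (d * d′)              ≡⟨ ^-distribʳ-* (d * d′) (n ^ 5) (Q ^ 3) ⟩
        (n ^ 5) ^ (d * d′) * (Q ^ 3) ^ (d * d′) ≡⟨ cong₂ _*_ (^-*-assoc n 5 (d * d′)) (^-*-assoc Q 3 (d * d′)) ⟩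
        n ^ (5 * (d * d′)) * Q ^ (3 * (d * d′)) ≡⟨ cong (λ z → n ^ z * Q ^ (3 * (d * d′))) (sym (*-assoc 5 d d′)) ⟩
        n ^ (5 * d * d′) * Q ^ (3 * (d * d′))   ∎
      e₁ : ∀ i′ k d → i′ * (k * d) ≡ k * i′ * d
      e₁ = solve-∀
      e₂ : ∀ i d′ → 3 * i * d′ ≡ i * (3 * d′)
      e₂ = solve-∀
      e₃ : ∀ d d′ → 3 * (d * d′) ≡ d * (3 * d′)
      e₃ = solve-∀
      e₄ : ∀ k d d′ → k * (d * d′) ≡ d′ * (k * d)
      e₄ = solve-∀
      goal : (n ^ i′) ^ (k * d) * M ^ (d * d′) < (y ^ d′) ^ (k * d) * M ^ (d * d′)
      goal = begin-strict
        (n ^ i′) ^ (k * d) * M ^ (d * d′)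
          ≡⟨ cong₂ _*_ (trans (^-*-assoc n i′ (k * d)) (cong (n ^_) (e₁ i′ k d))) M^ ⟩
        n ^ (k * i′ * d) * (n ^ (5 * d * d′) * Q ^ (3 * (d * d′)))
          ≡⟨ sym (*-assoc (n ^ (k * i′ * d)) _ _) ⟩
        n ^ (k * i′ * d) * n ^ (5 * d * d′) * Q ^ (3 * (d * d′))
          ≡⟨ cong (_* Q ^ (3 * (d * d′))) (sym (^-distribˡ-+-* n (k * i′ * d) (5 * d * d′))) ⟩
        n ^ (k * i′ * d + 5 * d * d′) * Q ^ (3 * (d * d′))
          ≡⟨ cong₂ (λ z z′ → n ^ z * Q ^ z′) (trans eq (e₂ i d′)) (e₃ d d′) ⟩
        n ^ (i * (3 * d′)) * Q ^ (d * (3 * d′))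
          ≡⟨ sym (cong₂ _*_ (^-*-assoc n i (3 * d′)) (^-*-assoc Q d (3 * d′))) ⟩
        (n ^ i) ^ (3 * d′) * (Q ^ d) ^ (3 * d′)
          ≡⟨ sym (^-distribʳ-* (3 * d′) (n ^ i) (Q ^ d)) ⟩
        (n ^ i * Q ^ d) ^ (3 * d′)
          <⟨ ^-monoˡ-< (3 * d′) {{m*n≢0 3 d′}} below ⟩
        (P ^ d) ^ (3 * d′)
          ≡⟨ trans (^-*-assoc P d (3 * d′)) (cong (P ^_) (sym (e₃ d d′))) ⟩
        P ^ (3 * (d * d′))
          ≡⟨ sym (^-*-assoc P 3 (d * d′)) ⟩
        (P ^ 3) ^ (d * d′)
          ≤⟨ ^-monoˡ-≤ (d * d′) le ⟩
        (y ^ k * M) ^ (d * d′)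
          ≡⟨ ^-distribʳ-* (d * d′) (y ^ k) M ⟩
        (y ^ k) ^ (d * d′) * M ^ (d * d′)
          ≡⟨ cong (_* M ^ (d * d′)) (trans (^-*-assoc y k (d * d′)) (trans (cong (y ^_) (e₄ k d d′)) (sym (^-*-assoc y d′ (k * d))))) ⟩
        (y ^ d′) ^ (k * d) * M ^ (d * d′) ∎

    -- With  y ≈ n ^ (1/k − ε)  and  P / Q ≈ n ^ (2 − k ε/3).
    nt-bound : ∀ k c₀ Δ t y .{{_ : NonZero c₀}} .{{_ : NonZero y}} → Δ ≤ c₀ * y → t ^ 3 ≤ 8 * (n * n * suc Δ ^ k) →
      y ^ k * (n ^ 5 * Q ^ 3) ≤ 2 ^ k * P ^ 3 → n * t * Q ≤ 8 * (2 * c₀) ^ k * 2 ^ k * P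
    nt-bound k c₀ Δ t y Δ≤ t³≤ y≤ = ^-cancelˡ-≤ 3 $ begin
      (n * t * Q) ^ 3                                     ≡⟨ trans (^-distribʳ-* 3 (n * t) Q) (cong (_* Q ^ 3) (^-distribʳ-* 3 n t)) ⟩
      n ^ 3 * t ^ 3 * Q ^ 3                               ≤⟨ *-monoˡ-≤ (Q ^ 3) (*-monoʳ-≤ (n ^ 3) t³≤) ⟩
      n ^ 3 * (8 * (n * n * suc Δ ^ k)) * Q ^ 3           ≡⟨ e₁ n (n ^ 3) (suc Δ ^ k) (Q ^ 3) ⟩
      8 * suc Δ ^ k * (n * (n * n ^ 3) * Q ^ 3)           ≤⟨ *-monoˡ-≤ (n ^ 5 * Q ^ 3) (*-monoʳ-≤ 8 (^-monoˡ-≤ k sucΔ≤)) ⟩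
      8 * (2 * c₀ * y) ^ k * (n ^ 5 * Q ^ 3)              ≡⟨ cong (λ z → 8 * z * (n ^ 5 * Q ^ 3)) (^-distribʳ-* k (2 * c₀) y) ⟩
      8 * ((2 * c₀) ^ k * y ^ k) * (n ^ 5 * Q ^ 3)        ≡⟨ e₂ ((2 * c₀) ^ k) (y ^ k) (n ^ 5 * Q ^ 3) ⟩
      8 * (2 * c₀) ^ k * (y ^ k * (n ^ 5 * Q ^ 3))        ≤⟨ *-monoʳ-≤ (8 * (2 * c₀) ^ k) y≤ ⟩
      8 * (2 * c₀) ^ k * (2 ^ k * P ^ 3)                  ≡⟨ sym (*-assoc (8 * (2 * c₀) ^ k) (2 ^ k) (P ^ 3)) ⟩
      -- Enlarging K to K³ makes the right-hand side a perfect cube.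
      K * P ^ 3                                           ≤⟨ *-monoˡ-≤ (P ^ 3) (n≤n^k K 3) ⟩
      K ^ 3 * P ^ 3                                       ≡⟨ sym (^-distribʳ-* 3 K P) ⟩
      (K * P) ^ 3                                         ∎
      where
      K = 8 * (2 * c₀) ^ k * 2 ^ k
      e₁ : ∀ n n³ D Q → n³ * (8 * (n * n * D)) * Q ≡ 8 * D * (n * (n * n³) * Q)
      e₁ = solve-∀
      e₂ : ∀ a b c → 8 * (a * b) * c ≡ 8 * a * (b * c)
      e₂ = solve-∀
      -- As c₀ y ≥ 1, passing from Δ to Δ + 1 costs a factor two.
      sucΔ≤ : suc Δ ≤ 2 * c₀ * y
      sucΔ≤ = begin
        1 + Δ            ≤⟨ +-mono-≤ (>-nonZero⁻¹ (c₀ * y) {{m*n≢0 c₀ y}}) Δ≤ ⟩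
        c₀ * y + c₀ * y  ≡⟨ e₃ c₀ y ⟩
        2 * c₀ * y       ∎
        where
        e₃ : ∀ a b → a * b + a * b ≡ 2 * a * b
        e₃ = solve-∀

-- Rational arithmetic and bounds for cuts

module RationalBounds where

  open IntegerRoots
  open import Defs
  open import Data.Integer.Base as ℤ using (ℤ; +_; -[1+_]; +≤+; +<+)
  import Data.Integer.Properties as ℤₚ
  open import Data.Nat.Base as ℕ using (ℕ; zero; suc; z≤n; NonZero; >-nonZero⁻¹)
  import Data.Nat.Properties as ℕₚ
  open import Data.Product.Base using (∃; _×_; _,_; proj₂)
  open import Data.Rational.Base using (ℚ; mkℚ; 0ℚ; 1ℚ; ↥_; ↧ₙ_; _+_; _*_; _-_; -_; _/_; _≤_; _<_; *≤*; *<*; toℚᵘ; positive; nonNegative)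
  open import Data.Rational.Properties as ℚₚ hiding (_≟_; _≤?_)
  open import Data.Rational.Solver using (module +-*-Solver)
  import Data.Rational.Unnormalised.Base as ℚᵘ
  import Data.Rational.Unnormalised.Properties as ℚᵘₚ
  open import Function.Base using (_$_)
  open import Relation.Binary.PropositionalEquality
  open import Relation.Unary using (_∈_)
  import Algebra.Properties.CommutativeSemiring.Exp as Exp
  open import Algebra.Bundles using (CommutativeRing)

  module ℚ^ = Exp (CommutativeRing.commutativeSemiring ℚₚ.+-*-commutativeRing)

  -- The passage to unnormalised fractions, where identities hold without any reduction to lowest
  -- terms.
  toℚᵘ-/ : ∀ i d .{{_ : NonZero d}} → toℚᵘ (i / d) ℚᵘ.≃ (i ℚᵘ./ d)
  toℚᵘ-/ i (suc d) = toℚᵘ-fromℚᵘ (ℚᵘ.mkℚᵘ i d)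

  /-*-cancel : ∀ i d .{{_ : NonZero d}} → (i / d) * fromℕ d ≡ i / 1
  /-*-cancel i d@(suc _) = toℚᵘ-injective $ begin
    toℚᵘ ((i / d) * fromℕ d)            ≈⟨ toℚᵘ-homo-* (i / d) (fromℕ d) ⟩
    toℚᵘ (i / d) ℚᵘ.* toℚᵘ (fromℕ d)    ≈⟨ ℚᵘₚ.*-cong (toℚᵘ-/ i d) (toℚᵘ-/ (+ d) 1) ⟩
    (i ℚᵘ./ d) ℚᵘ.* (+ d ℚᵘ./ 1)        ≈⟨ ℚᵘ.*≡* (trans (ℤₚ.*-identityʳ (i ℤ.* + d)) (cong (λ z → i ℤ.* + z) (sym (ℕₚ.*-identityʳ d)))) ⟩
    i ℚᵘ./ 1                            ≈⟨ ℚᵘₚ.≃-sym (toℚᵘ-/ i 1) ⟩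
    toℚᵘ (i / 1)                        ∎
    where open ℚᵘₚ.≃-Reasoning

  numerator : ∀ p → p * fromℕ (↧ₙ p) ≡ ↥ p / 1
  numerator p = trans (cong (_* fromℕ (↧ₙ p)) (sym (↥p/↧p≡p p))) (/-*-cancel (↥ p) (↧ₙ p))

  fromℕ-+ : ∀ m n → fromℕ (m ℕ.+ n) ≡ fromℕ m + fromℕ n
  fromℕ-+ m n = toℚᵘ-injective $ begin
    toℚᵘ (fromℕ (m ℕ.+ n))              ≈⟨ toℚᵘ-/ (+ (m ℕ.+ n)) 1 ⟩
    + (m ℕ.+ n) ℚᵘ./ 1                  ≈⟨ ℚᵘ.*≡* (cong (ℤ._* + 1) (cong₂ (λ i j → i ℤ.+ j) (sym (ℤₚ.*-identityʳ (+ m))) (sym (ℤₚ.*-identityʳ (+ n))))) ⟩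
    (+ m ℚᵘ./ 1) ℚᵘ.+ (+ n ℚᵘ./ 1)      ≈⟨ ℚᵘₚ.≃-sym (ℚᵘₚ.+-cong (toℚᵘ-/ (+ m) 1) (toℚᵘ-/ (+ n) 1)) ⟩
    toℚᵘ (fromℕ m) ℚᵘ.+ toℚᵘ (fromℕ n)  ≈⟨ ℚᵘₚ.≃-sym (toℚᵘ-homo-+ (fromℕ m) (fromℕ n)) ⟩
    toℚᵘ (fromℕ m + fromℕ n)            ∎
    where open ℚᵘₚ.≃-Reasoning

  fromℕ-* : ∀ m n → fromℕ (m ℕ.* n) ≡ fromℕ m * fromℕ n
  fromℕ-* m n = toℚᵘ-injective $ begin
    toℚᵘ (fromℕ (m ℕ.* n))              ≈⟨ toℚᵘ-/ (+ (m ℕ.* n)) 1 ⟩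
    + (m ℕ.* n) ℚᵘ./ 1                  ≈⟨ ℚᵘ.*≡* (cong (ℤ._* + 1) (ℤₚ.pos-* m n)) ⟩
    (+ m ℚᵘ./ 1) ℚᵘ.* (+ n ℚᵘ./ 1)      ≈⟨ ℚᵘₚ.≃-sym (ℚᵘₚ.*-cong (toℚᵘ-/ (+ m) 1) (toℚᵘ-/ (+ n) 1)) ⟩
    toℚᵘ (fromℕ m) ℚᵘ.* toℚᵘ (fromℕ n)  ≈⟨ ℚᵘₚ.≃-sym (toℚᵘ-homo-* (fromℕ m) (fromℕ n)) ⟩
    toℚᵘ (fromℕ m * fromℕ n)            ∎
    where open ℚᵘₚ.≃-Reasoning

  fromℕ-^ : ∀ m k → fromℕ (m ℕ.^ k) ≡ fromℕ m ^ℚ k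
  fromℕ-^ m zero    = refl
  fromℕ-^ m (suc k) = trans (fromℕ-* m (m ℕ.^ k)) (cong (fromℕ m *_) (fromℕ-^ m k))

  fromℕ-mono-≤ : ∀ {m n} → m ℕ.≤ n → fromℕ m ≤ fromℕ n
  fromℕ-mono-≤ {m} {n} m≤n = toℚᵘ-cancel-≤ $
    ℚᵘₚ.≤-respˡ-≃ (ℚᵘₚ.≃-sym (toℚᵘ-/ (+ m) 1)) $ ℚᵘₚ.≤-respʳ-≃ (ℚᵘₚ.≃-sym (toℚᵘ-/ (+ n) 1)) $
    ℚᵘ.*≤* (ℤₚ.*-monoʳ-≤-nonNeg (+ 1) (+≤+ m≤n))

  fromℕ-mono-< : ∀ {m n} → m ℕ.< n → fromℕ m < fromℕ n
  fromℕ-mono-< {m} {n} m<n = toℚᵘ-cancel-< $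
    ℚᵘₚ.<-respˡ-≃ (ℚᵘₚ.≃-sym (toℚᵘ-/ (+ m) 1)) $ ℚᵘₚ.<-respʳ-≃ (ℚᵘₚ.≃-sym (toℚᵘ-/ (+ n) 1)) $
    ℚᵘ.*<* (ℤₚ.*-monoʳ-<-pos (+ 1) (+<+ m<n))

  fromℕ-cancel-≤ : ∀ {m n} → fromℕ m ≤ fromℕ n → m ℕ.≤ n
  fromℕ-cancel-≤ m≤n = ℕₚ.≮⇒≥ λ n<m → <-irrefl refl (<-≤-trans (fromℕ-mono-< n<m) m≤n)

  fromℕ-cancel-< : ∀ {m n} → fromℕ m < fromℕ n → m ℕ.< n
  fromℕ-cancel-< m<n = ℕₚ.≰⇒> λ n≤m → <-irrefl refl (<-≤-trans m<n (fromℕ-mono-≤ n≤m))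

  fromℕ-injective : ∀ {m n} → fromℕ m ≡ fromℕ n → m ≡ n
  fromℕ-injective eq = ℕₚ.≤-antisym (fromℕ-cancel-≤ (≤-reflexive eq)) (fromℕ-cancel-≤ (≤-reflexive (sym eq)))

  0≤fromℕ : ∀ m → 0ℚ ≤ fromℕ m
  0≤fromℕ m = fromℕ-mono-≤ {0} {m} z≤n

  0<fromℕ : ∀ m .{{_ : NonZero m}} → 0ℚ < fromℕ m
  0<fromℕ m = fromℕ-mono-< {0} {m} (>-nonZero⁻¹ m)

  *-mono-≤-nonNeg : ∀ {p q r s} → 0ℚ ≤ q → 0ℚ ≤ r → p ≤ q → r ≤ s → p * r ≤ q * s
  *-mono-≤-nonNeg {p} {q} {r} {s} 0≤q 0≤r p≤q r≤s = ≤-trans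
    (*-monoʳ-≤-nonNeg r {{nonNegative 0≤r}} p≤q) (*-monoˡ-≤-nonNeg q {{nonNegative 0≤q}} r≤s)

  ^-nonNeg : ∀ {p} k → 0ℚ ≤ p → 0ℚ ≤ p ^ℚ k
  ^-nonNeg zero    0≤p = 0≤fromℕ 1
  ^-nonNeg (suc k) 0≤p = *-mono-≤-nonNeg {0ℚ} {_} {0ℚ} 0≤p ≤-refl 0≤p (^-nonNeg k 0≤p)

  1≤^ : ∀ {p} k → 1ℚ ≤ p → 1ℚ ≤ p ^ℚ k
  1≤^ zero    1≤p = ≤-refl
  1≤^ (suc k) 1≤p = *-mono-≤-nonNeg {1ℚ} {_} {1ℚ} (≤-trans (0≤fromℕ 1) 1≤p) (0≤fromℕ 1) 1≤p (1≤^ k 1≤p)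

  -- An Archimedean bound: the denominator is at least one, so p is at most the absolute value of
  -- its numerator.
  <fromℕ : ∀ p → p < fromℕ (suc ℤ.∣ ↥ p ∣)
  <fromℕ p = *-cancelʳ-<-nonNeg (fromℕ (↧ₙ p)) {{nonNegative (0≤fromℕ (↧ₙ p))}} $ begin-strict
    p * fromℕ (↧ₙ p)                        ≡⟨ numerator p ⟩
    ↥ p / 1                                 ≤⟨ /1≤ (↥ p) ⟩
    fromℕ ℤ.∣ ↥ p ∣                         <⟨ fromℕ-mono-< (ℕₚ.n<1+n ℤ.∣ ↥ p ∣) ⟩
    fromℕ (suc ℤ.∣ ↥ p ∣)                   ≤⟨ fromℕ-mono-≤ (ℕₚ.m≤m*n (suc ℤ.∣ ↥ p ∣) (↧ₙ p)) ⟩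
    fromℕ (suc ℤ.∣ ↥ p ∣ ℕ.* ↧ₙ p)          ≡⟨ fromℕ-* (suc ℤ.∣ ↥ p ∣) (↧ₙ p) ⟩
    fromℕ (suc ℤ.∣ ↥ p ∣) * fromℕ (↧ₙ p)    ∎
    where
    open ≤-Reasoning
    /1≤ : ∀ i → i / 1 ≤ fromℕ ℤ.∣ i ∣
    /1≤ (+ n)    = ≤-refl
    /1≤ -[1+ n ] = toℚᵘ-cancel-≤ $
      ℚᵘₚ.≤-respˡ-≃ (ℚᵘₚ.≃-sym (toℚᵘ-/ -[1+ n ] 1)) $ ℚᵘₚ.≤-respʳ-≃ (ℚᵘₚ.≃-sym (toℚᵘ-/ (+ suc n) 1)) $
      ℚᵘ.*≤* (ℤₚ.*-monoʳ-≤-nonNeg (+ 1) (ℤ.-≤+ {n} {suc n}))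

  pos-numerator : ∀ p → 0ℚ < p → ∃ λ i → ↥ p ≡ + suc i
  pos-numerator p@(mkℚ i _ _) 0<p = go i (positive 0<p)
    where
    go : ∀ i → ℤ.Positive i → ∃ λ j → i ≡ + suc j
    go (+ suc j) _ = j , refl

  powerBelow : ∀ n r y → 0ℚ < r → 1 ℕ.≤ y → (∀ i → ↥ r ≡ + i → n ℕ.^ i ℕ.< y ℕ.^ ↧ₙ r) → PowerBelow n r (fromℕ y)
  powerBelow n r@(mkℚ (+ i) _ _) y 0<r 1≤y lt =
    fromℕ-mono-< {0} 1≤y , subst (fromℕ (n ℕ.^ i) <_) (fromℕ-^ y (↧ₙ r)) (fromℕ-mono-< (lt i refl))
  powerBelow n r@(mkℚ -[1+ i ] _ _) y 0<r _ _ with () ← proj₂ (pos-numerator r 0<r)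

  powerBelow⁻¹ : ∀ n r p → 0ℚ < r → PowerBelow n r p →
    0ℚ < p × ∃ λ i → ↥ r ≡ + i × fromℕ (n ℕ.^ i) < p ^ℚ ↧ₙ r
  powerBelow⁻¹ n (mkℚ (+ i) _ _)      p 0<r (0<p , lt) = 0<p , i , refl , lt
  powerBelow⁻¹ n r@(mkℚ -[1+ i ] _ _) p 0<r _ with () ← proj₂ (pos-numerator r 0<r)

  lower≤upper : ∀ (x : ℝ) {p q} → p ∈ ℝ.lower x → q ∈ ℝ.upper x → p ≤ q
  lower≤upper x p∈ q∈ = ≮⇒≥ λ q<p → ℝ.disjoint x p∈ (ℝ.upper-closed x q<p q∈)

  -- All k factors lie above x, hence are at least p, and all are nonnegative.
  ^ᶜ-lower : ∀ (x : ℝ) {p} → 0ℚ ≤ p → p ∈ ℝ.lower x → ∀ k {q} → q ∈ ⌈ x ⌉ ^ᶜ k → p ^ℚ k ≤ q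
  ^ᶜ-lower x 0≤p p∈ zero    1<q = <⇒≤ 1<q
  ^ᶜ-lower x 0≤p p∈ (suc k) (a , b , a∈ , b∈ , ab≤q) = ≤-trans
    (*-mono-≤-nonNeg (≤-trans 0≤p (lower≤upper x p∈ a∈)) (^-nonNeg k 0≤p) (lower≤upper x p∈ a∈) (^ᶜ-lower x 0≤p p∈ k b∈)) ab≤q

  -- With  h = 1/k  and  g = k/3.
  module Slopes (κ h g s r : ℚ) (κh : κ * h ≡ 1ℚ) (g3 : g * fromℕ 3 ≡ κ) (0<κ : 0ℚ < κ)
    (s≤h : s ≤ h) (below : fromℕ 2 - g * s < r) where

    open ≤-Reasoning
    open +-*-Solver

    -- If r were equal to 2 - kε/3, then (3 r - 5)/k would be 1/k - ε; this is the exponent at which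
    -- the degree hypothesis is used.
    r′ : ℚ
    r′ = (fromℕ 3 * r - fromℕ 5) * h

    private
      κs : fromℕ 3 * (fromℕ 2 - g * s) ≡ fromℕ 6 - κ * s
      κs = trans (solve 2 (λ g s → con (fromℕ 3) :* (con (fromℕ 2) :- g :* s) := con (fromℕ 6) :- (g :* con (fromℕ 3)) :* s) refl g s)
                 (cong (λ z → fromℕ 6 - z * s) g3)

      6-κs<3r : fromℕ 6 - κ * s < fromℕ 3 * r
      6-κs<3r = subst (_< fromℕ 3 * r) κs (*-monoʳ-<-pos (fromℕ 3) below)

    5<3r : fromℕ 5 < fromℕ 3 * r
    5<3r = begin-strict
      fromℕ 5          ≡⟨ sym (cong (λ z → fromℕ 6 - z) κh) ⟩
      fromℕ 6 - κ * h  ≤⟨ +-monoʳ-≤ (fromℕ 6) (neg-antimono-≤ (*-monoˡ-≤-nonNeg κ {{nonNegative (<⇒≤ 0<κ)}} s≤h)) ⟩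
      fromℕ 6 - κ * s  <⟨ 6-κs<3r ⟩
      fromℕ 3 * r      ∎

    r′κ : κ * r′ + fromℕ 5 ≡ fromℕ 3 * r
    r′κ = begin-equality
      κ * ((fromℕ 3 * r - fromℕ 5) * h) + fromℕ 5
        ≡⟨ solve 3 (λ κ h r → κ :* ((con (fromℕ 3) :* r :- con (fromℕ 5)) :* h) :+ con (fromℕ 5) :=
                              (con (fromℕ 3) :* r :- con (fromℕ 5)) :* (κ :* h) :+ con (fromℕ 5)) refl κ h r ⟩
      (fromℕ 3 * r - fromℕ 5) * (κ * h) + fromℕ 5
        ≡⟨ cong (λ z → (fromℕ 3 * r - fromℕ 5) * z + fromℕ 5) κh ⟩
      (fromℕ 3 * r - fromℕ 5) * 1ℚ + fromℕ 5
        ≡⟨ solve 1 (λ r → (con (fromℕ 3) :* r :- con (fromℕ 5)) :* con 1ℚ :+ con (fromℕ 5) := con (fromℕ 3) :* r) refl r ⟩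
      fromℕ 3 * r ∎

    0<r : 0ℚ < r
    0<r = *-cancelˡ-<-nonNeg (fromℕ 3) (<-trans (0<fromℕ 5) 5<3r)

    0<r′ : 0ℚ < r′
    0<r′ = *-cancelˡ-<-nonNeg κ {{nonNegative (<⇒≤ 0<κ)}} $ begin-strict
      κ * 0ℚ                    ≡⟨ *-zeroʳ κ ⟩
      0ℚ                        ≡⟨⟩
      fromℕ 5 - fromℕ 5         <⟨ +-monoˡ-< (- fromℕ 5) 5<3r ⟩
      fromℕ 3 * r - fromℕ 5     ≡⟨ cong (_- fromℕ 5) (sym r′κ) ⟩
      κ * r′ + fromℕ 5 - fromℕ 5 ≡⟨ solve 1 (λ x → x :+ con (fromℕ 5) :- con (fromℕ 5) := x) refl (κ * r′) ⟩
      κ * r′                    ∎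

    h-s<r′ : h - 1ℚ * s < r′
    h-s<r′ = *-cancelˡ-<-nonNeg κ {{nonNegative (<⇒≤ 0<κ)}} $ begin-strict
      κ * (h - 1ℚ * s)           ≡⟨ solve 3 (λ κ h s → κ :* (h :- con 1ℚ :* s) := κ :* h :- κ :* s) refl κ h s ⟩
      κ * h - κ * s              ≡⟨ cong (_- κ * s) κh ⟩
      1ℚ - κ * s                 ≡⟨ solve 1 (λ x → con 1ℚ :- x := con (fromℕ 6) :- x :- con (fromℕ 5)) refl (κ * s) ⟩
      fromℕ 6 - κ * s - fromℕ 5  <⟨ +-monoˡ-< (- fromℕ 5) 6-κs<3r ⟩
      fromℕ 3 * r - fromℕ 5      ≡⟨ cong (_- fromℕ 5) (sym r′κ) ⟩
      κ * r′ + fromℕ 5 - fromℕ 5 ≡⟨ solve 1 (λ x → x :+ con (fromℕ 5) :- con (fromℕ 5) := x) refl (κ * r′) ⟩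
      κ * r′                     ∎

-- From the degree hypothesis to the space bound

module SpaceBound where

  open IntegerRoots
  open RationalBounds
  open import Defs
  open import Data.Integer.Base as ℤ using (+_)
  open import Data.Nat.Base as ℕ using (ℕ; suc; z≤n; s≤s; NonZero)
  import Data.Nat.Properties as ℕₚ
  open import Data.Product.Base using (∃; _,_; proj₁; proj₂)
  open import Data.Rational.Base using (0ℚ; 1ℚ; ↥_; ↧ₙ_; _+_; _*_; _/_; _≤_; _<_; nonNegative; positive)
  open import Data.Rational.Properties hiding (_≟_; _≤?_)
  open import Data.Rational.Solver using (module +-*-Solver)
  open import Function.Base using (_$_)
  open import Relation.Binary.PropositionalEquality
  open import Relation.Unary using (_∈_)

  -- A rational q above the bound comes with witnesses r, s and b. They yield an integer y with Δ ≤
  -- c₀ y, and from this n t ≤ K b. The same rational s < ε serves the hypothesis and the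
  -- conclusion.
  space-bound : (c : ℝ) → 0ℚ <ℝ c → (k : ℕ) → .{{_ : NonZero k}} → (K₀ : ℕ) →
    ∃ λ C → ∀ n .{{_ : NonZero n}} (ε : ℝ) (Δ t S : ℕ) → ε ℝ≤ (+ 1 / k) →
      Δ ≤ᶜ ⌈ c ⌉ ⊗ n ^ˣ ((+ 1 / k) ⊖ 1ℚ ⊙ ε) →
      t ℕ.^ 3 ℕ.≤ 8 ℕ.* (n ℕ.* n ℕ.* suc Δ ℕ.^ k) → S ℕ.≤ K₀ ℕ.* (n ℕ.* t) →
      S ≤ᶜ ι (C ℕ.* bitLength n ℕ.^ 0) ⊗ ⌈ c ⌉ ^ᶜ k ⊗ n ^ˣ ((+ 2 / 1) ⊖ (+ k / 3) ⊙ ε)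
  space-bound c 0<c k K₀ = C , bound
    where
    cᵤ = proj₁ (ℝ.upper-inhabited c)
    c₀ = suc ℤ.∣ ↥ cᵤ ∣
    c₀∈ : fromℕ c₀ ∈ ℝ.upper c
    c₀∈ = ℝ.upper-closed c (<fromℕ cᵤ) (proj₂ (ℝ.upper-inhabited c))

    cₗ = proj₁ (ℝ.lower-rounded c 0<c)
    0<cₗ = proj₁ (proj₂ (ℝ.lower-rounded c 0<c))
    cₗ∈ = proj₂ (proj₂ (ℝ.lower-rounded c 0<c))
    m = ↧ₙ cₗ

    1≤mcₗ : 1ℚ ≤ cₗ * fromℕ m
    1≤mcₗ with pos-numerator cₗ 0<cₗ
    ... | j , eq = subst (1ℚ ≤_) (sym (trans (numerator cₗ) (cong (_/ 1) eq))) (fromℕ-mono-≤ {1} {suc j} (s≤s z≤n))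

    K = 8 ℕ.* (2 ℕ.* c₀) ℕ.^ k ℕ.* 2 ℕ.^ k
    -- The factor mᵏ compensates for cᵏ in the bound even when c is small: the rational 0 < cₗ < c
    -- has denominator m, so (m cₗ)ᵏ ≥ 1.
    C = K₀ ℕ.* K ℕ.* m ℕ.^ k

    1≤mᵏcₗᵏ : 1ℚ ≤ cₗ ^ℚ k * fromℕ (m ℕ.^ k)
    1≤mᵏcₗᵏ = subst (1ℚ ≤_) (trans (ℚ^.^-distrib-* cₗ (fromℕ m) k) (cong (cₗ ^ℚ k *_) (sym (fromℕ-^ m k)))) (1≤^ k 1≤mcₗ)

    bound : ∀ n .{{_ : NonZero n}} (ε : ℝ) (Δ t S : ℕ) → ε ℝ≤ (+ 1 / k) →
      Δ ≤ᶜ ⌈ c ⌉ ⊗ n ^ˣ ((+ 1 / k) ⊖ 1ℚ ⊙ ε) →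
      t ℕ.^ 3 ℕ.≤ 8 ℕ.* (n ℕ.* n ℕ.* suc Δ ℕ.^ k) → S ℕ.≤ K₀ ℕ.* (n ℕ.* t) →
      S ≤ᶜ ι (C ℕ.* bitLength n ℕ.^ 0) ⊗ ⌈ c ⌉ ^ᶜ k ⊗ n ^ˣ ((+ 2 / 1) ⊖ (+ k / 3) ⊙ ε)
    bound n ε Δ t S ε≤ Δ≤ t³≤ S≤ q
      (a , b , (a₁ , a₂ , C<a₁ , a₂∈ , a₁a₂≤a) , (r , (s , s∈ε , below) , n^r<b) , ab≤q) = begin
      fromℕ S                         ≤⟨ fromℕ-mono-≤ S≤ ⟩
      fromℕ (K₀ ℕ.* (n ℕ.* t))        ≡⟨ fromℕ-* K₀ (n ℕ.* t) ⟩
      fromℕ K₀ * fromℕ (n ℕ.* t)      ≤⟨ *-monoˡ-≤-nonNeg (fromℕ K₀) {{nonNegative (0≤fromℕ K₀)}} nt≤Kb ⟩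
      fromℕ K₀ * (fromℕ K * b)        ≡⟨ sym (*-assoc (fromℕ K₀) (fromℕ K) b) ⟩
      fromℕ K₀ * fromℕ K * b          ≡⟨ cong (_* b) (sym (fromℕ-* K₀ K)) ⟩
      fromℕ (K₀ ℕ.* K) * b            ≤⟨ *-monoʳ-≤-nonNeg b {{nonNegative (<⇒≤ 0<b)}} K₀K≤a ⟩
      a * b                           ≤⟨ ab≤q ⟩
      q                               ∎
      where
      open ≤-Reasoning
      h = + 1 / k
      s≤h : s ≤ h
      s≤h = ≮⇒≥ λ h<s → ε≤ (ℝ.lower-closed ε h<s s∈ε)

      open Slopes (fromℕ k) h (+ k / 3) s r (trans (*-comm (fromℕ k) h) (/-*-cancel (+ 1) k))
        (/-*-cancel (+ k) 3) (0<fromℕ k) s≤h below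

      unpacked = powerBelow⁻¹ n r b 0<r n^r<b
      0<b = proj₁ unpacked
      i = proj₁ (proj₂ unpacked)
      ↥r≡i = proj₁ (proj₂ (proj₂ unpacked))
      n^i<b^d = proj₂ (proj₂ (proj₂ unpacked))
      d = ↧ₙ r
      P = suc (proj₁ (pos-numerator b 0<b))
      Q = ↧ₙ b

      bQ≡P : b * fromℕ Q ≡ fromℕ P
      bQ≡P = trans (numerator b) (cong (_/ 1) (proj₂ (pos-numerator b 0<b)))

      rd≡i : r * fromℕ d ≡ fromℕ i
      rd≡i = trans (numerator r) (cong (_/ 1) ↥r≡i)

      0<Qᵈ : 0ℚ < fromℕ (Q ℕ.^ d)
      0<Qᵈ = 0<fromℕ (Q ℕ.^ d) {{ℕₚ.m^n≢0 Q d}}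

      nⁱQᵈ<Pᵈ : n ℕ.^ i ℕ.* Q ℕ.^ d ℕ.< P ℕ.^ d
      nⁱQᵈ<Pᵈ = fromℕ-cancel-< $ begin-strict
        fromℕ (n ℕ.^ i ℕ.* Q ℕ.^ d)       ≡⟨ fromℕ-* (n ℕ.^ i) (Q ℕ.^ d) ⟩
        fromℕ (n ℕ.^ i) * fromℕ (Q ℕ.^ d) <⟨ *-monoˡ-<-pos (fromℕ (Q ℕ.^ d)) {{positive 0<Qᵈ}} n^i<b^d ⟩
        b ^ℚ d * fromℕ (Q ℕ.^ d)          ≡⟨ cong (b ^ℚ d *_) (fromℕ-^ Q d) ⟩
        b ^ℚ d * fromℕ Q ^ℚ d             ≡⟨ sym (ℚ^.^-distrib-* b (fromℕ Q) d) ⟩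
        (b * fromℕ Q) ^ℚ d                ≡⟨ cong (_^ℚ d) bQ≡P ⟩
        fromℕ P ^ℚ d                      ≡⟨ sym (fromℕ-^ P d) ⟩
        fromℕ (P ℕ.^ d)                   ∎

      5d<3i : 5 ℕ.* d ℕ.< 3 ℕ.* i
      5d<3i = fromℕ-cancel-< $ begin-strict
        fromℕ (5 ℕ.* d)         ≡⟨ fromℕ-* 5 d ⟩
        fromℕ 5 * fromℕ d       <⟨ *-monoˡ-<-pos (fromℕ d) {{positive (0<fromℕ d)}} 5<3r ⟩
        fromℕ 3 * r * fromℕ d   ≡⟨ *-assoc (fromℕ 3) r (fromℕ d) ⟩
        fromℕ 3 * (r * fromℕ d) ≡⟨ cong (fromℕ 3 *_) rd≡i ⟩
        fromℕ 3 * fromℕ i       ≡⟨ sym (fromℕ-* 3 i) ⟩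
        fromℕ (3 ℕ.* i)         ∎

      open Exponents n P Q d i nⁱQᵈ<Pᵈ 5d<3i

      -- The k-th root of b³ / n⁵, about n ^ (1/k - ε) when b is close to n ^ (2 - kε/3); y is this
      -- root rounded up.
      root = integer-root k (n ℕ.^ 5 ℕ.* Q ℕ.^ 3) (P ℕ.^ 3)
        (ℕₚ.*-mono-≤ (ℕₚ.m^n>0 n 5) (ℕₚ.m^n>0 Q 3)) (ℕₚ.m^n>0 P 3)
      y = suc (proj₁ root)

      y-small : y ℕ.^ k ℕ.* (n ℕ.^ 5 ℕ.* Q ℕ.^ 3) ℕ.≤ 2 ℕ.^ k ℕ.* P ℕ.^ 3
      y-small = root-≤ k (proj₁ root) (proj₁ (proj₂ root))

      exponents : ∀ i′ → ↥ r′ ≡ + i′ → k ℕ.* i′ ℕ.* d ℕ.+ 5 ℕ.* d ℕ.* ↧ₙ r′ ≡ 3 ℕ.* i ℕ.* ↧ₙ r′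
      exponents i′ ↥r′≡i′ = fromℕ-injective $ begin-equality
        fromℕ (k ℕ.* i′ ℕ.* d ℕ.+ 5 ℕ.* d ℕ.* d′)
          ≡⟨ trans (fromℕ-+ (k ℕ.* i′ ℕ.* d) (5 ℕ.* d ℕ.* d′)) (cong₂ _+_
               (trans (fromℕ-* (k ℕ.* i′) d) (cong (_* fromℕ d) (fromℕ-* k i′)))
               (trans (fromℕ-* (5 ℕ.* d) d′) (cong (_* fromℕ d′) (fromℕ-* 5 d)))) ⟩
        fromℕ k * fromℕ i′ * fromℕ d + fromℕ 5 * fromℕ d * fromℕ d′
          ≡⟨ cong (λ z → fromℕ k * z * fromℕ d + fromℕ 5 * fromℕ d * fromℕ d′) (sym r′d′≡i′) ⟩
        fromℕ k * (r′ * fromℕ d′) * fromℕ d + fromℕ 5 * fromℕ d * fromℕ d′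
          ≡⟨ solve 4 (λ κ r d d′ → κ :* (r :* d′) :* d :+ con (fromℕ 5) :* d :* d′ :=
                                   (κ :* r :+ con (fromℕ 5)) :* d :* d′) refl (fromℕ k) r′ (fromℕ d) (fromℕ d′) ⟩
        (fromℕ k * r′ + fromℕ 5) * fromℕ d * fromℕ d′
          ≡⟨ cong (λ z → z * fromℕ d * fromℕ d′) r′κ ⟩
        fromℕ 3 * r * fromℕ d * fromℕ d′
          ≡⟨ cong (_* fromℕ d′) (trans (*-assoc (fromℕ 3) r (fromℕ d)) (trans (cong (fromℕ 3 *_) rd≡i) (sym (fromℕ-* 3 i)))) ⟩
        fromℕ (3 ℕ.* i) * fromℕ d′
          ≡⟨ sym (fromℕ-* (3 ℕ.* i) d′) ⟩
        fromℕ (3 ℕ.* i ℕ.* d′) ∎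
        where
        open +-*-Solver
        d′ = ↧ₙ r′
        r′d′≡i′ : r′ * fromℕ d′ ≡ fromℕ i′
        r′d′≡i′ = trans (numerator r′) (cong (_/ 1) ↥r′≡i′)

      Δ≤c₀y : Δ ℕ.≤ c₀ ℕ.* y
      -- The integer c₀ y is a legitimate upper bound in the hypothesis on Δ, as c₀ lies above c and
      -- y above n ^ r′.
      Δ≤c₀y = fromℕ-cancel-≤ $ Δ≤ (fromℕ (c₀ ℕ.* y))
        ( fromℕ c₀ , fromℕ y , c₀∈
        , (r′ , (s , s∈ε , h-s<r′) , powerBelow n r′ y 0<r′ (s≤s z≤n)
            λ i′ ↥r′≡i′ → power-< k y i′ (↧ₙ r′) (exponents i′ ↥r′≡i′) (proj₂ (proj₂ root)))
        , ≤-reflexive (sym (fromℕ-* c₀ y)) )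

      nt≤Kb : fromℕ (n ℕ.* t) ≤ fromℕ K * b
      nt≤Kb = *-cancelʳ-≤-pos (fromℕ Q) {{positive (0<fromℕ Q)}} $ begin
        fromℕ (n ℕ.* t) * fromℕ Q   ≡⟨ sym (fromℕ-* (n ℕ.* t) Q) ⟩
        fromℕ (n ℕ.* t ℕ.* Q)       ≤⟨ fromℕ-mono-≤ (nt-bound k c₀ Δ t y Δ≤c₀y t³≤ y-small) ⟩
        fromℕ (K ℕ.* P)             ≡⟨ fromℕ-* K P ⟩
        fromℕ K * fromℕ P           ≡⟨ cong (fromℕ K *_) (sym bQ≡P) ⟩
        fromℕ K * (b * fromℕ Q)     ≡⟨ sym (*-assoc (fromℕ K) b (fromℕ Q)) ⟩
        fromℕ K * b * fromℕ Q       ∎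

      K₀K≤a : fromℕ (K₀ ℕ.* K) ≤ a
      K₀K≤a = begin
        fromℕ (K₀ ℕ.* K)                                ≡⟨ sym (*-identityʳ _) ⟩
        fromℕ (K₀ ℕ.* K) * 1ℚ                           ≤⟨ *-monoˡ-≤-nonNeg (fromℕ (K₀ ℕ.* K)) {{nonNegative (0≤fromℕ (K₀ ℕ.* K))}} 1≤mᵏcₗᵏ ⟩
        fromℕ (K₀ ℕ.* K) * (cₗ ^ℚ k * fromℕ (m ℕ.^ k))  ≡⟨ cong (fromℕ (K₀ ℕ.* K) *_) (*-comm (cₗ ^ℚ k) (fromℕ (m ℕ.^ k))) ⟩
        fromℕ (K₀ ℕ.* K) * (fromℕ (m ℕ.^ k) * cₗ ^ℚ k)  ≡⟨ sym (*-assoc (fromℕ (K₀ ℕ.* K)) (fromℕ (m ℕ.^ k)) (cₗ ^ℚ k)) ⟩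
        fromℕ (K₀ ℕ.* K) * fromℕ (m ℕ.^ k) * cₗ ^ℚ k    ≡⟨ cong (_* cₗ ^ℚ k) (sym (fromℕ-* (K₀ ℕ.* K) (m ℕ.^ k))) ⟩
        fromℕ C * cₗ ^ℚ k                               ≡⟨ cong (λ z → fromℕ z * cₗ ^ℚ k) (sym (ℕₚ.*-identityʳ C)) ⟩
        fromℕ (C ℕ.* 1) * cₗ ^ℚ k                       ≤⟨ *-mono-≤-nonNeg (≤-trans (0≤fromℕ (C ℕ.* 1)) (<⇒≤ C<a₁)) (^-nonNeg k (<⇒≤ 0<cₗ))
                                                           (<⇒≤ C<a₁) (^ᶜ-lower c (<⇒≤ 0<cₗ) cₗ∈ k a₂∈) ⟩
        a₁ * a₂                                         ≤⟨ a₁a₂≤a ⟩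
        a                                               ∎

-- The estimates and their stretch

module Estimates where

  open Landmarks
  open Distances
  open Queries
  open import Defs using (Graph; IsDistance; decode; toℤ⁺; stretched)
  open import Data.Empty using (⊥-elim)
  open import Data.Fin.Base using (Fin)
  open import Data.Integer.Base as ℤ using (ℤ; +_; +≤+)
  import Data.Integer.Properties as ℤₚ
  open import Data.List.Base using (List; [])
  open import Data.Nat.Base as ℕ using (ℕ; zero; suc; _+_; _*_; _≤_; _<_; z≤n; s≤s)
  open import Data.Nat.Properties
  open import Data.Nat.Tactic.RingSolver using (solve-∀)
  open import Data.Product.Base using (∃; _×_; _,_)
  open import Data.Sum.Base using (_⊎_; inj₁; inj₂)
  open import Function.Base using (_$_)
  open import Relation.Binary.PropositionalEquality
  open import Relation.Binary.Construct.Add.Supremum.NonStrict ℤ._≤_ using (_≤⁺_; [_]; _≤⊤⁺)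
  open import Relation.Nullary.Decidable using (yes; no)
  open import Relation.Nullary.Negation.Core using (¬_)

  module Estimate {n : ℕ} (G : Graph n) (a₀ : Fin n) (as : List (Fin n)) (k : ℕ) where
    open Graph G using (finite; infinite)

    d : Fin n → Fin n → ℕ
    d = dist G

    p : Fin n → Fin n
    p = nearest d a₀ as

    r : Fin n → ℕ
    r = radius d a₀ as

    -- The encoding that `decode` inverts, with 0 for ∞.
    code : Fin n → Fin n → ℕ
    code a v with d a v <? n
    ... | yes _ = suc (d a v)
    ... | no _  = 0

    code≤n : ∀ a v → code a v ≤ n
    code≤n a v with d a v <? n
    ... | yes lt = lt
    ... | no _   = z≤n

    far : Fin n → Fin n → ℕ
    far u v = farAnswer (code (p u) v) (r u)

    -- The stretch condition within ℕ: the possibly negative 1 - k is moved to the other side, and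
    -- the maximum becomes a disjunction.
    Good : Fin n → Fin n → ℕ → Set
    Good u v m =
      (d u v < n → ∃ λ e → m ≡ suc e × d u v ≤ e × (e ≤ d u v ⊎ e + k ≤ 2 * d u v + 1)) ×
      (¬ d u v < n → m ≡ 0)

    good-stored : ∀ {u v} → Stored G r k u v → Good u v (suc (d u v))
    good-stored ((d<n , _) , _) = (λ _ → _ , refl , ≤-refl , inj₁ ≤-refl) , λ d≮n → ⊥-elim (d≮n d<n)

    good-sym : ∀ {u v m} → Good u v m → Good v u m
    good-sym {u} {v} {m} = subst
      (λ x → (x < n → ∃ λ e → m ≡ suc e × x ≤ e × (e ≤ x ⊎ e + k ≤ 2 * x + 1)) × (¬ x < n → m ≡ 0))
      (dist-sym G u v)

    stored-sym : ∀ {u v} → Stored G r k u v → Stored G r k v u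
    stored-sym {u} {v} ((d<n , d≤) , 1≤ru , 1≤rv) =
      (subst (_< n) (dist-sym G u v) d<n ,
       subst₂ (λ x y → 2 + x ≤ y + k) (dist-sym G u v) (+-comm (r u) (r v)) d≤) , 1≤rv , 1≤ru

    -- With x the distance and a ≤ b the radii, the detour is at most x + 2 a ≤ x + a + b, and a + b
    -- + k ≤ x + 1 for a pair that fails the storage condition. For a = 0 the detour is exact.
    far-upper : ∀ x a b → a ≤ b → ¬ (2 + x ≤ a + b + k × 1 ≤ a × 1 ≤ b) → ∀ {e} → e ≤ (a + x) + a →
      e ≤ x ⊎ e + k ≤ 2 * x + 1
    far-upper x zero b _ _ {e} e≤ = inj₁ (≤-trans e≤ (≤-reflexive (+-identityʳ x)))
    far-upper x a@(suc _) b a≤b ¬s {e} e≤ with 2 + x ≤? a + b + k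
    ... | yes s = ⊥-elim (¬s (s , s≤s z≤n , ≤-trans (s≤s z≤n) a≤b))
    ... | no s≰ = inj₂ $ begin
      e + k             ≤⟨ +-monoˡ-≤ k e≤ ⟩
      a + x + a + k     ≤⟨ +-monoˡ-≤ k (+-monoʳ-≤ (a + x) a≤b) ⟩
      a + x + b + k     ≡⟨ e₁ a x b k ⟩
      x + (a + b + k)   ≤⟨ +-monoʳ-≤ x (ℕ.s≤s⁻¹ (≰⇒> s≰)) ⟩
      x + suc x         ≡⟨ e₂ x ⟩
      2 * x + 1         ∎
      where
      open ≤-Reasoning
      e₁ : ∀ a x b k → a + x + b + k ≡ x + (a + b + k)
      e₁ = solve-∀
      e₂ : ∀ x → x + suc x ≡ 2 * x + 1
      e₂ = solve-∀

    good-far : ∀ {u v} → ¬ Stored G r k u v → r u ≤ r v → Good u v (far u v)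
    good-far {u} {v} ¬stored ru≤rv with d (p u) v <? n
    ... | yes pv<n = near , λ d≮n → ⊥-elim (d≮n (connected-trans G (connected-sym G ru<n) pv<n))
      where
      ru<n : d (p u) u < n
      -- The landmark p u also competes for v, so r u ≤ r v ≤ d (p u) v.
      ru<n = ≤-<-trans ru≤rv (≤-<-trans (nearest-≤ d a₀ as v (nearest-∈ d a₀ as u)) pv<n)
      near : d u v < n → ∃ λ e → suc (d (p u) v) + r u ≡ suc e × d u v ≤ e × (e ≤ d u v ⊎ e + k ≤ 2 * d u v + 1)
      near d<n = d (p u) v + r u , refl ,
        ≤-trans (dist-triangle G u (p u) v) (≤-trans (≤-reflexive (+-comm (d u (p u)) (d (p u) v)))
          (+-monoʳ-≤ (d (p u) v) (dist-sym-≤ G u (p u)))) ,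
        far-upper (d u v) (r u) (r v) ru≤rv (λ { (s , 1≤ru , 1≤rv) → ¬stored ((d<n , s) , 1≤ru , 1≤rv) })
          (+-monoˡ-≤ (r u) (dist-triangle G (p u) u v))
    ... | no pv≮n = near , λ _ → refl
      where
      near : d u v < n → ∃ λ e → 0 ≡ suc e × d u v ≤ e × (e ≤ d u v ⊎ e + k ≤ 2 * d u v + 1)
      near d<n with r u <? n
      ... | yes ru<n = ⊥-elim (pv≮n (connected-trans G ru<n d<n))
      -- A component without landmarks has radii n, the code of ∞, so all its pairs meet the storage
      -- condition.
      ... | no ru≮n  = ⊥-elim (¬stored ((d<n , d≤) , 1≤ru , ≤-trans 1≤ru ru≤rv))
        where
        1≤ru : 1 ≤ r u
        1≤ru = ≤-trans (≤-trans (s≤s z≤n) d<n) (≮⇒≥ ru≮n)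
        d≤ : 2 + d u v ≤ r u + r v + k
        d≤ = ≤-trans (+-mono-≤ 1≤ru (≤-trans d<n (≤-trans (≮⇒≥ ru≮n) ru≤rv))) (m≤m+n _ k)

    answer : Fin n → Fin n → ℕ
    answer u v with stored? G r k u v | r u ≤? r v
    ... | yes _ | _     = suc (d u v)
    ... | no _  | yes _ = far u v
    ... | no _  | no _  = far v u

    answer-≤ : ∀ {u v} → ¬ Stored G r k u v → r u ≤ r v → far u v ≡ answer u v
    answer-≤ {u} {v} ¬s le with stored? G r k u v | r u ≤? r v
    ... | yes s | _     = ⊥-elim (¬s s)
    ... | no _  | yes _ = refl
    ... | no _  | no ≰  = ⊥-elim (≰ le)

    answer-≰ : ∀ {u v} → ¬ Stored G r k u v → ¬ r u ≤ r v → far v u ≡ answer u v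
    answer-≰ {u} {v} ¬s ≰ with stored? G r k u v | r u ≤? r v
    ... | yes s | _      = ⊥-elim (¬s s)
    ... | no _  | yes le = ⊥-elim (≰ le)
    ... | no _  | no _   = refl

    answer-good : ∀ u v → Good u v (answer u v)
    answer-good u v with stored? G r k u v | r u ≤? r v
    ... | yes s | _     = good-stored s
    ... | no ¬s | yes ≤ = good-far ¬s ≤
    ... | no ¬s | no ≰  = good-sym (good-far (λ s → ¬s (stored-sym s)) (<⇒≤ (≰⇒> ≰)))

    good⇒stretch : ∀ {u v m} → Good u v m → ∃ λ δ →
      IsDistance G u v δ × toℤ⁺ δ ≤⁺ toℤ⁺ (decode m) × toℤ⁺ (decode m) ≤⁺ stretched (+ 2) (+ 1 ℤ.- + k) δ
    good⇒stretch {u} {v} (near , apart) with d u v <? n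
    ... | no d≮n rewrite apart d≮n =
      _ , infinite (λ w → d≮n (walk⇒dist<n G w)) , (_ ≤⊤⁺) , (_ ≤⊤⁺)
    ... | yes d<n with near d<n
    ... | e , refl , d≤e , upper =
      _ , finite (dist-walk G d<n) (dist-least G) , [ +≤+ d≤e ] , [ bound upper ]
      where
      bound : e ≤ d u v ⊎ e + k ≤ 2 * d u v + 1 → + e ℤ.≤ + d u v ℤ.⊔ (+ 2 ℤ.* + d u v ℤ.+ (+ 1 ℤ.- + k))
      bound (inj₁ e≤d) = ℤₚ.≤-trans (+≤+ e≤d) (ℤₚ.i≤i⊔j _ _)
      bound (inj₂ ek≤) = ℤₚ.≤-trans lower (ℤₚ.i≤j⊔i _ _)
        where
        open ℤₚ.≤-Reasoning
        lower : + e ℤ.≤ + 2 ℤ.* + d u v ℤ.+ (+ 1 ℤ.- + k)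
        lower = begin
          + e                                       ≡⟨ sym (ℤₚ.+-identityʳ (+ e)) ⟩
          + e ℤ.+ + 0                               ≡⟨ cong (λ z → (+ e) ℤ.+ z) (sym (ℤₚ.+-inverseʳ (+ k))) ⟩
          + e ℤ.+ (+ k ℤ.- + k)                     ≡⟨ sym (ℤₚ.+-assoc (+ e) (+ k) (ℤ.- + k)) ⟩
          + (e + k) ℤ.- + k                         ≤⟨ ℤₚ.+-monoˡ-≤ (ℤ.- + k) (+≤+ ek≤) ⟩
          + (2 * d u v) ℤ.+ + 1 ℤ.- + k             ≡⟨ cong (λ z → z ℤ.+ + 1 ℤ.- + k) (ℤₚ.pos-* 2 (d u v)) ⟩
          + 2 ℤ.* + d u v ℤ.+ + 1 ℤ.- + k           ≡⟨ ℤₚ.+-assoc (+ 2 ℤ.* + d u v) (+ 1) (ℤ.- + k) ⟩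
          + 2 ℤ.* + d u v ℤ.+ (+ 1 ℤ.- + k)         ∎

-- A static dictionary for the stored pairs

module Dictionaries where

  open Sums
  open DoubleDisplacement
  open Distances using (length-filter-tabulate)
  open import Data.Empty using (⊥-elim)
  open import Data.Fin.Base as F using (Fin; toℕ)
  import Data.Fin.Properties as Finₚ
  open import Data.List.Base using (List; []; _∷_; _++_; length; lookup; filter; map; tabulate; allFin; cartesianProduct)
  open import Data.List.Properties using (filter-++; length-++; map-tabulate)
  open import Data.List.Membership.Propositional using (_∈_)
  open import Data.List.Membership.Propositional.Properties using (∈-filter⁺; ∈-filter⁻; ∈-cartesianProduct⁺; ∈-allFin; ∈-lookup)
  open import Data.List.Relation.Unary.All as All using (All; []; _∷_)
  open import Data.List.Relation.Unary.AllPairs using ([]; _∷_)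
  open import Data.List.Relation.Unary.Any using (index)
  open import Data.List.Relation.Unary.Any.Properties using (lookup-index)
  open import Data.List.Relation.Unary.Unique.Propositional using (Unique)
  open import Data.List.Relation.Unary.Unique.Propositional.Properties using (filter⁺; cartesianProduct⁺; allFin⁺)
  open import Data.Nat.Base using (ℕ; zero; suc; _+_; _*_; _≤_; _<_; z≤n)
  open import Data.Nat.Properties
  open import Data.Product.Base using (∃; _×_; _,_; proj₁; proj₂)
  open import Function.Base using (_∘_)
  open import Relation.Binary.PropositionalEquality
  open import Relation.Nullary.Decidable using (Dec; yes; no)
  open import Relation.Nullary.Negation.Core using (¬_)

  lookup-injective : ∀ {A : Set} {xs : List A} → Unique xs → ∀ i j → lookup xs i ≡ lookup xs j → i ≡ j
  lookup-injective (x∉ ∷ u) F.zero    F.zero    _  = refl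
  lookup-injective (x∉ ∷ u) F.zero    (F.suc j) eq = ⊥-elim (All.lookup x∉ (∈-lookup j) eq)
  lookup-injective (x∉ ∷ u) (F.suc i) F.zero    eq = ⊥-elim (All.lookup x∉ (∈-lookup i) (sym eq))
  lookup-injective (x∉ ∷ u) (F.suc i) (F.suc j) eq = cong F.suc (lookup-injective u i j eq)

  length-filter-product : ∀ {m n} {A B : Set} {P : A × B → Set} (P? : ∀ x → Dec (P x)) (f : Fin m → A) (g : Fin n → B) →
    length (filter P? (cartesianProduct (tabulate f) (tabulate g))) ≡ ∑[ i < m ] ∑[ j < n ] 𝟙 (P? (f i , g j))
  length-filter-product {zero}      P? f g = sym (∑-zero _)
  length-filter-product {suc m} {n} P? f g = begin
    length (filter P? (map (f₀ ,_) ys ++ rest))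
      ≡⟨ cong length (filter-++ P? (map (f₀ ,_) ys) rest) ⟩
    length (filter P? (map (f₀ ,_) ys) ++ filter P? rest)
      ≡⟨ length-++ (filter P? (map (f₀ ,_) ys)) ⟩
    length (filter P? (map (f₀ ,_) ys)) + length (filter P? rest)
      ≡⟨ cong₂ _+_ (trans (cong (length ∘ filter P?) (map-tabulate g (f₀ ,_))) (length-filter-tabulate P? (λ j → f₀ , g j)))
                   (length-filter-product P? (f ∘ F.suc) g) ⟩
    ∑[ j < n ] 𝟙 (P? (f₀ , g j)) + ∑[ i < m ] ∑[ j < n ] 𝟙 (P? (f (F.suc i) , g j))
      ≡⟨ sym (∑-suc (λ i → ∑[ j < n ] 𝟙 (P? (f i , g j)))) ⟩
    ∑[ i < suc m ] ∑[ j < n ] 𝟙 (P? (f i , g j)) ∎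
    where
    open ≡-Reasoning
    f₀ = f F.zero
    ys = tabulate g
    rest = cartesianProduct (tabulate (f ∘ F.suc)) ys

  -- A key records only the slot, not the pair: the slot fixes R, so slot and position determine v,
  -- and then slot and v determine u.
  record Dictionary {n : ℕ} (S : Fin n → Fin n → Set) (value : Fin n → Fin n → ℕ) (N V : ℕ) : Set where
    field
      T R keys values : ℕ → ℕ

    slot : Fin n → Fin n → ℕ
    slot u v = T (toℕ v) + toℕ u

    position : Fin n → Fin n → ℕ
    position u v = R (slot u v) + toℕ v

    field
      T<      : ∀ v → v < n → T v < suc N
      R<      : ∀ f → f < n + suc N → R f < suc (3 * N)
      keys≤   : ∀ i → keys i ≤ n + suc N
      values≤ : ∀ i → values i ≤ V
      hit     : ∀ {u v} → S u v → keys (position u v) ≡ slot u v × values (position u v) ≡ value u v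
      miss    : ∀ {u v} → ¬ S u v → keys (position u v) ≢ slot u v

    slot< : ∀ u v → slot u v < n + suc N
    slot< u v = subst (_< n + suc N) (+-comm (toℕ u) _)
      (+-mono-<-≤ (Finₚ.toℕ<n u) (<⇒≤ (T< (toℕ v) (Finₚ.toℕ<n v))))

    position< : ∀ u v → position u v < suc (3 * N) + n
    position< u v = +-mono-<-≤ (R< _ (slot< u v)) (<⇒≤ (Finₚ.toℕ<n v))

  dictionary : ∀ {n} {S : Fin n → Fin n → Set} (S? : ∀ u v → Dec (S u v)) (value : Fin n → Fin n → ℕ) {V} →
    (∀ u v → value u v ≤ V) → Dictionary S value (∑[ u < n ] ∑[ v < n ] 𝟙 (S? u v)) V
  dictionary {n} {S} S? value {V} value≤V = subst (λ N → Dictionary S value N V)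
    (length-filter-product P? (λ i → i) (λ i → i)) record
    { T = T ; R = R ; keys = λ i → key (find i) ; values = λ i → val (find i)
    ; T< = proj₁ (proj₂ (proj₂ layout)) ; R< = proj₁ (proj₂ (proj₂ (proj₂ layout)))
    ; keys≤ = λ i → key≤ (find i) ; values≤ = λ i → val≤ (find i)
    ; hit = hit ; miss = miss }
    where
    P? : (p : Fin n × Fin n) → Dec (S (proj₁ p) (proj₂ p))
    P? (u , v) = S? u v

    pairs : List (Fin n × Fin n)
    pairs = filter P? (cartesianProduct (allFin n) (allFin n))

    N = length pairs

    row col : Fin N → Fin n
    row x = proj₁ (lookup pairs x)
    col x = proj₂ (lookup pairs x)

    layout = double-displacement (toℕ ∘ row) (toℕ ∘ col) (Finₚ.toℕ<n ∘ row) (Finₚ.toℕ<n ∘ col)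
      λ {x} {y} r c → lookup-injective (filter⁺ P? (cartesianProduct⁺ (allFin⁺ n) (allFin⁺ n))) x y
        (cong₂ _,_ (Finₚ.toℕ-injective r) (Finₚ.toℕ-injective c))

    T = proj₁ layout
    R = proj₁ (proj₂ layout)

    slot : Fin N → ℕ
    slot x = toℕ (row x) + T (toℕ (col x))

    pos : Fin N → ℕ
    pos x = R (slot x) + toℕ (col x)

    pos-injective : ∀ {x y} → pos x ≡ pos y → x ≡ y
    pos-injective = proj₂ (proj₂ (proj₂ (proj₂ layout)))

    slot< : ∀ x → slot x < n + suc N
    slot< x = +-mono-<-≤ (Finₚ.toℕ<n (row x)) (<⇒≤ (proj₁ (proj₂ (proj₂ layout)) (toℕ (col x)) (Finₚ.toℕ<n (col x))))

    find : ∀ i → Dec (∃ λ x → pos x ≡ i)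
    find i = Finₚ.any? λ x → pos x ≟ i

    key val : ∀ {i} → Dec (∃ λ x → pos x ≡ i) → ℕ
    key (yes (x , _)) = slot x
    -- This exceeds every slot, so a lookup that ends in a free position never matches.
    key (no _)        = n + suc N
    val (yes (x , _)) = value (row x) (col x)
    val (no _)        = 0

    key≤ : ∀ {i} (c : Dec (∃ λ x → pos x ≡ i)) → key c ≤ n + suc N
    key≤ (yes (x , _)) = <⇒≤ (slot< x)
    key≤ (no _)        = ≤-refl

    val≤ : ∀ {i} (c : Dec (∃ λ x → pos x ≡ i)) → val c ≤ V
    val≤ (yes (x , _)) = value≤V (row x) (col x)
    val≤ (no _)        = z≤n

    hit : ∀ {u v} → S u v → let i = R (T (toℕ v) + toℕ u) + toℕ v in
      key (find i) ≡ T (toℕ v) + toℕ u × val (find i) ≡ value u v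
    hit {u} {v} s = at (find _)
      where
      uv∈ : (u , v) ∈ pairs
      uv∈ = ∈-filter⁺ P? (∈-cartesianProduct⁺ (∈-allFin u) (∈-allFin v)) s
      x = index uv∈
      row≡ : row x ≡ u
      row≡ = cong proj₁ (sym (lookup-index uv∈))
      col≡ : col x ≡ v
      col≡ = cong proj₂ (sym (lookup-index uv∈))
      slot≡ : slot x ≡ T (toℕ v) + toℕ u
      slot≡ = trans (cong₂ (λ a b → toℕ a + T (toℕ b)) row≡ col≡) (+-comm (toℕ u) _)
      pos≡ : pos x ≡ R (T (toℕ v) + toℕ u) + toℕ v
      pos≡ = cong₂ (λ a b → R a + toℕ b) slot≡ col≡
      at : (c : Dec (∃ λ x → pos x ≡ R (T (toℕ v) + toℕ u) + toℕ v)) →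
        key c ≡ T (toℕ v) + toℕ u × val c ≡ value u v
      at (no none) = ⊥-elim (none (x , pos≡))
      at (yes (y , eq)) with pos-injective {y} {x} (trans eq (sym pos≡))
      ... | refl = slot≡ , cong₂ value row≡ col≡

    miss : ∀ {u v} → ¬ S u v → let i = R (T (toℕ v) + toℕ u) + toℕ v in key (find i) ≢ T (toℕ v) + toℕ u
    miss {u} {v} ¬s = at (find _)
      where
      at : (c : Dec (∃ λ x → pos x ≡ R (T (toℕ v) + toℕ u) + toℕ v)) → key c ≢ T (toℕ v) + toℕ u
      at (no _) eq = <⇒≢ (subst (_< n + suc N) (+-comm (toℕ u) (T (toℕ v)))
        (+-mono-<-≤ (Finₚ.toℕ<n u) (<⇒≤ (proj₁ (proj₂ (proj₂ layout)) (toℕ v) (Finₚ.toℕ<n v))))) (sym eq)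
      at (yes (x , pos≡)) slot≡ = ¬s (subst₂ S row≡ col≡ (proj₂ (∈-filter⁻ P? {xs = cartesianProduct (allFin n) (allFin n)} (∈-lookup {xs = pairs} x))))
        where
        col≡ : col x ≡ v
        col≡ = Finₚ.toℕ-injective (+-cancelˡ-≡ (R (slot x)) _ _
          (trans pos≡ (cong (λ f → R f + toℕ v) (sym slot≡))))
        row≡ : row x ≡ u
        row≡ = Finₚ.toℕ-injective (+-cancelʳ-≡ (T (toℕ (col x))) _ _
          (trans slot≡ (trans (+-comm (T (toℕ v)) (toℕ u)) (cong (λ c → toℕ u + T (toℕ c)) (sym col≡)))))

-- The memory image of a graph and its size

module Oracles where

  open Sums
  open Landmarks
  open Distances
  open Machines
  open Queries
  open Estimates
  open Dictionaries
  open import Defs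
  open import Data.Fin.Base as F using (Fin; toℕ)
  import Data.Fin.Properties as Finₚ
  open import Data.Integer.Base as ℤ using ()
  open import Data.List.Base using (List; []; _∷_; _++_; length; map; concat; applyUpTo; tabulate)
  open import Data.List.Properties using (length-++; length-applyUpTo; length-tabulate; length-map)
  open import Data.List.Membership.Propositional using (_∈_)
  open import Data.List.Relation.Unary.All as All using (All; []; _∷_)
  import Data.List.Relation.Unary.All.Properties as Allₚ
  open import Data.List.Relation.Unary.Any using (index; here; there)
  open import Data.Maybe.Base using (just)
  open import Data.Nat.Base as ℕ using (ℕ; zero; suc; _+_; _*_; _^_; _≤_; _<_; s≤s; NonZero; >-nonZero⁻¹)
  open import Data.Nat.ListAction using (sum)
  open import Data.Nat.Logarithm using (⌊log₂_⌋; ⌊log₂⌋-mono-≤; ⌊log₂[2^n]⌋≡n)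
  open import Data.Nat.Properties
  open import Data.Nat.Tactic.RingSolver using (solve-∀)
  open import Data.Product.Base using (_,_; proj₁; proj₂)
  open import Function.Base using (_∘_)
  open import Relation.Binary.PropositionalEquality
  open import Relation.Nullary.Decidable using (yes; no; True; toWitness)
  open import Relation.Nullary.Negation.Core using (¬_)

  n<2^bitLength : ∀ n → n < 2 ^ bitLength n
  n<2^bitLength n = ≰⇒> λ 2^≤n → <⇒≱ (n<1+n ⌊log₂ n ⌋)
    (subst (_≤ ⌊log₂ n ⌋) (⌊log₂[2^n]⌋≡n (suc ⌊log₂ n ⌋)) (⌊log₂⌋-mono-≤ 2^≤n))

  applyUpTo-!? : ∀ {A : Set} (f : ℕ → A) n i → i < n → applyUpTo f n !? i ≡ just (f i)
  applyUpTo-!? f (suc n) zero    _         = refl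
  applyUpTo-!? f (suc n) (suc i) (s≤s i<n) = applyUpTo-!? (f ∘ suc) n i i<n

  tabulate-!? : ∀ {A : Set} {n} (f : Fin n → A) i → tabulate f !? toℕ i ≡ just (f i)
  tabulate-!? f F.zero    = refl
  tabulate-!? f (F.suc i) = tabulate-!? (f ∘ F.suc) i

  concat-!? : ∀ {A B : Set} {n} (f : A → Fin n → B) {xs x} (x∈ : x ∈ xs) i →
    concat (map (tabulate ∘ f) xs) !? (toℕ (index x∈) * n + toℕ i) ≡ just (f x i)
  concat-!? f {x ∷ xs} (here refl) i = !?-++ˡ (tabulate (f x)) (toℕ i) (tabulate-!? (f x) i)
  concat-!? {n = n} f {y ∷ xs} {x} (there x∈) i =
    subst (λ m → (tabulate (f y) ++ concat (map (tabulate ∘ f) xs)) !? m ≡ just (f x i))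
      (trans (cong (_+ (toℕ (index x∈) * n + toℕ i)) (length-tabulate (f y))) (sym (+-assoc n _ _)))
      (trans (!?-++ʳ (tabulate (f y)) _) (concat-!? f x∈ i))

  length-concat : ∀ {A : Set} (xss : List (List A)) → length (concat xss) ≡ sum (map length xss)
  length-concat []         = refl
  length-concat (xs ∷ xss) = trans (length-++ xs) (cong (length xs +_) (length-concat xss))

  length-concat-tabulate : ∀ {A B : Set} {n} (f : A → Fin n → B) xs → length (concat (map (tabulate ∘ f) xs)) ≡ length xs * n
  length-concat-tabulate f []       = refl
  length-concat-tabulate f (x ∷ xs) = trans (length-++ (tabulate (f x))) (cong₂ _+_ (length-tabulate (f x)) (length-concat-tabulate f xs))

  length-image : ∀ as → length (image as) ≡ length as + sum (map length as)
  length-image as = trans (length-++ (bases (length as) as)) (cong₂ _+_ (length-bases (length as) as) (length-concat as))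

  bases≤ : ∀ b as → All (_≤ b + sum (map length as)) (bases b as)
  bases≤ b []       = []
  bases≤ b (a ∷ as) = m≤m+n b _ ∷ subst (λ m → All (_≤ m) (bases (b + length a) as)) (+-assoc b (length a) _) (bases≤ (b + length a) as)

  stored-count : ∀ {n} → Graph n → Fin n → List (Fin n) → ℕ → ℕ
  stored-count {n} G a₀ as k = ∑[ u < n ] ∑[ v < n ] 𝟙 (stored? G (radius (dist G) a₀ as) k u v)

  module Construction {n : ℕ} .{{_ : NonZero n}} (G : Graph n) (a₀ : Fin n) (as : List (Fin n)) (k t : ℕ) .{{_ : NonZero t}}
    (#as : length as ≡ t) (N≤ : stored-count G a₀ as k ≤ 16 * (n * t))
    (b : ℕ) (nt< : 130 * (n * t) < 2 ^ (b * bitLength n)) where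

    open Estimate G a₀ as k

    N w : ℕ
    N = stored-count G a₀ as k
    w = b * bitLength n

    open ≤-Reasoning

    1≤nt : 1 ≤ n * t
    1≤nt = *-mono-≤ (>-nonZero⁻¹ n) (>-nonZero⁻¹ t)

    n≤nt : n ≤ n * t
    n≤nt = m≤m*n n t

    opaque
      D : Dictionary (Stored G r k) (λ u v → suc (d u v)) N (suc n)
      D = dictionary (stored? G r k) (λ u v → suc (d u v)) (λ u v → s≤s (dist≤n G u v))
    open Dictionary D

    row : Fin n → ℕ
    row u = toℕ (index (nearest-∈ d a₀ as u))

    -- A position is a value of R, at most 3 N, plus a column below n.
    L : ℕ
    L = suc (3 * N) + n

    opaque
      arrays : List (List ℕ)
      arrays = applyUpTo T n ∷ applyUpTo R (n + suc N) ∷ applyUpTo keys L ∷ applyUpTo values L ∷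
               tabulate r ∷ tabulate (λ u → row u * n) ∷ concat (map (tabulate ∘ code) (a₀ ∷ as)) ∷ []

    opaque
      unfolding arrays

      length-arrays : length arrays ≡ 7
      length-arrays = refl

      total : sum (map length arrays) ≡ 6 * n + (2 + 1 + 7 * N) + suc t * n
      total = trans
        (cong₂ _+_ (length-applyUpTo T n) (cong₂ _+_ (length-applyUpTo R (n + suc N))
          (cong₂ _+_ (length-applyUpTo keys L) (cong₂ _+_ (length-applyUpTo values L)
            (cong₂ _+_ (length-tabulate r) (cong₂ _+_ (length-tabulate (λ u → row u * n))
              (cong (_+ 0) (trans (length-concat-tabulate code (a₀ ∷ as)) (cong (λ z → suc z * n) #as)))))))))
        (e n N (suc t * n))
        where
        e : ∀ n N x → n + (n + suc N + (suc (3 * N) + n + (suc (3 * N) + n + (n + (n + (x + 0)))))) ≡ 6 * n + (2 + 1 + 7 * N) + x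
        e = solve-∀

    -- R, keys and values contribute 7 N cells, and N ≤ 16 n t. The header and three single cells
    -- give 10, and 7 n includes the row of a₀, so the constant is 10 + 7 + 1 + 7 · 16 = 130.
    size≤ : 7 + sum (map length arrays) ≤ 130 * (n * t)
    size≤ = begin
      7 + sum (map length arrays)                                         ≡⟨ cong (7 +_) total ⟩
      7 + (6 * n + (2 + 1 + 7 * N) + (n + t * n))                         ≡⟨ e₁ n N t ⟩
      10 * 1 + 7 * n + n * t + 7 * N                                      ≤⟨ +-mono-≤ (+-monoˡ-≤ (n * t) (+-mono-≤ (*-monoʳ-≤ 10 1≤nt) (*-monoʳ-≤ 7 n≤nt))) (*-monoʳ-≤ 7 N≤) ⟩
      10 * (n * t) + 7 * (n * t) + n * t + 7 * (16 * (n * t))             ≡⟨ e₂ (n * t) ⟩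
      130 * (n * t)                                                       ∎
      where
      e₁ : ∀ n N t → 7 + (6 * n + (2 + 1 + 7 * N) + (n + t * n)) ≡ 10 * 1 + 7 * n + n * t + 7 * N
      e₁ = solve-∀
      e₂ : ∀ x → 10 * x + 7 * x + x + 7 * (16 * x) ≡ 130 * x
      e₂ = solve-∀

    length≤ : length (image arrays) ≤ 130 * (n * t)
    length≤ = subst (_≤ 130 * (n * t))
      (sym (trans (length-image arrays) (cong (_+ sum (map length arrays)) length-arrays))) size≤

    -- Stored words and intermediate sums are all bounded by c n t with c ≤ 130, so arithmetic never
    -- wraps around.
    below : ∀ c {c≤ : True (c ≤? 130)} {x} → x ≤ c * (n * t) → x < 2 ^ w
    below c {c≤} x≤ = ≤-<-trans (≤-trans x≤ (*-monoˡ-≤ (n * t) (toWitness c≤))) nt<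

    n+n≤ : n + n ≤ 2 * (n * t)
    n+n≤ = ≤-trans (+-mono-≤ n≤nt n≤nt) (≤-reflexive (cong (n * t +_) (sym (+-identityʳ (n * t)))))

    n+sucN≤ : n + suc N ≤ 18 * (n * t)
    n+sucN≤ = ≤-trans (+-mono-≤ n≤nt (+-mono-≤ 1≤nt N≤)) (≤-reflexive (e (n * t)))
      where
      e : ∀ x → x + (x + 16 * x) ≡ 18 * x
      e = solve-∀

    L≤ : L ≤ 50 * (n * t)
    L≤ = ≤-trans (+-mono-≤ (+-mono-≤ 1≤nt (*-monoʳ-≤ 3 N≤)) n≤nt) (≤-reflexive (e (n * t)))
      where
      e : ∀ x → x + 3 * (16 * x) + x ≡ 50 * x
      e = solve-∀

    r≤n : ∀ u → r u ≤ n
    r≤n u = dist≤n G (p u) u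

    row≤ : ∀ u → row u ≤ t
    row≤ u = ℕ.s≤s⁻¹ (subst (row u <_) (cong suc #as) (Finₚ.toℕ<n (index (nearest-∈ d a₀ as u))))

    offset≤ : ∀ u → row u * n ≤ n * t
    offset≤ u = ≤-trans (*-monoˡ-≤ n (row≤ u)) (≤-reflexive (*-comm t n))

    cell< : ∀ u (v : Fin n) → row u * n + toℕ v < 2 ^ w
    cell< u v = below 2 (≤-trans (+-mono-≤ (offset≤ u) (≤-trans (<⇒≤ (Finₚ.toℕ<n v)) n≤nt))
      (≤-reflexive (cong (n * t +_) (sym (+-identityʳ (n * t))))))

    opaque
      unfolding arrays

      small : All (_< 2 ^ w) (image arrays)
      small = Allₚ.++⁺
        (All.map (λ x≤ → below 130 (≤-trans x≤ size≤)) (bases≤ 7 arrays))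
        (Allₚ.concat⁺ (
          Allₚ.applyUpTo⁺₁ T n (λ v<n → below 18 (≤-trans (<⇒≤ (T< _ v<n)) (≤-trans (m≤n+m (suc N) n) n+sucN≤))) ∷
          Allₚ.applyUpTo⁺₁ R (n + suc N) (λ f< → below 50 (≤-trans (<⇒≤ (R< _ f<)) (≤-trans (m≤m+n _ n) L≤))) ∷
          Allₚ.applyUpTo⁺₂ keys L (λ i → below 18 (≤-trans (keys≤ i) n+sucN≤)) ∷
          Allₚ.applyUpTo⁺₂ values L (λ i → below 2 (≤-trans (values≤ i) (≤-trans (+-monoˡ-≤ n (>-nonZero⁻¹ n)) n+n≤))) ∷
          Allₚ.tabulate⁺ (λ u → below 2 (≤-trans (r≤n u) (≤-trans (m≤m+n n n) n+n≤))) ∷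
          Allₚ.tabulate⁺ (λ u → below 1 (≤-trans (offset≤ u) (≤-reflexive (sym (+-identityʳ (n * t)))))) ∷
          Allₚ.concat⁺ (Allₚ.map⁺ (All.universal (λ a → Allₚ.tabulate⁺ (λ v → below 2 (≤-trans (code≤n a v) (≤-trans (m≤m+n n n) n+n≤)))) (a₀ ∷ as))) ∷ []))

    fits : length (image arrays) ≤ 2 ^ w
    fits = <⇒≤ (≤-<-trans length≤ nt<)

    open Query w arrays fits small
    open Execution w oracle arrays fits small using (Returns; memory; Entry; query-decodes)

    opaque
      unfolding arrays

      entry-T : ∀ v → v < n → Entry 0 v (T v)
      entry-T v v<n = _ , refl , applyUpTo-!? T n v v<n

      entry-R : ∀ f → f < n + suc N → Entry 1 f (R f)
      entry-R f f< = _ , refl , applyUpTo-!? R (n + suc N) f f<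

      entry-keys : ∀ i → i < L → Entry 2 i (keys i)
      entry-keys i i< = _ , refl , applyUpTo-!? keys L i i<

      entry-values : ∀ i → i < L → Entry 3 i (values i)
      entry-values i i< = _ , refl , applyUpTo-!? values L i i<

      entry-radius : ∀ u → Entry 4 (toℕ u) (r u)
      entry-radius u = _ , refl , tabulate-!? r u

      entry-offset : ∀ u → Entry 5 (toℕ u) (row u * n)
      entry-offset u = _ , refl , tabulate-!? (λ u → row u * n) u

      entry-code : ∀ u v → Entry 6 (row u * n + toℕ v) (code (p u) v)
      entry-code u v = _ , refl , concat-!? code (nearest-∈ d a₀ as u) v

    vertex< : ∀ (u : Fin n) → toℕ u < 2 ^ w
    vertex< u = below 2 (≤-trans (<⇒≤ (Finₚ.toℕ<n u)) (≤-trans (m≤m+n n n) n+n≤))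

    returns-answer : ∀ u v → Returns 39 (0 , Machine.inputs w oracle memory (toℕ u) (toℕ v)) (answer u v)
    returns-answer u v = query-returns (Machine.inputs w oracle memory (toℕ u) (toℕ v))
      (toℕ-toWord w (vertex< u)) (toℕ-toWord w (vertex< v)) (toℕ-toWord w (m^n>0 2 w))
      (entry-T (toℕ v) (Finₚ.toℕ<n v)) refl
      (below 18 (≤-trans (<⇒≤ (slot< u v)) n+sucN≤))
      (entry-R (slot u v) (slot< u v))
      (below 50 (≤-trans (<⇒≤ (position< u v)) L≤))
      (entry-keys (position u v) (position< u v)) (entry-values (position u v) (position< u v))
      (entry-radius u) (entry-radius v) (entry-offset u) (entry-offset v) (entry-code u v) (entry-code v u)
      (cell< u v) (cell< v u)
      (below 2 (≤-trans (+-mono-≤ (code≤n (p u) v) (r≤n u)) n+n≤))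
      (below 2 (≤-trans (+-mono-≤ (code≤n (p v) u) (r≤n v)) n+n≤))
      on-hit on-miss-≤ on-miss-≰
      where
      on-hit : keys (position u v) ≡ slot u v → values (position u v) ≡ answer u v
      on-hit key≡ with stored? G r k u v
      ... | yes s = proj₂ (hit s)
      ... | no ¬s with () ← miss ¬s key≡
      ¬stored : keys (position u v) ≢ slot u v → ¬ Stored G r k u v
      ¬stored key≢ s = key≢ (proj₁ (hit s))
      on-miss-≤ : keys (position u v) ≢ slot u v → r u ≤ r v → far u v ≡ answer u v
      on-miss-≤ key≢ = answer-≤ (¬stored key≢)
      on-miss-≰ : keys (position u v) ≢ slot u v → ¬ r u ≤ r v → far v u ≡ answer u v
      on-miss-≰ key≢ = answer-≰ (¬stored key≢)

    ado : ADO oracle 39 b G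
    ado = record
      { memory   = memory
      ; estimate = λ u v → decode (answer u v)
      ; answers  = λ u v → query-decodes 39 (toℕ u) (toℕ v) (returns-answer u v)
      }

    ado-space : space ado ≤ 130 * (n * t)
    ado-space = ≤-trans (≤-reflexive (length-map (toWord w) (image arrays))) length≤

    ado-stretch : HasStretch (ℤ.+ 2) (ℤ.+ 1 ℤ.- ℤ.+ k) ado
    ado-stretch u v = good⇒stretch (answer-good u v)

-- Choice of the parameters and the theorem

open Landmarks
open Distances
open Machines
open IntegerRoots
open RationalBounds
open SpaceBound
open Oracles
open import Defs
open import Data.Fin.Base as F using (Fin)
open import Data.Integer.Base as ℤ using (+_)
open import Data.List.Base using ([])
open import Data.Nat.Base as ℕ using (ℕ; zero; suc; NonZero; z≤n; s≤s)
import Data.Nat.Properties as ℕₚ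
open import Data.Nat.Tactic.RingSolver using (solve-∀)
open import Data.Product.Base using (∃; _×_; _,_; proj₁; proj₂)
open import Data.Rational.Base as ℚ using (0ℚ; 1ℚ)
import Data.Rational.Properties as ℚₚ
open import Function.Base using (_$_)
open import Relation.Binary.PropositionalEquality

-- Rounding the cube root up at most doubles it, whence the factor 8.
integer-cube-root : ∀ a → 1 ℕ.≤ a → ∃ λ t → a ℕ.≤ suc t ℕ.^ 3 × suc t ℕ.^ 3 ℕ.≤ 8 ℕ.* a
integer-cube-root a 1≤a with integer-root 3 1 a ℕₚ.≤-refl 1≤a
... | t , below , above = t , ℕₚ.≤-trans above (ℕₚ.≤-reflexive (ℕₚ.*-identityʳ _)) , upper t below
  where
  open ℕₚ.≤-Reasoning
  upper : ∀ t → t ℕ.^ 3 ℕ.* 1 ℕ.< a → suc t ℕ.^ 3 ℕ.≤ 8 ℕ.* a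
  upper zero _ = ℕₚ.*-mono-≤ {1} {8} (s≤s z≤n) 1≤a
  upper t@(suc t′) lt = begin
    suc t ℕ.^ 3        ≤⟨ ℕₚ.^-monoˡ-≤ 3 (s≤s (ℕₚ.m≤n+m t t′)) ⟩
    (t ℕ.+ t) ℕ.^ 3    ≡⟨ e t ⟩
    8 ℕ.* (t ℕ.^ 3 ℕ.* 1) ≤⟨ ℕₚ.*-monoʳ-≤ 8 (ℕₚ.<⇒≤ lt) ⟩
    8 ℕ.* a            ∎
    where
    e : ∀ t → (t ℕ.+ t) ℕ.* ((t ℕ.+ t) ℕ.* ((t ℕ.+ t) ℕ.* 1)) ≡ 8 ℕ.* (t ℕ.* (t ℕ.* (t ℕ.* 1)) ℕ.* 1)
    e = solve-∀

-- The chain t² N ≤ D t² Ψ ≤ 16 D n³ ≤ 16 n t³ shows that with t³ ≥ n² D the dictionary is of the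
-- order of the landmark table.
pairs≤ : ∀ n t N D Ψ .{{_ : NonZero t}} → N ℕ.≤ D ℕ.* Ψ → t ℕ.* t ℕ.* Ψ ℕ.≤ 16 ℕ.* (n ℕ.* n ℕ.* n) →
  n ℕ.* n ℕ.* D ℕ.≤ t ℕ.^ 3 → N ℕ.≤ 16 ℕ.* (n ℕ.* t)
pairs≤ n t N D Ψ N≤ Ψ≤ t³≥ = ℕₚ.*-cancelˡ-≤ (t ℕ.* t) {{ℕₚ.m*n≢0 t t}} $ begin
  t ℕ.* t ℕ.* N                        ≤⟨ ℕₚ.*-monoʳ-≤ (t ℕ.* t) N≤ ⟩
  t ℕ.* t ℕ.* (D ℕ.* Ψ)                ≡⟨ e₁ t D Ψ ⟩
  D ℕ.* (t ℕ.* t ℕ.* Ψ)                ≤⟨ ℕₚ.*-monoʳ-≤ D Ψ≤ ⟩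
  D ℕ.* (16 ℕ.* (n ℕ.* n ℕ.* n))       ≡⟨ e₂ D n ⟩
  16 ℕ.* n ℕ.* (n ℕ.* n ℕ.* D)         ≤⟨ ℕₚ.*-monoʳ-≤ (16 ℕ.* n) t³≥ ⟩
  16 ℕ.* n ℕ.* t ℕ.^ 3                 ≡⟨ e₃ n t ⟩
  t ℕ.* t ℕ.* (16 ℕ.* (n ℕ.* t))       ∎
  where
  open ℕₚ.≤-Reasoning
  e₁ : ∀ t D Ψ → t ℕ.* t ℕ.* (D ℕ.* Ψ) ≡ D ℕ.* (t ℕ.* t ℕ.* Ψ)
  e₁ = solve-∀
  e₂ : ∀ D n → D ℕ.* (16 ℕ.* (n ℕ.* n ℕ.* n)) ≡ 16 ℕ.* n ℕ.* (n ℕ.* n ℕ.* D)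
  e₂ = solve-∀
  e₃ : ∀ n t → 16 ℕ.* n ℕ.* (t ℕ.* (t ℕ.* (t ℕ.* 1))) ≡ t ℕ.* t ℕ.* (16 ℕ.* (n ℕ.* t))
  e₃ = solve-∀

-- With X = 2 ^ `bitLength n`, the constant 130 · 8 < 2¹¹ takes eleven factors X, n³ takes three,
-- and (Δ + 1)ᵏ takes k; hence the factor 14 + k in the word size.
word-size : ∀ X n k Δ t → 2 ℕ.≤ X → n ℕ.≤ X → suc Δ ℕ.≤ X → t ℕ.≤ 8 ℕ.* (n ℕ.* n ℕ.* suc Δ ℕ.^ k) →
  130 ℕ.* (n ℕ.* t) ℕ.< X ℕ.^ (14 ℕ.+ k)
word-size X n k Δ t 2≤X n≤X sucΔ≤X t≤ = begin-strict
  130 ℕ.* (n ℕ.* t)                                 ≤⟨ ℕₚ.*-monoʳ-≤ 130 (ℕₚ.*-monoʳ-≤ n t≤) ⟩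
  130 ℕ.* (n ℕ.* (8 ℕ.* (n ℕ.* n ℕ.* suc Δ ℕ.^ k))) ≡⟨ e₁ 130 8 n (suc Δ ℕ.^ k) ⟩
  130 ℕ.* 8 ℕ.* (n ℕ.^ 3 ℕ.* suc Δ ℕ.^ k)           ≤⟨ ℕₚ.*-monoʳ-≤ (130 ℕ.* 8) (ℕₚ.*-mono-≤ (ℕₚ.^-monoˡ-≤ 3 n≤X) (ℕₚ.^-monoˡ-≤ k sucΔ≤X)) ⟩
  130 ℕ.* 8 ℕ.* (X ℕ.^ 3 ℕ.* X ℕ.^ k)               ≡⟨ cong (130 ℕ.* 8 ℕ.*_) (sym (ℕₚ.^-distribˡ-+-* X 3 k)) ⟩
  130 ℕ.* 8 ℕ.* X ℕ.^ (3 ℕ.+ k)                     <⟨ ℕₚ.*-monoˡ-< (X ℕ.^ (3 ℕ.+ k)) {{ℕₚ.m^n≢0 X (3 ℕ.+ k) {{X≢0}}}} (ℕₚ.<ᵇ⇒< 1040 2048 _) ⟩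
  2 ℕ.^ 11 ℕ.* X ℕ.^ (3 ℕ.+ k)                      ≤⟨ ℕₚ.*-monoˡ-≤ (X ℕ.^ (3 ℕ.+ k)) (ℕₚ.^-monoˡ-≤ 11 2≤X) ⟩
  X ℕ.^ 11 ℕ.* X ℕ.^ (3 ℕ.+ k)                      ≡⟨ sym (ℕₚ.^-distribˡ-+-* X 11 (3 ℕ.+ k)) ⟩
  X ℕ.^ (14 ℕ.+ k)                                  ∎
  where
  open ℕₚ.≤-Reasoning
  X≢0 : NonZero X
  X≢0 = ℕ.>-nonZero (ℕₚ.≤-trans (s≤s z≤n) 2≤X)
  e₁ : ∀ a b n D → a ℕ.* (n ℕ.* (b ℕ.* (n ℕ.* n ℕ.* D))) ≡ a ℕ.* b ℕ.* (n ℕ.* (n ℕ.* (n ℕ.* 1)) ℕ.* D)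
  e₁ = solve-∀

SpaceBound : ℝ → ℕ → ℕ → (n : ℕ) → ℝ → ℕ → Set
SpaceBound c k C n ε S =
  S ≤ᶜ ι (C ℕ.* bitLength n ℕ.^ 0) ⊗ ⌈ c ⌉ ^ᶜ k ⊗ n ^ˣ ((+ 2 ℚ./ 1) ⊖ (+ k ℚ./ 3) ⊙ ε)

-- All factors of the bound are nonnegative; this covers the empty memory of the graph without
-- vertices.
zero-space : ∀ c → 0ℚ <ℝ c → ∀ k C n ε → SpaceBound c k C n ε 0
zero-space c 0<c k C n ε q (a , b , (a₁ , a₂ , C<a₁ , a₂∈ , a₁a₂≤a) , (_ , _ , 0<b , _) , ab≤q) =
  ℚₚ.≤-trans (*-mono-≤-nonNeg {0ℚ} {a} {0ℚ} {b} 0≤a ℚₚ.≤-refl 0≤a (ℚₚ.<⇒≤ 0<b)) ab≤q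
  where
  cₗ = ℝ.lower-rounded c 0<c
  0≤a₂ : 0ℚ ℚ.≤ a₂
  0≤a₂ = ℚₚ.≤-trans (^-nonNeg k (ℚₚ.<⇒≤ (proj₁ (proj₂ cₗ))))
    (^ᶜ-lower c (ℚₚ.<⇒≤ (proj₁ (proj₂ cₗ))) (proj₂ (proj₂ cₗ)) k a₂∈)
  0≤a₁ : 0ℚ ℚ.≤ a₁
  0≤a₁ = ℚₚ.≤-trans (0≤fromℕ (C ℕ.* bitLength n ℕ.^ 0)) (ℚₚ.<⇒≤ C<a₁)
  0≤a : 0ℚ ℚ.≤ a
  0≤a = ℚₚ.≤-trans (*-mono-≤-nonNeg {0ℚ} {a₁} {0ℚ} {a₂} 0≤a₁ ℚₚ.≤-refl 0≤a₁ 0≤a₂) a₁a₂≤a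

ado-exists : ∀ {n} .{{_ : NonZero n}} (G : Graph n) → Fin n → ∀ k → ∃ λ t → 
  t ℕ.^ 3 ℕ.≤ 8 ℕ.* (n ℕ.* n ℕ.* suc (maxDegree G) ℕ.^ k) ×
  ∃ λ (A : ADO oracle 39 (14 ℕ.+ k) G) →
    HasStretch (+ 2) (+ 1 ℤ.- + k) A × space A ℕ.≤ 130 ℕ.* (n ℕ.* t)
ado-exists {n} G a₀ k = t , t³≤ , ado , ado-stretch , ado-space
  where
  D = suc (maxDegree G) ℕ.^ k
  root = integer-cube-root (n ℕ.* n ℕ.* D) (ℕₚ.*-mono-≤ (ℕₚ.*-mono-≤ (ℕ.>-nonZero⁻¹ n) (ℕ.>-nonZero⁻¹ n)) (ℕₚ.m^n>0 (suc (maxDegree G)) k))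
  t = suc (proj₁ root)
  t³≤ = proj₂ (proj₂ root)
  as = proj₁ (landmarks (dist G) a₀ t)
  #as = proj₁ (proj₂ (landmarks (dist G) a₀ t))
  energy≤ = proj₂ (proj₂ (landmarks (dist G) a₀ t))
  r = radius (dist G) a₀ as
  N≤ = pairs≤ n t _ D (energy (dist G) r) (∑close≤ G r k (stored? G r k) (stored⇒close G r k)) energy≤ (proj₁ (proj₂ root))
  open Construction G a₀ as k t #as N≤ (14 ℕ.+ k)
    (subst (130 ℕ.* (n ℕ.* t) ℕ.<_)
      (trans (ℕₚ.^-*-assoc 2 (bitLength n) (14 ℕ.+ k)) (cong (2 ℕ.^_) (ℕₚ.*-comm (bitLength n) (14 ℕ.+ k))))
      (word-size (2 ℕ.^ bitLength n) n k (maxDegree G) t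
        (ℕₚ.^-monoʳ-≤ 2 {1} {bitLength n} (s≤s z≤n)) (ℕₚ.<⇒≤ (n<2^bitLength n))
        (ℕₚ.≤-trans (s≤s (maxDegree≤n G)) (n<2^bitLength n)) (ℕₚ.≤-trans (n≤n^k t 3) t³≤)))

bounded-ado : ∀ c (0<c : 0ℚ <ℝ c) k .{{_ : NonZero k}} n .{{_ : NonZero n}} (G : Graph n) → Fin n → ∀ ε →
  ε ℝ≤ (+ 1 ℚ./ k) → maxDegree G ≤ᶜ ⌈ c ⌉ ⊗ n ^ˣ ((+ 1 ℚ./ k) ⊖ 1ℚ ⊙ ε) →
  ∃ λ (A : ADO oracle 39 (14 ℕ.+ k) G) →
    HasStretch (+ 2) (+ 1 ℤ.- + k) A × SpaceBound c k (proj₁ (space-bound c 0<c k 130)) n ε (space A)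
bounded-ado c 0<c k n G a₀ ε ε≤ Δ≤ = combine (ado-exists G a₀ k)
  where
  combine : (∃ λ t → t ℕ.^ 3 ℕ.≤ 8 ℕ.* (n ℕ.* n ℕ.* suc (maxDegree G) ℕ.^ k) ×
             ∃ λ (A : ADO oracle 39 (14 ℕ.+ k) G) →
               HasStretch (+ 2) (+ 1 ℤ.- + k) A × space A ℕ.≤ 130 ℕ.* (n ℕ.* t)) →
            ∃ λ (A : ADO oracle 39 (14 ℕ.+ k) G) →
              HasStretch (+ 2) (+ 1 ℤ.- + k) A × SpaceBound c k (proj₁ (space-bound c 0<c k 130)) n ε (space A)
  combine (t , t³≤ , A , stretch , size) =
    A , stretch , proj₂ (space-bound c 0<c k 130) n ε (maxDegree G) t (space A) ε≤ Δ≤ t³≤ size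

theorem1p4 : (c : ℝ) → 0ℚ <ℝ c →
    (k : ℕ) → .{{_ : NonZero k}} →
    ∃ λ (program : Program) → ∃ λ (time : ℕ) → ∃ λ (b : ℕ) →
    ∃ λ (C : ℕ) → ∃ λ (e : ℕ) →
    ∀ (n : ℕ) (G : Graph n) (ε : ℝ) →
    0ℚ <ℝ ε → ε ℝ≤ (+ 1 ℚ./ k) →
    maxDegree G ≤ᶜ ⌈ c ⌉ ⊗ n ^ˣ ((+ 1 ℚ./ k) ⊖ 1ℚ ⊙ ε) →
    ∃ λ (A : ADO program time b G) →
    HasStretch (+ 2) (+ 1 ℤ.- + k) A ×
    space A ≤ᶜ ι (C ℕ.* bitLength n ℕ.^ e) ⊗ ⌈ c ⌉ ^ᶜ k
    ⊗ n ^ˣ ((+ 2 ℚ./ 1) ⊖ (+ k ℚ./ 3) ⊙ ε)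
theorem1p4 c 0<c k = oracle , 39 , 14 ℕ.+ k , proj₁ (space-bound c 0<c k 130) , 0 , λ
  -- The graph without vertices offers no initial landmark and has no queries, so its memory is
  -- empty.
  { zero G ε _ _ _ → record { memory = [] ; estimate = λ () ; answers = λ () } , (λ ()) ,
                     zero-space c 0<c k (proj₁ (space-bound c 0<c k 130)) 0 ε
  -- Any vertex may serve as the initial landmark.
  ; n@(suc _) G ε _ ε≤ Δ≤ → bounded-ado c 0<c k n G F.zero ε ε≤ Δ≤
  }
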